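{- Let $\lambda\in\Lambda^+$ be a dominant weight and let $a\in\mathcal{F}$. Then $$\mathcal{I}_a(\lambda)=\bigsqcup_{\mu\in\Lambda^+,\ \mu\le\lambda} PB_a(\mu),$$ where the union runs over all dominant weights $\mu$ with $\mu\le\lambda$ in the dominance order, and the union is disjoint.
   Context: Fix $n\ge1$. Let $E=\{x\in\mathbb{R}^{n+1}:\sum_i x_i=0\}$ with the standard inner product $\langle-,-\rangle$, and let $\varepsilon_1,\dots,\varepsilon_{n+1}$ be the standard basis of $\mathbb{R}^{n+1}$. The root system of type $A_n$ is $\Phi=\{\varepsilon_i-\varepsilon_j: i\ne j\}$, with simple roots $\alpha_i=\varepsilon_i-\varepsilon_{i+1}$ ($1\le i\le n$), positive roots $\Phi^+=\{\varepsilon_i-\varepsilon_j:i<j\}$ and highest root $\tilde\alpha=\varepsilon_1-\varepsilon_{n+1}$. The fundamental weights $\varpi_1,\dots,\varpi_n\in E$ satisfy $\langle\varpi_i,\alpha_j\rangle=\delta_{ij}$; set $\varpi_0=0$. Let $\Lambda=\bigoplus_i\mathbb{Z}\varpi_i$ (weights), $\mathbb{Z}\Phi$ the root lattice, $\Lambda^+=\{\lambda\in\Lambda:\langle\lambda,\alpha_i\rangle\ge0\ \forall i\}$ (dominant weights). Dominance order on $\Lambda$: $\mu\le\lambda$ iff $\lambda-\mu\in\sum_i\mathbb{Z}_{\ge0}\alpha_i$. For $\alpha\in\Phi,k\in\mathbb{Z}$ let $H_{\alpha,k}=\{x:\langle x,\alpha\rangle=k\}$ and $s_{\alpha,k}$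 the orthogonal reflection in it. The affine Weyl group $W_{\mathrm{aff}}$ is the group generated by all $s_{\alpha,k}$; $W_{\mathrm f}$ is the subgroup generated by $s_{\alpha_i,0}$, with longest element $w_0$. Alcoves are the connected components of $E\setminus\bigcup H_{\alpha,k}$; the fundamental alcove is $\mathcal{A}_{\mathrm{id}}=\{x:-1<\langle x,\alpha\rangle<0\ \forall\alpha\in\Phi^+\}$, and $w\mapsto\mathcal{A}_w=w(\mathcal{A}_{\mathrm{id}})$ is a bijection from $W_{\mathrm{aff}}$ to alcoves. $(W_{\mathrm{aff}},S)$ is a Coxeter system with $S=\{s_{\alpha_1,0},\dots,s_{\alpha_n,0},s_0=s_{\tilde\alpha,-1}\}$, and $\le$ on $W_{\mathrm{aff}}$ denotes the Bruhat order. Let $\Pi^+=\{x\in E:0\le\langle x,\alpha_i\rangle\le1\ \forall i\}$, $\Pi^-=w_0(\Pi^+)$, and $\mathcal{F}=\{a\in W_{\mathrm{aff}}:\mathcal{A}_a\subset\Pi^-\}$. For $\lambda\in\Lambda^+$ and $a\in\mathcal{F}$, $\theta_a(\lambda)$ is the unique element of $W_{\mathrm{aff}}$ with $\mathcal{A}_{\theta_a(\lambda)}=\mathcal{A}_{w_0a}+\lambda$. Set $\mathcal{I}_a(\lambda)=\{x\in W_{\mathrm{aff}}:x\le\theta_a(\lambda)\}$. For $\mu,\lambda\in\Lambda^+$, write $\mu\lessdot\lambda$ if $\lambda$ covers $\mu$ in the poset $(\Lambda^+,\le)$ (dominance order restricted to dominant weights). The Paper Boat is $PB_a(\lambda)=\mathcal{I}_a(\lambda)\setminus\bigcup_{\mu\in\Lambda^+,\,\mu\lessdot\lambda}\mathcal{I}_a(\mu)$.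 -}

module Defs where

open import Data.Nat as ℕ using (ℕ; zero; suc)
open import Data.Fin as Fin using (Fin; zero; suc; toℕ; inject₁; fromℕ; opposite)
open import Data.Integer as ℤ using (ℤ; +_; -[1+_])
open import Data.Rational as ℚ using (ℚ; 0ℚ; 1ℚ; _+_; _*_; _-_; _/_)
open import Data.List using (List; []; _∷_; _++_; reverse; foldr; length)
open import Data.Product using (Σ; ∃; _×_; _,_)
open import Data.Bool using (if_then_else_)
open import Relation.Nullary using (¬_; does)
open import Relation.Binary.PropositionalEquality using (_≡_)
open import Function using (_∘_; id)
open import Data.Empty using (⊥)

-- Everything is set up for the root system of type A_n, n a fixed natural number.
-- Points of R^{n+1} are represented by their RATIONAL points.
module AType (n : ℕ) where

  N : ℕ
  N = suc n

  Pt : Set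
  Pt = Fin N → ℚ

  -- (affine) maps E → E, i.e. candidate elements of W_aff
  Map : Set
  Map = Pt → Pt

  Σᶠ : ∀ {m} → (Fin m → ℚ) → ℚ
  Σᶠ {zero}  f = 0ℚ
  Σᶠ {suc m} f = f zero + Σᶠ (f ∘ suc)

  _+ᵥ_ : Pt → Pt → Pt
  (x +ᵥ y) i = x i + y i

  _-ᵥ_ : Pt → Pt → Pt
  (x -ᵥ y) i = x i - y i

  _·ᵥ_ : ℚ → Pt → Pt
  (c ·ᵥ x) i = c * x i

  Σᵥ : ∀ {m} → (Fin m → Pt) → Pt
  Σᵥ f i = Σᶠ (λ k → f k i)

  ⟨_,_⟩ : Pt → Pt → ℚ
  ⟨ x , y ⟩ = Σᶠ (λ i → x i * y i)

  _≐_ : Pt → Pt → Set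
  x ≐ y = ∀ i → x i ≡ y i

  InE : Pt → Set
  InE x = Σᶠ x ≡ 0ℚ

  _≈_ : Map → Map → Set
  f ≈ g = ∀ x → InE x → f x ≐ g x

  ℤ→ℚ : ℤ → ℚ
  ℤ→ℚ k = k / 1

  ε : Fin N → Pt
  ε i j = if does (i Fin.≟ j) then 1ℚ else 0ℚ

  -- the root ε_i - ε_j  (a root when i ≢ j)
  root : Fin N → Fin N → Pt
  root i j = ε i -ᵥ ε j

  -- simple roots α_1..α_n (0-indexed: α i = ε_{i} - ε_{i+1})
  α : Fin n → Pt
  α i = root (inject₁ i) (suc i)

  α̃ : Pt
  α̃ = root zero (fromℕ n)

  -- orthogonal reflection in H_{β,k} for a root β (⟨β,β⟩ = 2):
  -- s_{β,k}(x) = x - (⟨x,β⟩ - k) β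
  sref : Pt → ℤ → Map
  sref β k x = x -ᵥ ((⟨ x , β ⟩ - ℤ→ℚ k) ·ᵥ β)

  RSpec : Set
  RSpec = Σ (Fin N) λ i → Σ (Fin N) λ j → (¬ i ≡ j) × ℤ

  rmap : RSpec → Map
  rmap (i , j , _ , k) = sref (root i j) k

  IsW : Map → Set
  IsW f = ∃ λ (rs : List RSpec) → f ≈ foldr (λ r g → rmap r ∘ g) id rs

  gen : Fin N → Map
  gen zero    = sref α̃ -[1+ 0 ]
  gen (suc i) = sref (α i) (+ 0)

  prod : List (Fin N) → Map
  prod = foldr (λ s g → gen s ∘ g) id

  HasLength : Map → ℕ → Set
  HasLength w k =
    (∃ λ (u : List (Fin N)) → (length u ≡ k) × (prod u ≈ w))
    × (∀ (u : List (Fin N)) → prod u ≈ w → k ℕ.≤ length u)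

  -- reflections T of the Coxeter system: conjugates w s w⁻¹ of elements of S
  IsRefl : Map → Set
  IsRefl t = ∃ λ (u : List (Fin N)) → ∃ λ (s : Fin N) → t ≈ prod (u ++ s ∷ reverse u)

  BStep : Map → Map → Set
  BStep u v = (∃ λ t → IsRefl t × (v ≈ (u ∘ t)))
            × (∃ λ k₁ → ∃ λ k₂ → HasLength u k₁ × HasLength v k₂ × (k₁ ℕ.< k₂))

  data _≤B_ : Map → Map → Set where
    b-refl : ∀ {u v} → u ≈ v → u ≤B v
    b-step : ∀ {u v w} → u ≤B v → BStep v w → u ≤B w

  Aid : Pt → Set
  Aid x = InE x × (∀ i j → i Fin.< j →
            (ℚ.- 1ℚ ℚ.< ⟨ x , root i j ⟩) × (⟨ x , root i j ⟩ ℚ.< 0ℚ))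

  InAlc : Map → Pt → Set
  InAlc w y = ∃ λ x → Aid x × (w x ≐ y)

  -- longest element w_0 of W_f (reverses the coordinates)
  w₀ : Map
  w₀ x i = x (opposite i)

  Π⁺ : Pt → Set
  Π⁺ x = InE x × (∀ i → (0ℚ ℚ.≤ ⟨ x , α i ⟩) × (⟨ x , α i ⟩ ℚ.≤ 1ℚ))

  Π⁻ : Pt → Set
  Π⁻ y = ∃ λ x → Π⁺ x × (w₀ x ≐ y)

  InF : Map → Set
  InF a = IsW a × (∀ y → InAlc a y → Π⁻ y)

  -- fundamental weights (0-indexed): ϖ i = ε_1+…+ε_{i+1} - ((i+1)/(n+1)) (ε_1+…+ε_{n+1})
  ϖ : Fin n → Pt
  ϖ i j = (if does (toℕ j ℕ.≤? toℕ i) then 1ℚ else 0ℚ) - ((+ suc (toℕ i)) / N)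

  IsWeight : Pt → Set
  IsWeight l = ∃ λ (c : Fin n → ℤ) → l ≐ Σᵥ (λ i → ℤ→ℚ (c i) ·ᵥ ϖ i)

  Dominant : Pt → Set
  Dominant l = IsWeight l × (∀ i → 0ℚ ℚ.≤ ⟨ l , α i ⟩)

  _≼_ : Pt → Pt → Set
  μ ≼ l = ∃ λ (d : Fin n → ℕ) → (l -ᵥ μ) ≐ Σᵥ (λ i → ℤ→ℚ (+ d i) ·ᵥ α i)

  _⋖_ : Pt → Pt → Set
  μ ⋖ l = (μ ≼ l) × (¬ μ ≐ l)
        × (∀ ν → Dominant ν → μ ≼ ν → ν ≼ l → ¬ ν ≐ μ → ¬ ν ≐ l → ⊥)

  IsTheta : Map → Pt → Map → Set
  IsTheta a l θ = IsW θ × (∀ y → (InAlc θ y → InAlc (w₀ ∘ a) (y -ᵥ l))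
                                × (InAlc (w₀ ∘ a) (y -ᵥ l) → InAlc θ y))

  InI : Map → Pt → Map → Set
  InI a l x = IsW x × (∃ λ θ → IsTheta a l θ × (x ≤B θ))

  InPB : Map → Pt → Map → Set
  InPB a l x = InI a l x × (∀ μ → Dominant μ → μ ⋖ l → ¬ InI a μ x)

{-# OPTIONS --safe #-}

-- Elements of W_aff are affine permutations of ℤ, and the Bruhat order is the entrywise order of
-- the counting arrays #{v < j : F v ≥ m}: multiplying on the right by a simple reflection
-- changes only one class of rows, which the neighbouring rows control, and the lifting property
-- does the rest. When y is dominant, x ≤ y therefore says that every vertex of the alcove of x
-- is majorised by the vertex of the same type of the alcove of y. The vertices of θ_a(l - Σ d_i
-- α_i) are those of θ_a(l) translated by -Σ d_i α_i, so x ∈ I_a(l - Σ d_i α_i) is a system of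
-- upper bounds on the individual d_i. Together with dominance, which bounds each d_i in terms of
-- its neighbours, this system has a greatest solution: among the dominant μ ≤ l with x ∈ I_a(μ)
-- there is a least one, and it is the only one with x ∈ PB_a(μ).

module Submission where

-- The obstacle is that `_≤B_` is generated by reflections and lengths, whereas ideals of different
-- weights have to be compared. Majorisation makes this possible: translating by Σ e_i α_i changes
-- the sum of the first k coordinates of a vertex by one coefficient only, because the sum
-- telescopes. So a set K of coordinates constrains the single coefficient determined by the size of
-- K. The two implications between order and majorisation rest on different facts. Towards the
-- order, an array entry is a maximum over sets of coordinates. Towards majorisation, a reflection
-- step downwards makes each vertex less spread (convexity), and a decreasing vector can be
-- recovered from its truncated differences with constants; dominance of y enters here. A greatest
-- solution exists because the off-diagonal entries of the Cartan matrix are non-positive: raising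
-- the other d_j relaxes dominance at i. All constraints are decidable, so a descent finds it. As
-- Paper Boats remove only covers, a smaller weight whose ideal contains x has to be pushed up to a
-- cover.

open import Defs

-- Division of integers by N, with residues in `Fin N`.

module IntegerResidues where

  open import Data.Nat as ℕ using (ℕ; zero; suc)
  open import Data.Fin as Fin using (Fin; zero; suc; toℕ; inject₁; fromℕ; fromℕ<)
  import Data.Fin.Properties as Finₚ
  open import Data.Integer hiding (suc; pos)
  open import Data.Integer.Properties
  open import Data.Integer.DivMod using (n%ℕd<d; a≡a%ℕn+[a/ℕn]*n)
  open import Data.Integer.Tactic.RingSolver using (solve-∀)
  open import Data.Product using (_×_; _,_; proj₁; proj₂)
  open import Data.Empty using (⊥-elim)
  open import Relation.Nullary using (¬_; yes; no; contradiction)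
  open import Relation.Binary.Definitions using (tri<; tri≈; tri>)
  open import Relation.Binary.PropositionalEquality

  -- Integer inequalities are proved by certificates: `e` is a sum of terms known to be
  -- non-negative, and the ring solver checks the identity. `gap≥0` and `<-by` do the same for
  -- strict inequalities, where the difference is at least 1.
  ≤-by : ∀ {a b e : ℤ} → 0ℤ ≤ e → b - a ≡ e → a ≤ b
  ≤-by p refl = 0≤i-j⇒j≤i p

  0≤+ : ∀ {a b : ℤ} → 0ℤ ≤ a → 0ℤ ≤ b → 0ℤ ≤ a + b
  0≤+ = +-mono-≤

  diff≥0 : ∀ {a b : ℤ} → a ≤ b → 0ℤ ≤ b - a
  diff≥0 = i≤j⇒0≤j-i

  gap≥0 : ∀ {a b : ℤ} → a < b → 0ℤ ≤ b - a - 1ℤ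
  gap≥0 {a} {b} p = subst (0ℤ ≤_) (lem a b) (diff≥0 (i<j⇒suc[i]≤j p))
    where lem : ∀ a b → b - (1ℤ + a) ≡ b - a - 1ℤ
          lem = solve-∀

  <-by : ∀ {a b e : ℤ} → 0ℤ ≤ e → b - a - 1ℤ ≡ e → a < b
  <-by {a} {b} p q = suc[i]≤j⇒i<j (≤-by p (trans (lem a b) q))
    where lem : ∀ a b → b - (1ℤ + a) ≡ b - a - 1ℤ
          lem = solve-∀

  <⇒≤-1 : ∀ {a b : ℤ} → a < b → a ≤ b - 1ℤ
  <⇒≤-1 {a} {b} p = ≤-by (gap≥0 p) (lem a b)
    where lem : ∀ a b → b - 1ℤ - a ≡ b - a - 1ℤ
          lem = solve-∀

  a-1<a : ∀ a → a - 1ℤ < a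
  a-1<a a = <-by (≤-refl {0ℤ}) (lem a)
    where lem : ∀ a → a - (a - 1ℤ) - 1ℤ ≡ 0ℤ
          lem = solve-∀

  i≤+∣i∣ : ∀ i → i ≤ + ∣ i ∣
  i≤+∣i∣ (+ _)    = ≤-refl
  i≤+∣i∣ -[1+ _ ] = -≤+

  module Residues (n′ : ℕ) where

    -- Here n is `suc n′`, so N = n + 1 is at least 2 and neighbouring integers have different
    -- residues (`rm-suc-≢`).
    N : ℕ
    N = suc (suc n′)

    Nℤ : ℤ
    Nℤ = + N

    ⟦_⟧ : Fin N → ℤ
    ⟦ c ⟧ = + toℕ c

    ⟦⟧<N : ∀ c → ⟦ c ⟧ < Nℤ
    ⟦⟧<N c = +<+ (Finₚ.toℕ<n c)

    private
      quot-≮ : ∀ r r′ q q′ → ⟦ r ⟧ + q * Nℤ ≡ ⟦ r′ ⟧ + q′ * Nℤ → ¬ q < q′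
      quot-≮ r r′ q q′ e q<q′ = <-irrefl refl (≤-<-trans N≤r (⟦⟧<N r))
        where
        lem : ∀ r r′ q q′ N → r - N ≡ (r + q * N - (r′ + q′ * N)) + (r′ + (q′ - q - 1ℤ) * N)
        lem = solve-∀
        N≤r : Nℤ ≤ ⟦ r ⟧
        N≤r = ≤-by (0≤+ (≤-reflexive (sym (i≡j⇒i-j≡0 e)))
                         (0≤+ (+≤+ ℕ.z≤n) (*-monoʳ-≤-nonNeg Nℤ (gap≥0 q<q′))))
                   (lem ⟦ r ⟧ ⟦ r′ ⟧ q q′ Nℤ)

    divmod-unique : ∀ r r′ q q′ → ⟦ r ⟧ + q * Nℤ ≡ ⟦ r′ ⟧ + q′ * Nℤ → r ≡ r′ × q ≡ q′
    divmod-unique r r′ q q′ e with <-cmp q q′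
    ... | tri< p _ _ = ⊥-elim (quot-≮ r r′ q q′ e p)
    ... | tri> _ _ p = ⊥-elim (quot-≮ r′ r q′ q (sym e) p)
    ... | tri≈ _ refl _ = Finₚ.toℕ-injective (+-injective (+-cancelʳ (q * Nℤ) e)) , refl
      where
      lem : ∀ a c → a ≡ (a + c) - c
      lem = solve-∀
      +-cancelʳ : ∀ {a b} c → a + c ≡ b + c → a ≡ b
      +-cancelʳ {a} {b} c p = trans (lem a c) (trans (cong (_- c) p) (sym (lem b c)))

    abstract
      rm : ℤ → Fin N
      rm z = fromℕ< (n%ℕd<d z N)

      fl : ℤ → ℤ
      fl z = z /ℕ N

      divmod : ∀ z → z ≡ ⟦ rm z ⟧ + fl z * Nℤ
      divmod z = trans (a≡a%ℕn+[a/ℕn]*n z N)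
        (cong (λ k → + k + fl z * Nℤ) (sym (Finₚ.toℕ-fromℕ< (n%ℕd<d z N))))

    rm-unique : ∀ {z} r q → z ≡ ⟦ r ⟧ + q * Nℤ → rm z ≡ r
    rm-unique {z} r q e = proj₁ (divmod-unique (rm z) r (fl z) q (trans (sym (divmod z)) e))

    fl-unique : ∀ {z} r q → z ≡ ⟦ r ⟧ + q * Nℤ → fl z ≡ q
    fl-unique {z} r q e = proj₂ (divmod-unique (rm z) r (fl z) q (trans (sym (divmod z)) e))

    private
      shift-eq : ∀ z k → z + k * Nℤ ≡ ⟦ rm z ⟧ + (fl z + k) * Nℤ
      shift-eq z k = trans (cong (_+ k * Nℤ) (divmod z)) (lem ⟦ rm z ⟧ (fl z) k Nℤ)
        where lem : ∀ r q k N → r + q * N + k * N ≡ r + (q + k) * N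
              lem = solve-∀

    rm-shift : ∀ z k → rm (z + k * Nℤ) ≡ rm z
    rm-shift z k = rm-unique (rm z) (fl z + k) (shift-eq z k)

    fl-shift : ∀ z k → fl (z + k * Nℤ) ≡ fl z + k
    fl-shift z k = fl-unique (rm z) (fl z + k) (shift-eq z k)

    private
      fin-eq : ∀ c → ⟦ c ⟧ ≡ ⟦ c ⟧ + 0ℤ * Nℤ
      fin-eq c = lem ⟦ c ⟧ Nℤ
        where lem : ∀ c N → c ≡ c + 0ℤ * N
              lem = solve-∀

    rm-fin : ∀ c → rm ⟦ c ⟧ ≡ c
    rm-fin c = rm-unique c 0ℤ (fin-eq c)

    fl-fin : ∀ c → fl ⟦ c ⟧ ≡ 0ℤ
    fl-fin c = fl-unique c 0ℤ (fin-eq c)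

    congruent : ∀ {x y} → rm x ≡ rm y → x ≡ y + (fl x - fl y) * Nℤ
    congruent {x} {y} e = trans (divmod x) (trans (cong (λ r → ⟦ r ⟧ + fl x * Nℤ) e)
      (trans (lem ⟦ rm y ⟧ (fl x) (fl y) Nℤ) (cong (_+ (fl x - fl y) * Nℤ) (sym (divmod y)))))
      where lem : ∀ r x y N → r + x * N ≡ r + y * N + (x - y) * N
            lem = solve-∀

    rm-+ : ∀ {x y} z → rm x ≡ rm y → rm (x + z) ≡ rm (y + z)
    rm-+ {x} {y} z e = trans (cong (λ v → rm (v + z)) (congruent {x} {y} e))
      (trans (cong rm (lem y ((fl x - fl y) * Nℤ) z)) (rm-shift (y + z) (fl x - fl y)))
      where lem : ∀ y k z → y + k + z ≡ y + z + k
            lem = solve-∀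

    fl-mono : ∀ {x y} → x ≤ y → fl x ≤ fl y
    fl-mono {x} {y} x≤y with fl x ≤? fl y
    ... | yes p = p
    ... | no ¬p = contradiction (≤-<-trans N≤ (⟦⟧<N (rm y))) (<-irrefl refl)
      where
      lem : ∀ rx ry x y N → ry - N ≡ (ry + y * N - (rx + x * N)) + (rx + (x - y - 1ℤ) * N)
      lem = solve-∀
      N≤ : Nℤ ≤ ⟦ rm y ⟧
      N≤ = ≤-by (0≤+ (subst₂ (λ a b → 0ℤ ≤ b - a) (divmod x) (divmod y) (diff≥0 x≤y))
                     (0≤+ (+≤+ ℕ.z≤n) (*-monoʳ-≤-nonNeg Nℤ (gap≥0 (≰⇒> ¬p)))))
                (lem ⟦ rm x ⟧ ⟦ rm y ⟧ (fl x) (fl y) Nℤ)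

    fl-zero-residue : ∀ {z} → rm z ≡ zero → z ≡ fl z * Nℤ
    fl-zero-residue {z} e = trans (divmod z) (trans (cong (λ r → ⟦ r ⟧ + fl z * Nℤ) e) (+-identityˡ _))

    -- With `fl-pred-zero`: the quotient changes only on crossing a multiple of N. This is the
    -- source of the locality of simple reflections in `arr-σ`.
    fl-pred : ∀ {z} → ¬ rm z ≡ zero → fl (z - 1ℤ) ≡ fl z
    fl-pred {z} ≢0 with rm z in eq
    ... | zero = ⊥-elim (≢0 refl)
    ... | suc r = fl-unique (inject₁ r) (fl z)
          (trans (cong (_- 1ℤ) (trans (divmod z) (cong (λ k → ⟦ k ⟧ + fl z * Nℤ) eq)))
          (trans (lem (+ toℕ r) (fl z * Nℤ)) (cong (λ k → + k + fl z * Nℤ) (sym (Finₚ.toℕ-inject₁ r)))))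
      where lem : ∀ r q → 1ℤ + r + q - 1ℤ ≡ r + q
            lem = solve-∀

    fl-pred-zero : ∀ {z} → rm z ≡ zero → fl (z - 1ℤ) ≡ fl z - 1ℤ
    fl-pred-zero {z} e = fl-unique (fromℕ (suc n′)) (fl z - 1ℤ)
      (trans (cong (_- 1ℤ) (fl-zero-residue {z} e))
      (trans (lem (fl z) (+ suc n′)) (cong (λ k → + k + (fl z - 1ℤ) * Nℤ) (sym (Finₚ.toℕ-fromℕ (suc n′))))))
      where lem : ∀ q n → q * (1ℤ + n) - 1ℤ ≡ n + (q - 1ℤ) * (1ℤ + n)
            lem = solve-∀

    0≤⇒0≤fl : ∀ {z} → 0ℤ ≤ z → 0ℤ ≤ fl z
    0≤⇒0≤fl p = ≤-trans (≤-reflexive (sym (fl-fin zero))) (fl-mono p)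

    rm-suc-≢ : ∀ z → ¬ rm (z + 1ℤ) ≡ rm z
    rm-suc-≢ z e = Finₚ.0≢1+n (trans (sym (rm-fin zero)) (trans (sym e₁) (rm-fin (suc zero))))
      where
      lem₁ : ∀ z → (z + 1ℤ) + - z ≡ 1ℤ
      lem₁ = solve-∀
      e₁ : rm 1ℤ ≡ rm 0ℤ
      e₁ = subst₂ (λ a b → rm a ≡ rm b) (lem₁ z) (+-inverseʳ z) (rm-+ {z + 1ℤ} {z} (- z) e)

-- Affine permutations, reflections and the exchange property.

module AffinePermutation where

  open import Data.Nat as ℕ using (ℕ; zero; suc)
  open import Data.Fin as Fin using (Fin; zero; suc)
  import Data.Fin.Properties as Finₚ
  open import Data.Integer hiding (suc; pos)
  open import Data.Integer.Properties
  open import Data.Integer.Tactic.RingSolver using (solve-∀)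
  open import Data.List using (List; []; _∷_; _++_; reverse)
  import Data.List.Properties as Listₚ
  open import Data.Product using (∃; _×_; _,_)
  open import Data.Empty using (⊥-elim)
  open import Function using (_∘_)
  open import Relation.Nullary using (¬_; yes; no)
  open import Relation.Binary.Definitions using (Tri; tri<; tri≈; tri>)
  open import Relation.Binary.PropositionalEquality
  open import Algebra.Bundles using (CommutativeMonoid)
  import Algebra.Properties.CommutativeMonoid.Sum as MonoidSum
  import Algebra.Properties.CommutativeSemigroup as CommSemigroup

  open IntegerResidues

  module SumTwoPoints {c ℓ} (M : CommutativeMonoid c ℓ) where
    open CommutativeMonoid M renaming (_∙_ to _⊕_; assoc to ⊕-assoc; ∙-cong to ⊕-cong; ∙-congˡ to ⊕-congˡ; ∙-congʳ to ⊕-congʳ; refl to ≈-refl; sym to ≈-sym; trans to ≈-trans; comm to ⊕-comm)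
    open CommSemigroup commutativeSemigroup using (xy∙z≈zy∙x; xy∙z≈xz∙y)
    open MonoidSum M using (sum; sum-cong-≋)

    -- The corrections stand on both sides because a monoid may lack subtraction: the lemma serves
    -- sums in ℕ, ℤ and ℚ.
    sum-differ-at-one : ∀ {m} (f g : Fin m → Carrier) i → (∀ k → ¬ k ≡ i → f k ≈ g k) →
                        sum f ⊕ g i ≈ sum g ⊕ f i
    sum-differ-at-one f g zero h =
      ≈-trans (xy∙z≈zy∙x _ _ _) (⊕-congʳ (⊕-congˡ (sum-cong-≋ λ k → h (suc k) λ ())))
    sum-differ-at-one f g (suc i) h =
      ≈-trans (⊕-assoc _ _ _) (≈-trans (⊕-cong (h zero λ ())
        (sum-differ-at-one (f ∘ suc) (g ∘ suc) i λ k k≢i → h (suc k) (k≢i ∘ Finₚ.suc-injective)))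
        (≈-sym (⊕-assoc _ _ _)))

    sum-differ-at-two : ∀ {m} (f g : Fin m → Carrier) i j → ¬ i ≡ j →
                        (∀ k → ¬ k ≡ i → ¬ k ≡ j → f k ≈ g k) →
                        sum f ⊕ (g i ⊕ g j) ≈ sum g ⊕ (f i ⊕ f j)
    sum-differ-at-two {m} f g i j i≢j h =
      ≈-trans (≈-sym (⊕-assoc _ _ _))
      (≈-trans (⊕-congʳ (≈-trans (⊕-congˡ (≈-sym mid-i)) (sum-differ-at-one f mid i λ k k≢i → ≈-sym (mid-off k k≢i))))
      (≈-trans (xy∙z≈xz∙y _ _ _)
      (≈-trans (⊕-congʳ (≈-trans (sum-differ-at-one mid g j mid-g) (⊕-congˡ (mid-off j (i≢j ∘ sym)))))
      (≈-trans (⊕-assoc _ _ _) (⊕-congˡ (⊕-comm _ _))))))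
      where
      mid : Fin m → Carrier
      mid k with k Fin.≟ i
      ... | yes _ = g k
      ... | no _ = f k
      mid-i : mid i ≈ g i
      mid-i with i Fin.≟ i
      ... | yes _ = ≈-refl
      ... | no ¬p = ⊥-elim (¬p refl)
      mid-off : ∀ k → ¬ k ≡ i → mid k ≈ f k
      mid-off k k≢i with k Fin.≟ i
      ... | yes p = ⊥-elim (k≢i p)
      ... | no _ = ≈-refl
      mid-g : ∀ k → ¬ k ≡ j → mid k ≈ g k
      mid-g k k≢j with k Fin.≟ i
      ... | yes _ = ≈-refl
      ... | no k≢i = h k k≢i k≢j

  open MonoidSum +-0-commutativeMonoid public using () renaming (sum to Σℤ; sum-cong-≗ to Σℤ-cong; ∑-distrib-+ to Σℤ-+)
  open SumTwoPoints +-0-commutativeMonoid public using (sum-differ-at-one; sum-differ-at-two)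

  module AffinePermutations (n′ : ℕ) where
    open Residues n′ public

    -- These are the extended affine permutations. Products of generators moreover have the window
    -- sum of the identity (`Σ-window`), which is what excludes a common translation of all integers
    -- in `same-alcove`.
    record Aff : Set where
      field
        fun inv : ℤ → ℤ
        shift   : ∀ v k → fun (v + k * Nℤ) ≡ fun v + k * Nℤ
        fun-inv : ∀ v → fun (inv v) ≡ v
        inv-fun : ∀ v → inv (fun v) ≡ v

    open Aff public

    module _ (F : Aff) where
      inv-shift : ∀ v k → inv F (v + k * Nℤ) ≡ inv F v + k * Nℤ
      inv-shift v k = trans (cong (λ x → inv F (x + k * Nℤ)) (sym (fun-inv F v)))
        (trans (cong (inv F) (sym (shift F (inv F v) k))) (inv-fun F _))

      fun-injective : ∀ {x y} → fun F x ≡ fun F y → x ≡ y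
      fun-injective {x} {y} e = trans (sym (inv-fun F x)) (trans (cong (inv F) e) (inv-fun F y))

      fun-congruent : ∀ {x y} → rm x ≡ rm y → fun F x ≡ fun F y + (x - y)
      fun-congruent {x} {y} e = trans (cong (fun F) e′) (trans (shift F y (fl x - fl y))
        (cong (λ z → fun F y + z) (trans (lem y ((fl x - fl y) * Nℤ)) (cong (_- y) (sym e′)))))
        where
        e′ : x ≡ y + (fl x - fl y) * Nℤ
        e′ = congruent e
        lem : ∀ y k → k ≡ y + k - y
        lem = solve-∀

      rm-fun : ∀ {x y} → rm x ≡ rm y → rm (fun F x) ≡ rm (fun F y)
      rm-fun {x} {y} e = trans (cong (rm ∘ fun F) (congruent e))
        (trans (cong rm (shift F y (fl x - fl y))) (rm-shift (fun F y) (fl x - fl y)))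

      rm-fun-injective : ∀ {x y} → rm (fun F x) ≡ rm (fun F y) → rm x ≡ rm y
      rm-fun-injective {x} {y} e = trans (cong rm (fun-injective
        (trans (congruent {fun F x} {fun F y} e) (sym (shift F y (fl (fun F x) - fl (fun F y)))))))
        (rm-shift y (fl (fun F x) - fl (fun F y)))

      inv-congruent : ∀ {x y} → rm x ≡ rm y → inv F x ≡ inv F y + (x - y)
      inv-congruent {x} {y} e = trans (cong (inv F) e′) (trans (inv-shift y (fl x - fl y))
        (cong (λ z → inv F y + z) (trans (lem y ((fl x - fl y) * Nℤ)) (cong (_- y) (sym e′)))))
        where
        e′ : x ≡ y + (fl x - fl y) * Nℤ
        e′ = congruent e
        lem : ∀ y k → k ≡ y + k - y
        lem = solve-∀

      inv-≢ : ∀ {x y} → ¬ rm x ≡ rm y → ¬ rm (inv F x) ≡ rm (inv F y)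
      inv-≢ {x} {y} x≢y e = x≢y (subst₂ (λ a b → rm a ≡ rm b) (fun-inv F x) (fun-inv F y) (rm-fun e))

    inv-unique : ∀ F G → (∀ v → fun F v ≡ fun G v) → ∀ v → inv F v ≡ inv G v
    inv-unique F G e v = trans (cong (inv F) (trans (sym (fun-inv G v)) (sym (e _)))) (inv-fun F _)

    idA : Aff
    idA = record { fun = λ v → v ; inv = λ v → v ; shift = λ _ _ → refl
                 ; fun-inv = λ _ → refl ; inv-fun = λ _ → refl }

    infixr 9 _∘A_
    _∘A_ : Aff → Aff → Aff
    F ∘A G = record
      { fun = fun F ∘ fun G ; inv = inv G ∘ inv F
      ; shift = λ v k → trans (cong (fun F) (shift G v k)) (shift F _ k)
      ; fun-inv = λ v → trans (cong (fun F) (fun-inv G _)) (fun-inv F v)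
      ; inv-fun = λ v → trans (cong (inv G) (inv-fun F _)) (inv-fun G v) }

    abstract
      -- The affine reflection exchanging `a + k * Nℤ` with `b + k * Nℤ` for all k, when the
      -- residues of `a` and `b` differ.
      τ : ℤ → ℤ → ℤ → ℤ
      τ a b v with rm v Fin.≟ rm a | rm v Fin.≟ rm b
      ... | yes _ | _     = v + (b - a)
      ... | no _  | yes _ = v + (a - b)
      ... | no _  | no _  = v

      τ-fst : ∀ {a b} v → rm v ≡ rm a → τ a b v ≡ v + (b - a)
      τ-fst {a} {b} v e with rm v Fin.≟ rm a | rm v Fin.≟ rm b
      ... | yes _ | _ = refl
      ... | no ¬e | _ = ⊥-elim (¬e e)

      τ-snd : ∀ {a b} v → ¬ rm a ≡ rm b → rm v ≡ rm b → τ a b v ≡ v + (a - b)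
      τ-snd {a} {b} v a≢b e with rm v Fin.≟ rm a | rm v Fin.≟ rm b
      ... | yes p | _ = ⊥-elim (a≢b (trans (sym p) e))
      ... | no _ | yes _ = refl
      ... | no _ | no ¬e = ⊥-elim (¬e e)

      τ-off : ∀ {a b} v → ¬ rm v ≡ rm a → ¬ rm v ≡ rm b → τ a b v ≡ v
      τ-off {a} {b} v ¬a ¬b with rm v Fin.≟ rm a | rm v Fin.≟ rm b
      ... | yes p | _ = ⊥-elim (¬a p)
      ... | no _ | yes p = ⊥-elim (¬b p)
      ... | no _ | no _ = refl

    rm-move : ∀ {a b} v → rm v ≡ rm a → rm (v + (b - a)) ≡ rm b
    rm-move {a} {b} v e = trans (rm-+ (b - a) e) (cong rm (lem a b))
      where lem : ∀ a b → a + (b - a) ≡ b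
            lem = solve-∀

    data TauView (a b v : ℤ) : Set where
      at-fst : rm v ≡ rm a → τ a b v ≡ v + (b - a) → TauView a b v
      at-snd : rm v ≡ rm b → τ a b v ≡ v + (a - b) → TauView a b v
      off    : ¬ rm v ≡ rm a → ¬ rm v ≡ rm b → τ a b v ≡ v → TauView a b v

    τ-view : ∀ {a b} → ¬ rm a ≡ rm b → ∀ v → TauView a b v
    τ-view {a} {b} a≢b v with rm v Fin.≟ rm a | rm v Fin.≟ rm b
    ... | yes p | _     = at-fst p (τ-fst v p)
    ... | no _  | yes q = at-snd q (τ-snd v a≢b q)
    ... | no p  | no q  = off p q (τ-off v p q)

    τ-congruent : ∀ {a b a′ b′} → ¬ rm a ≡ rm b → rm a ≡ rm a′ → b - a ≡ b′ - a′ → ∀ v → τ a b v ≡ τ a′ b′ v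
    τ-congruent {a} {b} {a′} {b′} a≢b a≡a′ d v = by (τ-view a≢b v)
      where
      lem₁ : ∀ a b → a - b ≡ - (b - a)
      lem₁ = solve-∀
      lem₂ : ∀ a b → a + (b - a) ≡ b
      lem₂ = solve-∀
      b≡b′ : rm b ≡ rm b′
      b≡b′ = subst₂ (λ x y → rm x ≡ rm y) (lem₂ a b) (trans (cong (λ z → a′ + z) d) (lem₂ a′ b′)) (rm-+ (b - a) a≡a′)
      a′≢b′ : ¬ rm a′ ≡ rm b′
      a′≢b′ q = a≢b (trans a≡a′ (trans q (sym b≡b′)))
      by : TauView a b v → τ a b v ≡ τ a′ b′ v
      by (at-fst p e) = trans e (trans (cong (λ z → v + z) d) (sym (τ-fst v (trans p a≡a′))))
      by (at-snd p e) = trans e (trans (cong (λ z → v + z) (trans (lem₁ a b) (trans (cong -_ d) (sym (lem₁ a′ b′)))))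
        (sym (τ-snd v a′≢b′ (trans p b≡b′))))
      by (off p q e) = trans e (sym (τ-off v (λ r → p (trans r (sym a≡a′))) (λ r → q (trans r (sym b≡b′)))))

    τ-sym : ∀ {a b} → ¬ rm a ≡ rm b → ∀ v → τ a b v ≡ τ b a v
    τ-sym {a} {b} a≢b v with τ-view a≢b v
    ... | at-fst p e = trans e (sym (τ-snd v (a≢b ∘ sym) p))
    ... | at-snd p e = trans e (sym (τ-fst v p))
    ... | off p q e = trans e (sym (τ-off v q p))

    τ-involutive : ∀ {a b} → ¬ rm a ≡ rm b → ∀ v → τ a b (τ a b v) ≡ v
    τ-involutive {a} {b} a≢b v with τ-view a≢b v
    ... | at-fst p e = trans (cong (τ a b) e) (trans (τ-snd _ a≢b (rm-move v p)) (lem v a b))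
      where lem : ∀ v a b → v + (b - a) + (a - b) ≡ v
            lem = solve-∀
    ... | at-snd p e = trans (cong (τ a b) e) (trans (τ-fst _ (rm-move v p)) (lem v b a))
      where lem : ∀ v a b → v + (b - a) + (a - b) ≡ v
            lem = solve-∀
    ... | off p q e = trans (cong (τ a b) e) e

    τ-conj : ∀ (F : Aff) {a b} → ¬ rm a ≡ rm b → ∀ v → fun F (τ a b v) ≡ τ (fun F a) (fun F b) (fun F v)
    τ-conj F {a} {b} a≢b v with τ-view a≢b v
    ... | at-fst p e = trans (cong (fun F) e) (trans (fun-congruent F (rm-move v p))
          (trans (lem v a b (fun F b) (fun F a)) (trans (cong (_+ (fun F b - fun F a)) (sym (fun-congruent F p)))
          (sym (τ-fst _ (rm-fun F p))))))
      where lem : ∀ v a b B A → B + (v + (b - a) - b) ≡ A + (v - a) + (B - A)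
            lem = solve-∀
    ... | at-snd p e = trans (cong (fun F) e) (trans (fun-congruent F (rm-move v p))
          (trans (lem v b a (fun F a) (fun F b)) (trans (cong (_+ (fun F a - fun F b)) (sym (fun-congruent F p)))
          (sym (τ-snd _ (a≢b ∘ rm-fun-injective F) (rm-fun F p))))))
      where lem : ∀ v a b B A → B + (v + (b - a) - b) ≡ A + (v - a) + (B - A)
            lem = solve-∀
    ... | off p q e = trans (cong (fun F) e)
          (sym (τ-off _ (p ∘ rm-fun-injective F) (q ∘ rm-fun-injective F)))

    τ-shift : ∀ {a b} → ¬ rm a ≡ rm b → ∀ v k → τ a b (v + k * Nℤ) ≡ τ a b v + k * Nℤ
    τ-shift {a} {b} a≢b v k with τ-view a≢b v
    ... | at-fst p e = trans (τ-fst _ (trans (rm-shift v k) p)) (trans (lem v _ _) (cong (_+ k * Nℤ) (sym e)))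
      where lem : ∀ v k x → v + k + x ≡ v + x + k
            lem = solve-∀
    ... | at-snd p e = trans (τ-snd _ a≢b (trans (rm-shift v k) p)) (trans (lem v _ _) (cong (_+ k * Nℤ) (sym e)))
      where lem : ∀ v k x → v + k + x ≡ v + x + k
            lem = solve-∀
    ... | off p q e = trans (τ-off _ (p ∘ trans (sym (rm-shift v k))) (q ∘ trans (sym (rm-shift v k)))) (cong (_+ k * Nℤ) (sym e))

    τA : ∀ {a b} → ¬ rm a ≡ rm b → Aff
    τA {a} {b} a≢b = record { fun = τ a b ; inv = τ a b ; shift = τ-shift a≢b
      ; fun-inv = τ-involutive a≢b ; inv-fun = τ-involutive a≢b }

    pred-≢ : ∀ z → ¬ rm (z - 1ℤ) ≡ rm z
    pred-≢ z e = rm-suc-≢ (z - 1ℤ) (trans (cong rm (lem z)) (sym e))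
      where lem : ∀ z → z - 1ℤ + 1ℤ ≡ z
            lem = solve-∀

    σ : Fin N → ℤ → ℤ
    σ s = τ (⟦ s ⟧ - 1ℤ) ⟦ s ⟧

    σA : Fin N → Aff
    σA s = τA (pred-≢ ⟦ s ⟧)

    Word : Set
    Word = List (Fin N)

    -- Letters compose in the order opposite to `prod`, since points are acted on by precomposition
    -- (`prod-act`). Hence appending a letter acts on values and prepending one acts on positions.
    W : Word → Aff
    W [] = idA
    W (s ∷ u) = W u ∘A σA s

    infix 9 _⟪_⟫
    _⟪_⟫ : Word → ℤ → ℤ
    u ⟪ v ⟫ = fun (W u) v

    infix 4 _≋_
    _≋_ : Word → Word → Set
    u ≋ v = ∀ x → u ⟪ x ⟫ ≡ v ⟪ x ⟫

    W-++ : ∀ u v x → (u ++ v) ⟪ x ⟫ ≡ v ⟪ u ⟪ x ⟫ ⟫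
    W-++ [] v x = refl
    W-++ (s ∷ u) v x = W-++ u v (σ s x)

    W-reverse : ∀ u x → reverse u ⟪ x ⟫ ≡ inv (W u) x
    W-reverse [] x = refl
    W-reverse (s ∷ u) x = trans (cong (_⟪ x ⟫) (Listₚ.unfold-reverse s u))
      (trans (W-++ (reverse u) (s ∷ []) x) (cong (σ s) (W-reverse u x)))

    data SigmaView (s : Fin N) (v : ℤ) : Set where
      up   : rm v ≡ rm (⟦ s ⟧ - 1ℤ) → σ s v ≡ v + 1ℤ → SigmaView s v
      down : rm v ≡ s → σ s v ≡ v - 1ℤ → SigmaView s v
      stay : ¬ rm v ≡ rm (⟦ s ⟧ - 1ℤ) → ¬ rm v ≡ s → σ s v ≡ v → SigmaView s v

    σ-view : ∀ s v → SigmaView s v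
    σ-view s v = convert (τ-view (pred-≢ ⟦ s ⟧) v)
      where
      lem₁ : ∀ v s → v + (s - (s - 1ℤ)) ≡ v + 1ℤ
      lem₁ = solve-∀
      lem₂ : ∀ v s → v + (s - 1ℤ - s) ≡ v - 1ℤ
      lem₂ = solve-∀
      convert : TauView (⟦ s ⟧ - 1ℤ) ⟦ s ⟧ v → SigmaView s v
      convert (at-fst p e) = up p (trans e (lem₁ v ⟦ s ⟧))
      convert (at-snd p e) = down (trans p (rm-fin s)) (trans e (lem₂ v ⟦ s ⟧))
      convert (off p q e)  = stay p (q ∘ λ r → trans r (sym (rm-fin s))) e

    v-1≤σ : ∀ s v → v - 1ℤ ≤ σ s v
    v-1≤σ s v = bound (σ-view s v)
      where
      lem : ∀ v → v + 1ℤ - (v - 1ℤ) ≡ + 2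
      lem = solve-∀
      bound : SigmaView s v → v - 1ℤ ≤ σ s v
      bound (up _ e)     = ≤-trans (≤-by (+≤+ (ℕ.z≤n {2})) (lem v)) (≤-reflexive (sym e))
      bound (down _ e)   = ≤-reflexive (sym e)
      bound (stay _ _ e) = ≤-trans (<⇒≤ (a-1<a v)) (≤-reflexive (sym e))

    σ≤v+1 : ∀ s v → σ s v ≤ v + 1ℤ
    σ≤v+1 s v = ≤-trans (≤-by (diff≥0 (v-1≤σ s (σ s v))) (lem (σ s v) (σ s (σ s v)))) (≤-reflexive (cong (_+ 1ℤ) (τ-involutive (pred-≢ ⟦ s ⟧) v)))
      where lem : ∀ a b → b + 1ℤ - a ≡ b - (a - 1ℤ)
            lem = solve-∀

    -- `σ s` moves every integer by at most 1, so two integers whose order it reverses are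
    -- consecutive and the smaller one is moved up. The pair is then a translate of `s - 1`, `s`.
    σ-flip : ∀ s {a b} → ¬ rm a ≡ rm b → a < b → σ s b < σ s a → ∀ v → τ a b v ≡ σ s v
    σ-flip s {a} {b} a≢b a<b flip = conclude (σ-view s a)
      where
      lem₁ : ∀ a b A B → a - (b - 1ℤ) ≡ (A - B - 1ℤ) + (B - (b - 1ℤ)) + (a + 1ℤ - A)
      lem₁ = solve-∀
      a≡b-1 : a ≡ b - 1ℤ
      a≡b-1 = ≤-antisym (<⇒≤-1 a<b)
        (≤-by (0≤+ (0≤+ (gap≥0 flip) (diff≥0 (v-1≤σ s b))) (diff≥0 (σ≤v+1 s a))) (lem₁ a b (σ s a) (σ s b)))
      a<σa : a < σ s a
      a<σa = ≤-<-trans (≤-trans (≤-reflexive a≡b-1) (v-1≤σ s b)) flip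
      conclude : SigmaView s a → ∀ v → τ a b v ≡ σ s v
      conclude (up p e) = τ-congruent a≢b p (trans (cong (λ z → b - z) a≡b-1) (lem₄ b ⟦ s ⟧))
        where lem₄ : ∀ b s → b - (b - 1ℤ) ≡ s - (s - 1ℤ)
              lem₄ = solve-∀
      conclude (down _ e) = ⊥-elim (<-asym a<σa (subst (_< a) (sym e) (a-1<a a)))
      conclude (stay _ _ e) = ⊥-elim (<-irrefl (sym e) a<σa)

    Deletion : Word → ℤ → ℤ → Set
    Deletion u a b = ∃ λ A → ∃ λ s → ∃ λ B → (u ≡ A ++ s ∷ B) × (∀ v → (A ++ B) ⟪ v ⟫ ≡ u ⟪ τ a b v ⟫)

    -- The strong exchange property. The pair is followed through the letters until one of them
    -- reverses it; by `σ-flip` the reflection is that letter, and the two cancel. `τ-conj` carries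
    -- the reflection past the earlier letters.
    exchange : ∀ u {a b} → ¬ rm a ≡ rm b → a < b → u ⟪ b ⟫ < u ⟪ a ⟫ → Deletion u a b
    exchange [] a≢b a<b flip = ⊥-elim (<-asym a<b flip)
    exchange (s ∷ u) {a} {b} a≢b a<b flip = split (<-cmp (σ s a) (σ s b))
      where
      extend : Deletion u (σ s a) (σ s b) → Deletion (s ∷ u) a b
      extend (A , t , B , e , h) = s ∷ A , t , B , cong (s ∷_) e ,
        λ v → trans (h (σ s v)) (cong (fun (W u)) (sym (τ-conj (σA s) a≢b v)))
      split : Tri (σ s a < σ s b) (σ s a ≡ σ s b) (σ s b < σ s a) → Deletion (s ∷ u) a b
      split (tri≈ _ e _) = ⊥-elim (a≢b (cong rm (fun-injective (σA s) e)))
      split (tri> _ _ p) = [] , s , u , refl , λ v → cong (fun (W u))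
        (sym (trans (cong (σ s) (σ-flip s a≢b a<b p v)) (τ-involutive (pred-≢ ⟦ s ⟧) v)))
      split (tri< p _ _) = extend (exchange u {σ s a} {σ s b} (λ e → a≢b (rm-fun-injective (σA s) e)) p flip)

    -- Induction on a bound for `b - a`. Conjugating by the letter that raises `a` by 1 never raises
    -- `b`, which lies in another class, so the pair draws closer until the letter itself reverses
    -- it.
    τ-word : ∀ d {a b} → ¬ rm a ≡ rm b → a < b → b - a ≤ + d → ∃ λ u → ∀ v → u ⟪ v ⟫ ≡ τ a b v
    τ-word zero {a} {b} _ a<b b-a≤d = ⊥-elim (≤⇒≯ (i-j≤0⇒i≤j b-a≤d) a<b)
    τ-word (suc d) {a} {b} a≢b a<b b-a≤d = split (<-cmp (σ s a) (σ s b))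
      where
      s = rm (a + 1ℤ)
      lem₁ : ∀ a → a + 1ℤ + - 1ℤ ≡ a
      lem₁ = solve-∀
      s-1≡a : rm (⟦ s ⟧ - 1ℤ) ≡ rm a
      s-1≡a = trans (rm-+ (- 1ℤ) (rm-fin s)) (cong rm (lem₁ a))
      σa : σ s a ≡ a + 1ℤ
      σa = trans (τ-fst a (sym s-1≡a)) (lem a ⟦ s ⟧)
        where lem : ∀ a s → a + (s - (s - 1ℤ)) ≡ a + 1ℤ
              lem = solve-∀
      σ≢ : ¬ rm (σ s a) ≡ rm (σ s b)
      σ≢ = a≢b ∘ rm-fun-injective (σA s)
      σb≤b : σ s b ≤ b
      σb≤b = bound (σ-view s b)
        where
        bound : SigmaView s b → σ s b ≤ b
        bound (up p e)     = ⊥-elim (a≢b (trans (sym s-1≡a) (sym p)))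
        bound (down p e)   = ≤-trans (≤-reflexive e) (<⇒≤ (a-1<a b))
        bound (stay _ _ e) = ≤-reflexive e
      conjugate : (∃ λ u → ∀ v → u ⟪ v ⟫ ≡ τ (σ s a) (σ s b) v) → ∃ λ u → ∀ v → u ⟪ v ⟫ ≡ τ a b v
      conjugate (u , h) = s ∷ u ++ s ∷ [] , λ v → trans (W-++ u (s ∷ []) (σ s v))
        (trans (cong (σ s) (trans (h (σ s v)) (sym (τ-conj (σA s) a≢b v)))) (τ-involutive (pred-≢ ⟦ s ⟧) (τ a b v)))
      lem₃ : ∀ d a b c → d - (c - (a + 1ℤ)) ≡ (b - c) + (1ℤ + d - (b - a))
      lem₃ = solve-∀
      split : Tri (σ s a < σ s b) (σ s a ≡ σ s b) (σ s b < σ s a) → ∃ λ u → ∀ v → u ⟪ v ⟫ ≡ τ a b v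
      split (tri≈ _ e _) = ⊥-elim (σ≢ (cong rm e))
      split (tri> _ _ p) = s ∷ [] , λ v → sym (σ-flip s a≢b a<b p v)
      split (tri< p _ _) = conjugate (τ-word d σ≢ p (≤-by (0≤+ (diff≥0 σb≤b) (diff≥0 b-a≤d))
        (trans (cong (λ z → + d - (σ s b - z)) σa) (lem₃ (+ d) a b (σ s b)))))

    reflection-word : ∀ {a b} → ¬ rm a ≡ rm b → ∃ λ u → ∀ v → u ⟪ v ⟫ ≡ τ a b v
    reflection-word {a} {b} a≢b with <-cmp a b
    ... | tri≈ _ e _ = ⊥-elim (a≢b (cong rm e))
    ... | tri< p _ _ = τ-word ∣ b - a ∣ a≢b p (≤-reflexive (sym (0≤i⇒+∣i∣≡i (diff≥0 (<⇒≤ p)))))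
    ... | tri> _ _ p with τ-word ∣ a - b ∣ (a≢b ∘ sym) p (≤-reflexive (sym (0≤i⇒+∣i∣≡i (diff≥0 (<⇒≤ p)))))
    ... | u , h = u , λ v → trans (h v) (τ-sym (a≢b ∘ sym) v)

    module _ (F : Aff) {a b : ℤ} (a≢b : ¬ rm a ≡ rm b) where
      window : ∀ v → fun F ⟦ rm v ⟧ ≡ fun F v - fl v * Nℤ
      window v = trans (fun-congruent F {⟦ rm v ⟧} {v} (rm-fin (rm v)))
        (cong (λ z → fun F v + z) (trans (cong (λ z → ⟦ rm v ⟧ - z) (divmod v)) (lem ⟦ rm v ⟧ (fl v * Nℤ))))
        where lem : ∀ r x → r - (r + x) ≡ - x
              lem = solve-∀

      window-τ-fst : fun F (τ a b ⟦ rm a ⟧) ≡ fun F b - fl a * Nℤ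
      window-τ-fst = trans (cong (fun F) (τ-fst _ (rm-fin _)))
        (trans (fun-congruent F {⟦ rm a ⟧ + (b - a)} {b} (rm-move _ (rm-fin _)))
        (cong (λ z → fun F b + z) (trans (cong (λ z → ⟦ rm a ⟧ + (b - z) - b) (divmod a)) (lem ⟦ rm a ⟧ b (fl a * Nℤ)))))
        where lem : ∀ r b x → r + (b - (r + x)) - b ≡ - x
              lem = solve-∀

      window-τ-snd : fun F (τ a b ⟦ rm b ⟧) ≡ fun F a - fl b * Nℤ
      window-τ-snd = trans (cong (fun F) (τ-snd _ a≢b (rm-fin _)))
        (trans (fun-congruent F {⟦ rm b ⟧ + (a - b)} {a} (rm-move _ (rm-fin _)))
        (cong (λ z → fun F a + z) (trans (cong (λ z → ⟦ rm b ⟧ + (a - z) - a) (divmod b)) (lem ⟦ rm b ⟧ a (fl b * Nℤ)))))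
        where lem : ∀ r b x → r + (b - (r + x)) - b ≡ - x
              lem = solve-∀

      window-τ-off : ∀ c → ¬ c ≡ rm a → ¬ c ≡ rm b → fun F (τ a b ⟦ c ⟧) ≡ fun F ⟦ c ⟧
      window-τ-off c p q = cong (fun F) (τ-off _ (p ∘ trans (sym (rm-fin c))) (q ∘ trans (sym (rm-fin c))))

      -- The values at `a` and `b` change places while the multiples of N subtracted from them stay,
      -- so the total is the same.
      Σ-window-τ : Σℤ (λ c → fun F (τ a b ⟦ c ⟧)) ≡ Σℤ (λ c → fun F ⟦ c ⟧)
      Σ-window-τ = cancel (sum-differ-at-two _ _ (rm a) (rm b) a≢b window-τ-off)
        (trans (cong₂ _+_ window-τ-fst window-τ-snd)
        (trans (lem (fun F a) (fun F b) (fl a * Nℤ) (fl b * Nℤ)) (sym (cong₂ _+_ (window a) (window b)))))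
        where
        lem : ∀ x y k l → y - k + (x - l) ≡ x - k + (y - l)
        lem = solve-∀
        lem₂ : ∀ x y → x ≡ x + y - y
        lem₂ = solve-∀
        cancel : ∀ {x y p q} → x + p ≡ y + q → q ≡ p → x ≡ y
        cancel {x} {y} {p} {q} e refl = trans (lem₂ x q) (trans (cong (_- q) e) (sym (lem₂ y q)))

    Σ-window : ∀ u → Σℤ (λ c → u ⟪ ⟦ c ⟧ ⟫) ≡ Σℤ ⟦_⟧
    Σ-window [] = refl
    Σ-window (s ∷ u) = trans (Σ-window-τ (W u) (pred-≢ ⟦ s ⟧)) (Σ-window u)

-- The reflection order on words and its counting arrays.

module CoxeterOrder where

  open import Data.Nat as ℕ using (ℕ; zero; suc)
  import Data.Nat.Properties as ℕₚ
  open import Data.Fin as Fin using (Fin; zero; suc)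
  open import Data.Integer hiding (suc; pos)
  open import Data.Integer.Properties
  open import Data.Integer.Tactic.RingSolver using (solve-∀)
  open import Data.List using (List; []; _∷_; _++_; _∷ʳ_; length; initLast; InitLast; _∷ʳ′_)
  import Data.List.Properties as Listₚ
  open import Data.Product using (∃; _×_; _,_)
  open import Data.Sum using (_⊎_; inj₁; inj₂)
  open import Data.Empty using (⊥-elim)
  open import Function using (_∘_)
  open import Relation.Nullary using (¬_; Dec; yes; no)
  open import Relation.Binary.Definitions using (Tri; tri<; tri≈; tri>)
  open import Relation.Binary.PropositionalEquality

  open IntegerResidues
  open AffinePermutation

  Σℤ-mono : ∀ {m} {f g : Fin m → ℤ} → (∀ c → f c ≤ g c) → Σℤ f ≤ Σℤ g
  Σℤ-mono {zero}  h = ≤-refl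
  Σℤ-mono {suc m} h = +-mono-≤ (h zero) (Σℤ-mono (h ∘ suc))

  Σℤ-const0 : ∀ m → Σℤ {m} (λ _ → 0ℤ) ≡ 0ℤ
  Σℤ-const0 zero = refl
  Σℤ-const0 (suc m) = trans (+-identityˡ _) (Σℤ-const0 m)

  term≤Σℤ : ∀ {m} (f : Fin m → ℤ) → (∀ c → 0ℤ ≤ f c) → ∀ c → f c ≤ Σℤ f
  term≤Σℤ {suc m} f h zero = subst (_≤ Σℤ f) (+-identityʳ (f zero))
    (+-monoʳ-≤ (f zero) (≤-trans (≤-reflexive (sym (Σℤ-const0 m))) (Σℤ-mono (h ∘ suc))))
  term≤Σℤ {suc m} f h (suc c) = subst (_≤ Σℤ f) (+-identityˡ (f (suc c)))
    (+-mono-≤ (h zero) (term≤Σℤ (f ∘ suc) (h ∘ suc) c))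

  Σℤ-≤-tight : ∀ {m} (f g : Fin m → ℤ) → (∀ c → f c ≤ g c) → Σℤ f ≡ Σℤ g → ∀ c → f c ≡ g c
  Σℤ-≤-tight {suc m} f g h e = go
    where
    lem₁ : ∀ a b c d → a - c ≡ (a + b - (c + d)) + (d - b)
    lem₁ = solve-∀
    lem₂ : ∀ a b c d → b - d ≡ (a + b - (c + d)) + (c - a)
    lem₂ = solve-∀
    e≥0 : 0ℤ ≤ Σℤ f - Σℤ g
    e≥0 = ≤-reflexive (sym (i≡j⇒i-j≡0 e))
    tails : Σℤ (f ∘ suc) ≡ Σℤ (g ∘ suc)
    tails = ≤-antisym (Σℤ-mono (h ∘ suc))
      (≤-by (0≤+ e≥0 (diff≥0 (h zero))) (lem₂ (f zero) (Σℤ (f ∘ suc)) (g zero) (Σℤ (g ∘ suc))))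
    go : ∀ c → f c ≡ g c
    go zero = ≤-antisym (h zero) (≤-by (0≤+ e≥0 (diff≥0 (Σℤ-mono (h ∘ suc)))) (lem₁ (f zero) (Σℤ (f ∘ suc)) (g zero) (Σℤ (g ∘ suc))))
    go (suc c) = Σℤ-≤-tight (f ∘ suc) (g ∘ suc) (h ∘ suc) tails c

  abstract
    pos : ℤ → ℤ
    pos z = z ⊔ 0ℤ

    pos-≥0 : ∀ {z} → 0ℤ ≤ z → pos z ≡ z
    pos-≥0 = i≥j⇒i⊔j≡i

    pos-≤0 : ∀ {z} → z ≤ 0ℤ → pos z ≡ 0ℤ
    pos-≤0 = i≤j⇒i⊔j≡j

    0≤pos : ∀ z → 0ℤ ≤ pos z
    0≤pos z = i≤j⊔i z 0ℤ

    z≤pos : ∀ z → z ≤ pos z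
    z≤pos z = i≤i⊔j z 0ℤ

  data Sign01 (z : ℤ) : Set where
    ≤0 : z ≤ 0ℤ → Sign01 z
    ≥1 : 1ℤ ≤ z → Sign01 z

  sign01 : ∀ z → Sign01 z
  sign01 z with z ≤? 0ℤ
  ... | yes p = ≤0 p
  ... | no ¬p = ≥1 (i<j⇒suc[i]≤j (≰⇒> ¬p))

  -- On integers this is the indicator of `1 ≤ z`, written as the difference in which it arises in
  -- `arr-row`.
  stp : ℤ → ℤ
  stp z = pos z - pos (z - 1ℤ)

  stp-≤0 : ∀ {z} → z ≤ 0ℤ → stp z ≡ 0ℤ
  stp-≤0 {z} p = cong₂ _-_ (pos-≤0 p) (pos-≤0 (≤-trans (<⇒≤ (a-1<a z)) p))

  stp-≥1 : ∀ {z} → 1ℤ ≤ z → stp z ≡ 1ℤ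
  stp-≥1 {z} p = trans (cong₂ _-_ (pos-≥0 (≤-trans (+≤+ ℕ.z≤n) p)) (pos-≥0 (diff≥0 p))) (lem z)
    where lem : ∀ z → z - (z - 1ℤ) ≡ 1ℤ
          lem = solve-∀

  module WordOrder (n′ : ℕ) where
    open AffinePermutations n′ public

    -- One reflection step, seen from the larger element: `w` inverts the pair and `v` undoes the
    -- inversion. The direction is thus recorded by an inversion and not by lengths, which makes it
    -- easy to follow under multiplication.
    record HStep (v w : Word) : Set where
      constructor hstep
      field
        {pa pb} : ℤ
        pa≢pb : ¬ rm pa ≡ rm pb
        pa<pb : pa < pb
        flip  : w ⟪ pb ⟫ < w ⟪ pa ⟫
        swap  : ∀ x → v ⟪ x ⟫ ≡ w ⟪ τ pa pb x ⟫

    infix 4 _⊑_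
    data _⊑_ (u : Word) : Word → Set where
      ⊑-refl : ∀ {v} → u ≋ v → u ⊑ v
      ⊑-step : ∀ {v w} → u ⊑ v → HStep v w → u ⊑ w

    ⊑-respʳ : ∀ {u v w} → u ⊑ v → v ≋ w → u ⊑ w
    ⊑-respʳ (⊑-refl e) f = ⊑-refl λ x → trans (e x) (f x)
    ⊑-respʳ (⊑-step p (hstep a≢b a<b flip swap)) f =
      ⊑-step p (hstep a≢b a<b (subst₂ _<_ (f _) (f _) flip) λ x → trans (swap x) (f _))

    ⊑-respˡ : ∀ {u u′ v} → u′ ≋ u → u ⊑ v → u′ ⊑ v
    ⊑-respˡ e (⊑-refl f) = ⊑-refl λ x → trans (e x) (f x)
    ⊑-respˡ e (⊑-step p s) = ⊑-step (⊑-respˡ e p) s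

    W-∷ʳ : ∀ u s x → (u ∷ʳ s) ⟪ x ⟫ ≡ σ s (u ⟪ x ⟫)
    W-∷ʳ u s x = W-++ u (s ∷ []) x

    σ² : ∀ s x → σ s (σ s x) ≡ x
    σ² s = τ-involutive (pred-≢ ⟦ s ⟧)

    ∷ʳ-∷ʳ : ∀ u s → u ∷ʳ s ∷ʳ s ≋ u
    ∷ʳ-∷ʳ u s x = trans (W-∷ʳ (u ∷ʳ s) s x) (trans (cong (σ s) (W-∷ʳ u s x)) (σ² s _))

    -- Multiplying a step from `v` to `w` on the right by s gives a step again, unless `σ s`
    -- reverses the two exchanged values. In that case `σ-flip` shows that the step is
    -- multiplication by s, so `v ∷ʳ s` is `w`.
    lifting : ∀ {u w} s → u ⊑ w → (u ∷ʳ s ⊑ w) ⊎ (u ∷ʳ s ⊑ w ∷ʳ s)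
    lifting {u} {w} s (⊑-refl e) = inj₂ (⊑-refl λ x → trans (W-∷ʳ u s x) (trans (cong (σ s) (e x)) (sym (W-∷ʳ w s x))))
    lifting {u} {w} s (⊑-step {v} p st@(hstep {a} {b} a≢b a<b flip swap)) = case (lifting s p)
      where
      vs-swap : ∀ x → (v ∷ʳ s) ⟪ x ⟫ ≡ σ s (w ⟪ τ a b x ⟫)
      vs-swap x = trans (W-∷ʳ v s x) (cong (σ s) (swap x))
      wa≢wb : ¬ rm (w ⟪ a ⟫) ≡ rm (w ⟪ b ⟫)
      wa≢wb e = a≢b (rm-fun-injective (W w) e)
      split : u ∷ʳ s ⊑ v ∷ʳ s → Tri (σ s (w ⟪ b ⟫) < σ s (w ⟪ a ⟫)) (σ s (w ⟪ b ⟫) ≡ σ s (w ⟪ a ⟫)) (σ s (w ⟪ a ⟫) < σ s (w ⟪ b ⟫)) →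
              (u ∷ʳ s ⊑ w) ⊎ (u ∷ʳ s ⊑ w ∷ʳ s)
      split q (tri≈ _ e _) = ⊥-elim (wa≢wb (cong rm (sym (fun-injective (σA s) e))))
      split q (tri< l _ _) = inj₂ (⊑-step q (hstep a≢b a<b
        (subst₂ _<_ (sym (W-∷ʳ w s b)) (sym (W-∷ʳ w s a)) l) λ x → trans (vs-swap x) (sym (W-∷ʳ w s _))))
      split q (tri> _ _ l) = inj₁ (⊑-respʳ q λ x → trans (vs-swap x)
        (trans (cong (σ s) (trans (τ-conj (W w) a≢b x) (trans (τ-sym wa≢wb _) (σ-flip s (wa≢wb ∘ sym) flip l _)))) (σ² s _)))
      case : (u ∷ʳ s ⊑ v) ⊎ (u ∷ʳ s ⊑ v ∷ʳ s) → (u ∷ʳ s ⊑ w) ⊎ (u ∷ʳ s ⊑ w ∷ʳ s)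
      case (inj₁ q) = inj₁ (⊑-step q st)
      case (inj₂ q) = split q (<-cmp (σ s (w ⟪ b ⟫)) (σ s (w ⟪ a ⟫)))

    window-≋ : ∀ u v → (∀ c → u ⟪ ⟦ c ⟧ ⟫ ≡ v ⟪ ⟦ c ⟧ ⟫) → u ≋ v
    window-≋ u v h x = trans (extend u) (trans (cong (_+ (x - ⟦ rm x ⟧)) (h (rm x))) (sym (extend v)))
      where extend : ∀ w → w ⟪ x ⟫ ≡ w ⟪ ⟦ rm x ⟧ ⟫ + (x - ⟦ rm x ⟧)
            extend w = fun-congruent (W w) (sym (rm-fin (rm x)))

    -- For v = ⟦ c ⟧ + k N the conditions v < j and F v ≥ m read - fl (F ⟦ c ⟧ - m) ≤ k < - fl (⟦ c
    -- ⟧ - j); the truncated difference counts such k.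
    term : Aff → ℤ → ℤ → Fin N → ℤ
    term F m j c = pos (fl (fun F ⟦ c ⟧ - m) - fl (⟦ c ⟧ - j))

    -- The number of v < j with F v ≥ m, summed over residue classes.
    arr : Aff → ℤ → ℤ → ℤ
    arr F m j = Σℤ (term F m j)

    -- The indicator of `v < j`, which means that the quotient of `v - j` is at most -1.
    below : ℤ → ℤ → ℤ
    below v j = stp (- fl (v - j))

    rm-diff : ∀ {x y} → rm (x - y) ≡ zero → rm x ≡ rm y
    rm-diff {x} {y} e = subst₂ (λ a b → rm a ≡ rm b) (lem x y) (+-identityˡ y)
      (rm-+ {x - y} {0ℤ} y (trans e (sym (rm-fin zero))))
      where lem : ∀ x y → x - y + y ≡ x
            lem = solve-∀

    fl-sub : ∀ z k → fl (z - k * Nℤ) ≡ fl z - k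
    fl-sub z k = trans (cong fl (lem z k Nℤ)) (fl-shift z (- k))
      where lem : ∀ z k N → z - k * N ≡ z + - k * N
            lem = solve-∀

    sub-residue : ∀ v → ⟦ rm v ⟧ ≡ v - fl v * Nℤ
    sub-residue v = trans (lem ⟦ rm v ⟧ (fl v * Nℤ)) (cong (_- fl v * Nℤ) (sym (divmod v)))
      where lem : ∀ r k → r ≡ r + k - k
            lem = solve-∀

    fl-residue : ∀ v j → fl (⟦ rm v ⟧ - j) ≡ fl (v - j) - fl v
    fl-residue v j = trans (cong (λ z → fl (z - j)) (sub-residue v))
      (trans (cong fl (lem v j (fl v * Nℤ))) (fl-sub (v - j) (fl v)))
      where lem : ∀ v j k → v - k - j ≡ v - j - k
            lem = solve-∀

    fl-fun-residue : ∀ F v m → fl (fun F ⟦ rm v ⟧ - m) ≡ fl (fun F v - m) - fl v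
    fl-fun-residue F v m = trans (cong (λ z → fl (z - m)) eq)
      (trans (cong fl (lem (fun F v) m (fl v * Nℤ))) (fl-sub (fun F v - m) (fl v)))
      where
      lem : ∀ v j k → v - k - j ≡ v - j - k
      lem = solve-∀
      lem₂ : ∀ f v k → f + (v - k - v) ≡ f - k
      lem₂ = solve-∀
      eq : fun F ⟦ rm v ⟧ ≡ fun F v - fl v * Nℤ
      eq = trans (fun-congruent F {⟦ rm v ⟧} {v} (rm-fin (rm v)))
        (trans (cong (λ z → fun F v + (z - v)) (sub-residue v)) (lem₂ (fun F v) v (fl v * Nℤ)))

    term-residue : ∀ F m j v → term F m j (rm v) ≡ pos (fl (fun F v - m) - fl (v - j))
    term-residue F m j v = cong pos (trans (cong₂ _-_ (fl-fun-residue F v m) (fl-residue v j))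
      (lem (fl (fun F v - m)) (fl (v - j)) (fl v)))
      where lem : ∀ a b c → (a - c) - (b - c) ≡ a - b
            lem = solve-∀

    fl0 : fl 0ℤ ≡ 0ℤ
    fl0 = fl-fin zero

    fl-1 : fl (- 1ℤ) ≡ - 1ℤ
    fl-1 = trans (fl-pred-zero {0ℤ} (rm-fin zero)) (cong (_- 1ℤ) fl0)

    -- Lowering the threshold from `m + 1` to `m` admits one more integer, the preimage of `m`, and
    -- it counts when it lies below `j`. Only its residue class changes its term.
    arr-row : ∀ F m j → arr F m j ≡ arr F (m + 1ℤ) j + below (inv F m) j
    arr-row F m j = trans (solve₁ (arr F m j) (term F (m + 1ℤ) j c₀))
      (trans (cong (_- term F (m + 1ℤ) j c₀) (sum-differ-at-one (term F m j) (term F (m + 1ℤ) j) c₀ same))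
      (trans (lem (arr F (m + 1ℤ) j) (term F m j c₀) (term F (m + 1ℤ) j c₀))
      (cong (λ z → arr F (m + 1ℤ) j + z) (cong₂ _-_ at-m at-m+1))))
      where
      v = inv F m
      c₀ = rm v
      solve₁ : ∀ a b → a ≡ a + b - b
      solve₁ = solve-∀
      lem : ∀ a b c → a + b - c ≡ a + (b - c)
      lem = solve-∀
      lem₂ : ∀ x m → x - (m + 1ℤ) ≡ x - m - 1ℤ
      lem₂ = solve-∀
      lem₃ : ∀ m → m - m ≡ 0ℤ
      lem₃ = solve-∀
      lem₄ : ∀ m → m - (m + 1ℤ) ≡ - 1ℤ
      lem₄ = solve-∀
      lem₅ : ∀ x → - 1ℤ - x ≡ - x - 1ℤ
      lem₅ = solve-∀
      same : ∀ c → ¬ c ≡ c₀ → term F m j c ≡ term F (m + 1ℤ) j c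
      same c c≢ = cong (λ z → pos (z - fl (⟦ c ⟧ - j)))
        (sym (trans (cong fl (lem₂ (fun F ⟦ c ⟧) m)) (fl-pred λ e →
          c≢ (trans (sym (rm-fin c)) (rm-fun-injective F (trans (rm-diff e) (cong rm (sym (fun-inv F m)))))))))
      at-m : term F m j c₀ ≡ pos (- fl (v - j))
      at-m = trans (term-residue F m j v) (cong pos (trans
        (cong (_- fl (v - j)) (trans (cong (λ z → fl (z - m)) (fun-inv F m)) (trans (cong fl (lem₃ m)) fl0))) (+-identityˡ _)))
      at-m+1 : term F (m + 1ℤ) j c₀ ≡ pos (- fl (v - j) - 1ℤ)
      at-m+1 = trans (term-residue F (m + 1ℤ) j v) (cong pos (trans
        (cong (_- fl (v - j)) (trans (cong (λ z → fl (z - (m + 1ℤ))) (fun-inv F m)) (trans (cong fl (lem₄ m)) fl-1))) (lem₅ (fl (v - j)))))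

    -- `σ s` exchanges values congruent to `s - 1` with their successors, and a threshold `m`
    -- separates such a pair only if it is congruent to `s`.
    arr-σ : ∀ s F m j → ¬ rm m ≡ s → arr (σA s ∘A F) m j ≡ arr F m j
    arr-σ s F m j m≢s = Σℤ-cong λ c → cong (λ z → pos (z - fl (⟦ c ⟧ - j))) (same (fun F ⟦ c ⟧))
      where
      lem₁ : ∀ z m → z - 1ℤ - m ≡ z - m - 1ℤ
      lem₁ = solve-∀
      lem₂ : ∀ z m → z - m ≡ z + 1ℤ - m - 1ℤ
      lem₂ = solve-∀
      lem₃ : ∀ s → s - 1ℤ + 1ℤ ≡ s
      lem₃ = solve-∀
      same : ∀ z → fl (σ s z - m) ≡ fl (z - m)
      same z = by-view (σ-view s z)
        where
        by-view : SigmaView s z → fl (σ s z - m) ≡ fl (z - m)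
        by-view (stay _ _ e) = cong (λ y → fl (y - m)) e
        by-view (down p e) = trans (cong (λ y → fl (y - m)) e) (trans (cong fl (lem₁ z m))
          (fl-pred λ q → m≢s (trans (sym (rm-diff q)) p)))
        by-view (up p e) = trans (cong (λ y → fl (y - m)) e) (sym (trans (cong fl (lem₂ z m))
          (fl-pred λ q → m≢s (trans (sym (rm-diff q)) (trans (rm-+ 1ℤ p) (trans (cong rm (lem₃ ⟦ s ⟧)) (rm-fin s)))))))

    below-≤1 : ∀ v j → below v j ≤ 1ℤ
    below-≤1 v j with sign01 (- fl (v - j))
    ... | ≤0 p = ≤-trans (≤-reflexive (stp-≤0 p)) (+≤+ ℕ.z≤n)
    ... | ≥1 p = ≤-reflexive (stp-≥1 p)

    private
      row-arith : ∀ {X Y p q r r′} → Sign01 q → Sign01 r′ → q ≤ p → r ≤ 1ℤ → X ≤ Y →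
                  X + stp q + stp p ≤ Y + stp r′ + r → X + stp q ≤ Y + stp r′
      row-arith {X} {Y} {p} {q} {r} {r′} (≤0 q≤0) (≤0 r≤0) _ _ X≤Y _ =
        ≤-trans (+-mono-≤ X≤Y (≤-reflexive (stp-≤0 q≤0))) (≤-reflexive (cong (λ z → Y + z) (sym (stp-≤0 r≤0))))
      row-arith {X} {Y} {p} {q} {r} {r′} (≤0 q≤0) (≥1 1≤r) _ _ X≤Y _ =
        +-mono-≤ X≤Y (≤-trans (≤-reflexive (stp-≤0 q≤0)) (≤-trans (+≤+ ℕ.z≤n) (≤-reflexive (sym (stp-≥1 1≤r)))))
      row-arith {X} {Y} {p} {q} {r} {r′} (≥1 1≤q) (≥1 1≤r) _ _ X≤Y _ =
        +-mono-≤ X≤Y (≤-reflexive (trans (stp-≥1 1≤q) (sym (stp-≥1 1≤r))))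
      row-arith {X} {Y} {p} {q} {r} {r′} (≥1 1≤q) (≤0 r≤0) q≤p r≤1 X≤Y h =
        ≤-by (0≤+ (diff≥0 h) (diff≥0 r≤1)) (trans (lem X Y (stp q) (stp r′) r) (cong (λ z → Y + stp r′ + r - (X + stp q + z) + (1ℤ - r)) (sym (stp-≥1 (≤-trans 1≤q q≤p)))))
        where lem : ∀ X Y q r′ r → Y + r′ - (X + q) ≡ Y + r′ + r - (X + q + 1ℤ) + (1ℤ - r)
              lem = solve-∀

    -- The bound could fail only if F gains 1 from row `m + 1` to row `m` and G gains nothing. As
    -- the preimage of `m - 1` under F lies further left, F then gains 1 again in row `m - 1`, where
    -- G gains at most 1, so the bound in that row already contains the one wanted.
    arr-row-≤ : ∀ F G m j → inv F (m - 1ℤ) < inv F m →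
                arr F (m + 1ℤ) j ≤ arr G (m + 1ℤ) j → arr F (m - 1ℤ) j ≤ arr G (m - 1ℤ) j → arr F m j ≤ arr G m j
    arr-row-≤ F G m j asc hi lo = subst₂ _≤_ (sym (arr-row F m j)) (sym (arr-row G m j))
      (row-arith (sign01 (- fl (inv F m - j))) (sign01 (- fl (inv G m - j)))
        (neg-mono-≤ (fl-mono (+-monoˡ-≤ (- j) (<⇒≤ asc))))
        (below-≤1 (inv G (m - 1ℤ)) j) hi (subst₂ _≤_ (two F) (two G) lo))
      where
      lem : ∀ m → m - 1ℤ + 1ℤ ≡ m
      lem = solve-∀
      two : ∀ H → arr H (m - 1ℤ) j ≡ arr H (m + 1ℤ) j + below (inv H m) j + below (inv H (m - 1ℤ)) j
      two H = trans (arr-row H (m - 1ℤ) j) (cong (_+ below (inv H (m - 1ℤ)) j)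
        (trans (cong (λ z → arr H z j) (lem m)) (arr-row H m j)))

    arr-cong : ∀ F G → (∀ v → fun F v ≡ fun G v) → ∀ m j → arr F m j ≡ arr G m j
    arr-cong F G e m j = Σℤ-cong λ c → cong (λ z → pos (fl (z - m) - fl (⟦ c ⟧ - j))) (e ⟦ c ⟧)

    infix 4 _⊴_
    _⊴_ : Aff → Aff → Set
    F ⊴ G = ∀ m j → arr F m j ≤ arr G m j

    -- Appending s exchanges the values `s - 1` and `s`, so whether it goes up is decided by the
    -- positions of these two values.
    Ascent : Word → Fin N → Set
    Ascent u s = inv (W u) (⟦ s ⟧ - 1ℤ) < inv (W u) ⟦ s ⟧

    ascent-shift : ∀ F s m → rm m ≡ s → inv F (⟦ s ⟧ - 1ℤ) < inv F ⟦ s ⟧ → inv F (m - 1ℤ) < inv F m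
    ascent-shift F s m e asc = subst₂ _<_ (sym (inv-congruent F m-1≡)) (sym (inv-congruent F m≡))
      (<-by (gap≥0 asc) (lem (inv F ⟦ s ⟧) (inv F (⟦ s ⟧ - 1ℤ)) m ⟦ s ⟧))
      where
      m≡ : rm m ≡ rm ⟦ s ⟧
      m≡ = trans e (sym (rm-fin s))
      m-1≡ : rm (m - 1ℤ) ≡ rm (⟦ s ⟧ - 1ℤ)
      m-1≡ = rm-+ (- 1ℤ) m≡
      lem : ∀ x y m s → x + (m - s) - (y + (m - 1ℤ - (s - 1ℤ))) - 1ℤ ≡ x - y - 1ℤ
      lem = solve-∀

    -- Replacing both sides by their product with s only changes the rows m ≡ s,
    -- and those are controlled by the two neighbouring rows.
    ⊴-descend : ∀ s F G F′ G′ → (∀ m j → ¬ rm m ≡ s → arr F′ m j ≡ arr F m j) →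
                (∀ m j → ¬ rm m ≡ s → arr G′ m j ≡ arr G m j) →
                inv F′ (⟦ s ⟧ - 1ℤ) < inv F′ ⟦ s ⟧ → F ⊴ G → F′ ⊴ G′
    ⊴-descend s F G F′ G′ hF hG asc F⊴G m j = decide (rm m Fin.≟ s)
      where
      other : ∀ m → ¬ rm m ≡ s → arr F′ m j ≤ arr G′ m j
      other m ≢s = subst₂ _≤_ (sym (hF m j ≢s)) (sym (hG m j ≢s)) (F⊴G m j)
      decide : Dec (rm m ≡ s) → arr F′ m j ≤ arr G′ m j
      decide (no ≢s) = other m ≢s
      decide (yes e) = arr-row-≤ F′ G′ m j (ascent-shift F′ s m e asc)
        (other (m + 1ℤ) λ q → rm-suc-≢ m (trans q (sym e)))
        (other (m - 1ℤ) λ q → pred-≢ m (trans q (sym e)))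

    ∷ʳ-inv : ∀ u s v → inv (W (u ∷ʳ s)) v ≡ inv (W u) (σ s v)
    ∷ʳ-inv u s = inv-unique (W (u ∷ʳ s)) (σA s ∘A W u) (W-∷ʳ u s)

    σ-at : ∀ s → σ s ⟦ s ⟧ ≡ ⟦ s ⟧ - 1ℤ
    σ-at s = trans (τ-snd ⟦ s ⟧ (pred-≢ ⟦ s ⟧) refl) (lem ⟦ s ⟧)
      where lem : ∀ s → s + (s - 1ℤ - s) ≡ s - 1ℤ
            lem = solve-∀

    σ-at-pred : ∀ s → σ s (⟦ s ⟧ - 1ℤ) ≡ ⟦ s ⟧
    σ-at-pred s = trans (cong (σ s) (sym (σ-at s))) (σ² s ⟦ s ⟧)

    arr-∷ʳ : ∀ u s m j → ¬ rm m ≡ s → arr (W (u ∷ʳ s)) m j ≡ arr (W u) m j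
    arr-∷ʳ u s m j m≢s = trans (arr-cong (W (u ∷ʳ s)) (σA s ∘A W u) (W-∷ʳ u s) m j) (arr-σ s (W u) m j m≢s)

    ascent? : ∀ u s → Ascent u s ⊎ Ascent (u ∷ʳ s) s
    ascent? u s = by (<-cmp (inv (W u) (⟦ s ⟧ - 1ℤ)) (inv (W u) ⟦ s ⟧))
      where
      by : Tri (inv (W u) (⟦ s ⟧ - 1ℤ) < inv (W u) ⟦ s ⟧) (inv (W u) (⟦ s ⟧ - 1ℤ) ≡ inv (W u) ⟦ s ⟧) (inv (W u) ⟦ s ⟧ < inv (W u) (⟦ s ⟧ - 1ℤ)) → Ascent u s ⊎ Ascent (u ∷ʳ s) s
      by (tri< p _ _) = inj₁ p
      by (tri≈ _ e _) = ⊥-elim (inv-≢ (W u) (pred-≢ ⟦ s ⟧) (cong rm e))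
      by (tri> _ _ p) = inj₂ (subst₂ _<_
        (sym (trans (∷ʳ-inv u s _) (cong (inv (W u)) (σ-at-pred s))))
        (sym (trans (∷ʳ-inv u s _) (cong (inv (W u)) (σ-at s)))) p)

    ascent-step : ∀ u s → Ascent u s → HStep u (u ∷ʳ s)
    ascent-step u s asc = hstep (inv-≢ (W u) (pred-≢ ⟦ s ⟧)) asc
      (subst₂ _<_ (sym at-b) (sym at-a) (a-1<a ⟦ s ⟧)) λ x → sym (trans (W-∷ʳ u s _)
        (trans (cong (σ s) (trans (τ-conj (W u) (inv-≢ (W u) (pred-≢ ⟦ s ⟧)) x)
          (cong₂ (λ a b → τ a b (u ⟪ x ⟫)) (fun-inv (W u) _) (fun-inv (W u) _)))) (σ² s _)))
      where
      at-b : (u ∷ʳ s) ⟪ inv (W u) ⟦ s ⟧ ⟫ ≡ ⟦ s ⟧ - 1ℤ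
      at-b = trans (W-∷ʳ u s _) (trans (cong (σ s) (fun-inv (W u) _)) (σ-at s))
      at-a : (u ∷ʳ s) ⟪ inv (W u) (⟦ s ⟧ - 1ℤ) ⟫ ≡ ⟦ s ⟧
      at-a = trans (W-∷ʳ u s _) (trans (cong (σ s) (fun-inv (W u) _)) (σ-at-pred s))

    HStep-deletion : ∀ {v w} → HStep v w → ∃ λ A → ∃ λ s → ∃ λ B → (w ≡ A ++ s ∷ B) × (A ++ B ≋ v)
    HStep-deletion {v} {w} (hstep a≢b a<b flip swap) with exchange w a≢b a<b flip
    ... | A , s , B , e , h = A , s , B , e , λ x → trans (h x) (sym (swap x))

    length-deletion : ∀ A (s : Fin N) B → length (A ++ s ∷ B) ≡ suc (length (A ++ B))
    length-deletion A s B = trans (Listₚ.length-++ A) (trans (ℕₚ.+-suc (length A) (length B)) (cong suc (sym (Listₚ.length-++ A))))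

    HStep-resp : ∀ {v w v′ w′} → v ≋ v′ → w ≋ w′ → HStep v w → HStep v′ w′
    HStep-resp e f (hstep a≢b a<b flip swap) =
      hstep a≢b a<b (subst₂ _<_ (f _) (f _) flip) λ x → trans (sym (e x)) (trans (swap x) (f _))

    -- The diagonal entries of the identity array vanish, which forces `x ⟪ v ⟫ ≤ v` for every v;
    -- equality follows from the equal window sums.
    ⊴-id : ∀ x → W x ⊴ idA → x ≋ []
    ⊴-id x h = window-≋ x [] (Σℤ-≤-tight (λ c → x ⟪ ⟦ c ⟧ ⟫) ⟦_⟧ (λ c → lower ⟦ c ⟧) (Σ-window x))
      where
      lem₁ : ∀ v → v - (v + 1ℤ) ≡ - 1ℤ
      lem₁ = solve-∀
      lem₂ : ∀ x v → x - (v + 1ℤ) ≡ x - v - 1ℤ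
      lem₂ = solve-∀
      id-zero : ∀ v → arr idA v v ≡ 0ℤ
      id-zero v = trans (Σℤ-cong λ c → trans (cong pos (+-inverseʳ (fl (⟦ c ⟧ - v)))) (pos-≤0 ≤-refl)) (Σℤ-const0 N)
      lower : ∀ v → x ⟪ v ⟫ ≤ v
      lower v with x ⟪ v ⟫ ≤? v
      ... | yes p = p
      ... | no ¬p = ⊥-elim (≤⇒≯ fl≤-1 (<-≤-trans -<+ (0≤⇒0≤fl (subst (0ℤ ≤_) (sym (lem₂ (x ⟪ v ⟫) v)) (gap≥0 (≰⇒> ¬p))))))
        where
        t≤0 : pos (fl (x ⟪ v ⟫ - (v + 1ℤ)) - fl (v - (v + 1ℤ))) ≤ 0ℤ
        t≤0 = ≤-trans (≤-reflexive (sym (term-residue (W x) (v + 1ℤ) (v + 1ℤ) v)))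
          (≤-trans (term≤Σℤ (term (W x) (v + 1ℤ) (v + 1ℤ)) (λ c → 0≤pos _) (rm v))
          (≤-trans (h (v + 1ℤ) (v + 1ℤ)) (≤-reflexive (id-zero (v + 1ℤ)))))
        fl≤-1 : fl (x ⟪ v ⟫ - (v + 1ℤ)) ≤ - 1ℤ
        fl≤-1 = ≤-trans (i-j≤0⇒i≤j (≤-trans (z≤pos _) t≤0)) (≤-reflexive (trans (cong fl (lem₁ v)) fl-1))

    length-∷ʳ : ∀ (u : Word) s → length (u ∷ʳ s) ≡ suc (length u)
    length-∷ʳ u s = trans (Listₚ.length-++ u) (ℕₚ.+-comm (length u) 1)

    -- Induction on the word of `y`, which may fail to be reduced; `k` is therefore only a bound for
    -- its length. If the last letter s is an ascent of the rest `u`, then whichever of `x` and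
    -- `x ∷ʳ s` ascends at s is below `u`, and `lifting` brings s back.
    ⊴⇒⊑ : ∀ k y → length y ℕ.≤ k → ∀ x → W x ⊴ W y → x ⊑ y
    ⊴⇒⊑ k y len x h = by k (initLast y) len h
      where
      shorten : ∀ {k} u s → length (u ∷ʳ s) ℕ.≤ suc k → length u ℕ.≤ k
      shorten u s len = ℕₚ.≤-pred (ℕₚ.≤-trans (ℕₚ.≤-reflexive (sym (length-∷ʳ u s))) len)

      module Step (k : ℕ) (u : Word) (s : Fin N) (len : length u ℕ.≤ k) (h : W x ⊴ W (u ∷ʳ s)) where
        descended : ∀ x′ → Ascent x′ s → (∀ m j → ¬ rm m ≡ s → arr (W x′) m j ≡ arr (W x) m j) → x′ ⊑ u
        descended x′ asc same = ⊴⇒⊑ k u len x′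
          (⊴-descend s (W x) (W (u ∷ʳ s)) (W x′) (W u) same (λ m j ≢s → sym (arr-∷ʳ u s m j ≢s)) asc h)

        finish : Ascent u s → Ascent x s ⊎ Ascent (x ∷ʳ s) s → x ⊑ u ∷ʳ s
        finish asc (inj₁ ascx) = ⊑-step (descended x ascx λ _ _ _ → refl) (ascent-step u s asc)
        finish asc (inj₂ ascx) = up-one (lifting s (descended (x ∷ʳ s) ascx (arr-∷ʳ x s)))
          where
          up-one : (x ∷ʳ s ∷ʳ s ⊑ u) ⊎ (x ∷ʳ s ∷ʳ s ⊑ u ∷ʳ s) → x ⊑ u ∷ʳ s
          up-one (inj₁ p) = ⊑-step (⊑-respˡ (λ v → sym (∷ʳ-∷ʳ x s v)) p) (ascent-step u s asc)
          up-one (inj₂ p) = ⊑-respˡ (λ v → sym (∷ʳ-∷ʳ x s v)) p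

        -- If u ∷ʳ s is not longer than u, the exchange property gives it a shorter word.
        shortcut : (∃ λ A → ∃ λ t → ∃ λ B → (u ≡ A ++ t ∷ B) × (A ++ B ≋ u ∷ʳ s)) → x ⊑ u ∷ʳ s
        shortcut (A , t , B , e , same) = ⊑-respʳ (⊴⇒⊑ k (A ++ B)
          (ℕₚ.≤-trans (ℕₚ.n≤1+n _) (ℕₚ.≤-trans (ℕₚ.≤-reflexive (sym (trans (cong length e) (length-deletion A t B)))) len)) x
          λ m j → ≤-trans (h m j) (≤-reflexive (arr-cong (W (u ∷ʳ s)) (W (A ++ B)) (λ v → sym (same v)) m j))) same

        conclude : Ascent u s ⊎ Ascent (u ∷ʳ s) s → x ⊑ u ∷ʳ s
        conclude (inj₁ asc) = finish asc (ascent? x s)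
        -- `u ∷ʳ s` is one step below `u ∷ʳ s ∷ʳ s`, which is `u` again, so deleting a letter of `u`
        -- spells `u ∷ʳ s`.
        conclude (inj₂ asc) = shortcut (HStep-deletion
          (HStep-resp {u ∷ʳ s} {u ∷ʳ s ∷ʳ s} {u ∷ʳ s} {u} (λ _ → refl) (∷ʳ-∷ʳ u s) (ascent-step (u ∷ʳ s) s asc)))

      by : ∀ {y} k → InitLast y → length y ℕ.≤ k → W x ⊴ W y → x ⊑ y
      by k [] len h = ⊑-refl (⊴-id x h)
      by zero (u ∷ʳ′ s) len h = ⊥-elim (ℕₚ.<⇒≱ (ℕₚ.≤-trans (ℕ.s≤s ℕ.z≤n) (ℕₚ.≤-reflexive (sym (length-∷ʳ u s)))) len)
      by (suc k) (u ∷ʳ′ s) len h = Step.conclude k u s (shorten u s len) h (ascent? u s)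

-- Majorisation of the vertices of alcoves.

module Majorisation where

  open import Data.Nat as ℕ using (ℕ; zero; suc)
  import Data.Nat.Properties as ℕₚ
  open import Data.Bool using (true; false)
  open import Data.Fin as Fin using (Fin; zero; suc)
  open import Data.Fin.Subset using (Subset)
  open import Data.Integer hiding (suc; pos)
  open import Data.Integer.Properties
  open import Data.Integer.Tactic.RingSolver using (solve-∀)
  open import Data.List using (List; []; _∷_; length)
  open import Data.Vec using ([]; _∷_)
  open import Data.Product using (∃; _×_; _,_)
  open import Data.Sum using (inj₁; inj₂)
  open import Function using (_∘_)
  open import Relation.Nullary using (¬_)
  open import Relation.Binary.PropositionalEquality

  open IntegerResidues
  open AffinePermutation
  open CoxeterOrder

  Σ₊ : ∀ {m} → (Fin m → ℤ) → (Fin m → ℤ) → ℤ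
  Σ₊ f g = Σℤ (λ c → pos (f c - g c))

  ssum : ∀ {m} → Subset m → (Fin m → ℤ) → ℤ
  ssum []          f = 0ℤ
  ssum (true ∷ K)  f = f zero + ssum K (f ∘ suc)
  ssum (false ∷ K) f = ssum K (f ∘ suc)

  card : ∀ {m} → Subset m → ℕ
  card []          = 0
  card (true ∷ K)  = suc (card K)
  card (false ∷ K) = card K

  card≤ : ∀ {m} (K : Subset m) → card K ℕ.≤ m
  card≤ []          = ℕ.z≤n
  card≤ (true ∷ K)  = ℕ.s≤s (card≤ K)
  card≤ (false ∷ K) = ℕₚ.m≤n⇒m≤1+n (card≤ K)

  psum : ∀ {m} → ℕ → (Fin m → ℤ) → ℤ
  psum         zero    f = 0ℤ
  psum {zero}  (suc k) f = 0ℤ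
  psum {suc m} (suc k) f = f zero + psum k (f ∘ suc)

  psum-cong : ∀ {m} k {f g : Fin m → ℤ} → (∀ c → f c ≡ g c) → psum k f ≡ psum k g
  psum-cong zero e = refl
  psum-cong {zero} (suc k) e = refl
  psum-cong {suc m} (suc k) e = cong₂ _+_ (e zero) (psum-cong k (e ∘ suc))

  psum-+ : ∀ {m} k (f g : Fin m → ℤ) → psum k (λ c → f c + g c) ≡ psum k f + psum k g
  psum-+ zero f g = refl
  psum-+ {zero} (suc k) f g = refl
  psum-+ {suc m} (suc k) f g = trans (cong (λ z → f zero + g zero + z) (psum-+ k (f ∘ suc) (g ∘ suc)))
    (lem (f zero) (g zero) (psum k (f ∘ suc)) (psum k (g ∘ suc)))
    where lem : ∀ a b c d → a + b + (c + d) ≡ a + c + (b + d)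
          lem = solve-∀


  -- The set of indices where `g` does not exceed `f` keeps exactly the terms that `pos` does not
  -- truncate.
  Σ₊-attained : ∀ {m} (f g : Fin m → ℤ) → ∃ λ K → Σ₊ f g ≡ ssum K f - ssum K g
  Σ₊-attained {zero} f g = [] , refl
  Σ₊-attained {suc m} f g with Σ₊-attained (f ∘ suc) (g ∘ suc) | ≤-total 0ℤ (f zero - g zero)
  ... | K , e | inj₁ p = true ∷ K , trans (cong₂ _+_ (pos-≥0 p) e) (lem (f zero) (g zero) (ssum K (f ∘ suc)) (ssum K (g ∘ suc)))
    where lem : ∀ a b c d → a - b + (c - d) ≡ a + c - (b + d)
          lem = solve-∀
  ... | K , e | inj₂ p = false ∷ K , trans (cong₂ _+_ (pos-≤0 p) e) (+-identityˡ _)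

  psum-≤-Σ₊ : ∀ {m} k (f g : Fin m → ℤ) → psum k f - psum k g ≤ Σ₊ f g
  psum-≤-Σ₊ {zero} zero f g = ≤-refl
  psum-≤-Σ₊ {zero} (suc k) f g = ≤-refl
  psum-≤-Σ₊ {suc m} zero f g = 0≤+ (0≤pos _) (psum-≤-Σ₊ zero (f ∘ suc) (g ∘ suc))
  psum-≤-Σ₊ {suc m} (suc k) f g = ≤-trans (≤-reflexive (lem (f zero) (g zero) (psum k (f ∘ suc)) (psum k (g ∘ suc))))
    (+-mono-≤ (z≤pos (f zero - g zero)) (psum-≤-Σ₊ k (f ∘ suc) (g ∘ suc)))
    where lem : ∀ a b c d → a + c - (b + d) ≡ a - b + (c - d)
          lem = solve-∀

  Increasing Decreasing : ∀ {m} → (Fin m → ℤ) → Set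
  Increasing f = ∀ c d → c Fin.≤ d → f c ≤ f d
  Decreasing f = ∀ c d → c Fin.≤ d → f d ≤ f c

  psum-tail : ∀ {m} (g : Fin (suc m) → ℤ) → Increasing g → ∀ k → k ℕ.≤ m → psum k g ≤ psum k (g ∘ suc)
  psum-tail g inc zero _ = ≤-refl
  psum-tail {suc m} g inc (suc k) (ℕ.s≤s k≤m) = +-mono-≤ (inc zero (suc zero) ℕ.z≤n)
    (psum-tail (g ∘ suc) (λ c d c≤d → inc (suc c) (suc d) (ℕ.s≤s c≤d)) k k≤m)

  psum-≤-ssum : ∀ {m} (K : Subset m) (g : Fin m → ℤ) → Increasing g → psum (card K) g ≤ ssum K g
  psum-≤-ssum [] g inc = ≤-refl
  psum-≤-ssum (true ∷ K) g inc = +-monoʳ-≤ (g zero) (psum-≤-ssum K (g ∘ suc) λ c d c≤d → inc (suc c) (suc d) (ℕ.s≤s c≤d))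
  psum-≤-ssum (false ∷ K) g inc = ≤-trans (psum-tail g inc (card K) (card≤ K))
    (psum-≤-ssum K (g ∘ suc) λ c d c≤d → inc (suc c) (suc d) (ℕ.s≤s c≤d))

  rep : ℕ → ℤ → ℤ
  rep zero    t = 0ℤ
  rep (suc k) t = t + rep k t

  ssum-≤-Σ₊ : ∀ {m} (K : Subset m) (f : Fin m → ℤ) t → ssum K f ≤ rep (card K) t + Σ₊ f (λ _ → t)
  ssum-≤-Σ₊ [] f t = ≤-refl
  ssum-≤-Σ₊ (true ∷ K) f t =
    step (rep (card K) t) t (f zero) (pos (f zero - t)) (Σ₊ (f ∘ suc) (λ _ → t)) (ssum K (f ∘ suc))
      (z≤pos (f zero - t)) (ssum-≤-Σ₊ K (f ∘ suc) t)
    where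
    lem : ∀ k t f p S s → t + k + (p + S) - (f + s) ≡ p - (f - t) + (k + S - s)
    lem = solve-∀
    step : ∀ k t f p S s → f - t ≤ p → s ≤ k + S → f + s ≤ t + k + (p + S)
    step k t f p S s h h′ = ≤-by (0≤+ (diff≥0 h) (diff≥0 h′)) (lem k t f p S s)
  ssum-≤-Σ₊ (false ∷ K) f t =
    step (rep (card K) t) (pos (f zero - t)) (Σ₊ (f ∘ suc) (λ _ → t)) (ssum K (f ∘ suc))
      (0≤pos (f zero - t)) (ssum-≤-Σ₊ K (f ∘ suc) t)
    where
    lem : ∀ k p S s → k + (p + S) - s ≡ p + (k + S - s)
    lem = solve-∀
    step : ∀ k p S s → 0ℤ ≤ p → s ≤ k + S → s ≤ k + (p + S)
    step k p S s h h′ = ≤-by (0≤+ h (diff≥0 h′)) (lem k p S s)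

  -- The partial sums of a decreasing sequence are recovered from its Σ₊ with constants:
  -- t is chosen between the k-th and the (k+1)-st entry.
  psum-attained : ∀ {m} k → k ℕ.≤ m → (f : Fin m → ℤ) → Decreasing f → ∀ M → (∀ c → f c ≤ M) →
                  ∃ λ t → t ≤ M × rep k t + Σ₊ f (λ _ → t) ≡ psum k f
  psum-attained {m} zero _ f dec M f≤M = M , ≤-refl , trans (+-identityˡ _)
      (trans (Σℤ-cong λ c → pos-≤0 (≤-trans (+-monoˡ-≤ (- M) (f≤M c)) (≤-reflexive (+-inverseʳ M)))) (Σℤ-const0 m))
  psum-attained {suc m} (suc k) (ℕ.s≤s k≤m) f dec M f≤M
    with psum-attained k k≤m (f ∘ suc) (λ c d c≤d → dec (suc c) (suc d) (ℕ.s≤s c≤d)) (f zero) (λ c → dec zero (suc c) ℕ.z≤n)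
  ... | t , t≤f₀ , e = t , ≤-trans t≤f₀ (f≤M zero) ,
    trans (cong (λ z → t + rep k t + (z + Σ₊ (f ∘ suc) (λ _ → t))) (pos-≥0 (diff≥0 t≤f₀)))
      (trans (lem (rep k t) t (f zero) (Σ₊ (f ∘ suc) (λ _ → t))) (cong (λ z → f zero + z) e))
    where lem : ∀ k t f S → t + k + (f - t + S) ≡ f + (k + S)
          lem = solve-∀

  -- Convexity of `pos`: at equal sums, `A` and `D` are spread at least as far apart as `B` and `C`.
  pos-supermodular : ∀ A B C D → B + C ≡ A + D → B ≤ A → C ≤ A → pos B + pos C ≤ pos A + pos D
  pos-supermodular A B C D e B≤A C≤A with ≤-total 0ℤ B | ≤-total 0ℤ C
  ... | inj₁ p | inj₁ q = ≤-trans (≤-reflexive (trans (cong₂ _+_ (pos-≥0 p) (pos-≥0 q)) e)) (+-mono-≤ (z≤pos A) (z≤pos D))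
  ... | inj₁ p | inj₂ q = ≤-trans (≤-reflexive (cong₂ _+_ (pos-≥0 p) (pos-≤0 q))) (+-mono-≤ (≤-trans B≤A (z≤pos A)) (0≤pos D))
  ... | inj₂ p | inj₁ q = ≤-trans (≤-reflexive (trans (cong₂ _+_ (pos-≤0 p) (pos-≥0 q)) (+-comm 0ℤ C))) (+-mono-≤ (≤-trans C≤A (z≤pos A)) (0≤pos D))
  ... | inj₂ p | inj₂ q = ≤-trans (≤-reflexive (cong₂ _+_ (pos-≤0 p) (pos-≤0 q))) (+-mono-≤ (0≤pos A) (0≤pos D))

  module Majorization (n′ : ℕ) where
    open WordOrder n′ public

    -- The vertices of the alcove of F, indexed by m modulo N and up to multiples of (1, …, 1).
    vert : Aff → ℤ → Fin N → ℤ
    vert F m c = fl (fun F ⟦ c ⟧ - m)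

    -- Two coordinates change: `P - k` and `Q - l` for `w` become `Q - k` and `P - l` for `v`. As Q
    -- ≤ P and k ≤ l, the pair for `w` contains the largest and the smallest of the four, and
    -- convexity applies.
    HStep-Σ₊ : ∀ {v w} → HStep v w → ∀ m t → Σ₊ (vert (W v) m) (λ _ → t) ≤ Σ₊ (vert (W w) m) (λ _ → t)
    HStep-Σ₊ {v} {w} (hstep {a} {b} a≢b a<b flip swap) m t =
      ≤-by (diff≥0 (pos-supermodular (P - k - t) (Q - k - t) (P - l - t) (Q - l - t) (lem₁ P Q k l t)
             (+-monoˡ-≤ (- t) (+-monoˡ-≤ (- k) Q≤P)) (+-monoˡ-≤ (- t) (+-monoʳ-≤ P (neg-mono-≤ k≤l)))))
        (trans (lem₂ (Σℤ f) (Σℤ g) (f (rm a) + f (rm b)) (g (rm a) + g (rm b)) (sum-differ-at-two f g (rm a) (rm b) a≢b same))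
          (cong₂ _-_ (cong₂ _+_ (at-w a) (at-w b)) (cong₂ _+_ at-a at-b)))
      where
      f g : Fin N → ℤ
      f c = pos (vert (W v) m c - t)
      g c = pos (vert (W w) m c - t)
      P = fl (w ⟪ a ⟫ - m)
      Q = fl (w ⟪ b ⟫ - m)
      k = fl a
      l = fl b
      Q≤P : Q ≤ P
      Q≤P = fl-mono (+-monoˡ-≤ (- m) (<⇒≤ flip))
      k≤l : k ≤ l
      k≤l = fl-mono (<⇒≤ a<b)
      lem₁ : ∀ P Q k l t → Q - k - t + (P - l - t) ≡ P - k - t + (Q - l - t)
      lem₁ = solve-∀
      lem₂ : ∀ F G x y → F + y ≡ G + x → G - F ≡ y - x
      lem₂ F G x y e = trans (lem₃ F G x y) (trans (cong (λ z → y - x + (z - (F + y))) (sym e)) (lem₄ F y x))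
        where lem₃ : ∀ F G x y → G - F ≡ y - x + (G + x - (F + y))
              lem₃ = solve-∀
              lem₄ : ∀ F y x → y - x + (F + y - (F + y)) ≡ y - x
              lem₄ = solve-∀
      same : ∀ c → ¬ c ≡ rm a → ¬ c ≡ rm b → f c ≡ g c
      same c p q = cong (λ z → pos (fl (z - m) - t)) (trans (swap ⟦ c ⟧) (window-τ-off (W w) a≢b c p q))
      at-w : ∀ x → g (rm x) ≡ pos (fl (w ⟪ x ⟫ - m) - fl x - t)
      at-w x = cong (λ z → pos (z - t)) (fl-fun-residue (W w) x m)
      lem₅ : ∀ x y m → x - y - m ≡ x - m - y
      lem₅ = solve-∀
      moved : ∀ x y → fl (w ⟪ x ⟫ - fl y * Nℤ - m) ≡ fl (w ⟪ x ⟫ - m) - fl y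
      moved x y = trans (cong fl (lem₅ (w ⟪ x ⟫) (fl y * Nℤ) m)) (fl-sub (w ⟪ x ⟫ - m) (fl y))
      at-a : f (rm a) ≡ pos (Q - k - t)
      at-a = cong (λ z → pos (z - t)) (trans (cong (λ z → fl (z - m)) (trans (swap ⟦ rm a ⟧) (window-τ-fst (W w) a≢b))) (moved b a))
      at-b : f (rm b) ≡ pos (P - l - t)
      at-b = cong (λ z → pos (z - t)) (trans (cong (λ z → fl (z - m)) (trans (swap ⟦ rm b ⟧) (window-τ-snd (W w) a≢b))) (moved a b))

    ⊑-Σ₊ : ∀ {v w} → v ⊑ w → ∀ m t → Σ₊ (vert (W v) m) (λ _ → t) ≤ Σ₊ (vert (W w) m) (λ _ → t)
    ⊑-Σ₊ (⊑-refl e) m t = ≤-reflexive (Σℤ-cong λ c → cong (λ z → pos (fl (z - m) - t)) (e ⟦ c ⟧))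
    ⊑-Σ₊ (⊑-step p st) m t = ≤-trans (⊑-Σ₊ p m t) (HStep-Σ₊ st m t)

    infix 4 _⋐_
    _⋐_ : Word → Word → Set
    x ⋐ y = ∀ m K → ssum K (vert (W x) m) ≤ psum (card K) (vert (W y) m)

    -- An array entry is `Σ₊` of a vertex against the increasing vector `g` of the threshold `j`.
    -- The optimal K for `x` is replaced by the first `card K` coordinates: the vertex sum does not
    -- fall by `h`, and the sum of `g` does not rise, since the smallest entries of `g` come first.
    ⋐⇒⊑ : ∀ {x y} → x ⋐ y → x ⊑ y
    ⋐⇒⊑ {x} {y} h = ⊴⇒⊑ (length y) y ℕₚ.≤-refl x below-arr
      where
      below-arr : W x ⊴ W y
      below-arr m j = bound (Σ₊-attained X g)
        where
        X = vert (W x) m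
        Y = vert (W y) m
        g : Fin N → ℤ
        g c = fl (⟦ c ⟧ - j)
        inc : Increasing g
        inc c d c≤d = fl-mono (+-monoˡ-≤ (- j) (+≤+ c≤d))
        bound : (∃ λ K → Σ₊ X g ≡ ssum K X - ssum K g) → Σ₊ X g ≤ Σ₊ Y g
        bound (K , e) = ≤-trans (≤-reflexive e) (≤-trans (+-mono-≤ (h m K) (neg-mono-≤ (psum-≤-ssum K g inc))) (psum-≤-Σ₊ (card K) Y g))

    -- The alcove has points with coordinates `hat x (y ⟪ ⟦ c ⟧ ⟫)`, where `hat x` is increasing
    -- (`hat-mono`), so this places it in the dominant chamber.
    Dom : Word → Set
    Dom y = Decreasing (λ c → y ⟪ ⟦ c ⟧ ⟫)

    -- With k = `card K`, every constant t bounds the sum over K for `x` by k t + Σ₊, and Σ₊ grows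
    -- along reflection steps. The t of `psum-attained`, available since the vertex of `y` is
    -- sorted, turns this bound into the partial sum for `y`.
    ⊑⇒⋐ : ∀ {x y} → Dom y → x ⊑ y → x ⋐ y
    ⊑⇒⋐ {x} {y} dom p m K = attain (psum-attained (card K) (card≤ K) Y dec (Y zero) (λ c → dec zero c ℕ.z≤n))
      where
      Y = vert (W y) m
      dec : Decreasing Y
      dec c d c≤d = fl-mono (+-monoˡ-≤ (- m) (dom c d c≤d))
      attain : (∃ λ t → t ≤ Y zero × rep (card K) t + Σ₊ Y (λ _ → t) ≡ psum (card K) Y) → ssum K (vert (W x) m) ≤ psum (card K) Y
      attain (t , _ , e) = ≤-trans (ssum-≤-Σ₊ K (vert (W x) m) t)
        (≤-trans (+-monoʳ-≤ (rep (card K) t) (⊑-Σ₊ p m t)) (≤-reflexive e))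

-- The integers inside the rationals.

module RationalEmbedding where

  open import Data.Nat as ℕ using (ℕ; zero; suc)
  open import Data.Integer as ℤ using (ℤ; +_)
  import Data.Integer.Properties as ℤₚ
  import Data.Integer.Tactic.RingSolver as ℤSolver
  open import Data.Rational
  open import Data.Rational.Properties
  import Data.Rational.Unnormalised as ℚᵘ
  import Data.Rational.Unnormalised.Properties as ℚᵘₚ
  open import Data.Empty using (⊥-elim)
  open import Relation.Nullary using (yes; no)
  open import Relation.Nullary.Decidable using (dec⇒maybe)
  open import Relation.Binary.Definitions using (tri<; tri≈; tri>)
  open import Relation.Binary.PropositionalEquality
  open import Tactic.RingSolver using (solve-∀)
  open import Tactic.RingSolver.Core.AlmostCommutativeRing using (AlmostCommutativeRing; fromCommutativeRing)
  import Algebra.Properties.CommutativeMonoid.Sum as MonoidSum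

  open AffinePermutation using (module SumTwoPoints)

  ℚ-ring : AlmostCommutativeRing _ _
  ℚ-ring = fromCommutativeRing +-*-commutativeRing λ x → dec⇒maybe (0ℚ ≟ x)

  open SumTwoPoints +-0-commutativeMonoid public using () renaming (sum-differ-at-one to Σℚ-differ-at-one; sum-differ-at-two to Σℚ-differ-at-two)
  open MonoidSum +-0-commutativeMonoid public using () renaming (sum to Σℚ)

  abstract
    ι : ℤ → ℚ
    ι k = k / 1

    ι-def : ∀ k → k / 1 ≡ ι k
    ι-def k = refl

    private
      ι-toℚᵘ : ∀ k → toℚᵘ (ι k) ℚᵘ.≃ ℚᵘ.mkℚᵘ k 0
      ι-toℚᵘ k = toℚᵘ-fromℚᵘ (ℚᵘ.mkℚᵘ k 0)

    ι-+ : ∀ a b → ι (a ℤ.+ b) ≡ ι a + ι b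
    ι-+ a b = toℚᵘ-injective (ℚᵘₚ.≃-trans (ι-toℚᵘ (a ℤ.+ b)) (ℚᵘₚ.≃-sym
      (ℚᵘₚ.≃-trans (toℚᵘ-homo-+ (ι a) (ι b)) (ℚᵘₚ.≃-trans (ℚᵘₚ.+-cong (ι-toℚᵘ a) (ι-toℚᵘ b)) (ℚᵘ.*≡* (lem a b))))))
      where lem : ∀ a b → (a ℤ.* + 1 ℤ.+ b ℤ.* + 1) ℤ.* + 1 ≡ (a ℤ.+ b) ℤ.* + 1
            lem = ℤSolver.solve-∀

    ι-* : ∀ a b → ι (a ℤ.* b) ≡ ι a * ι b
    ι-* a b = toℚᵘ-injective (ℚᵘₚ.≃-trans (ι-toℚᵘ (a ℤ.* b)) (ℚᵘₚ.≃-sym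
      (ℚᵘₚ.≃-trans (toℚᵘ-homo-* (ι a) (ι b)) (ℚᵘₚ.≃-trans (ℚᵘₚ.*-cong (ι-toℚᵘ a) (ι-toℚᵘ b)) ℚᵘₚ.≃-refl))))

    ι-neg : ∀ a → ι (ℤ.- a) ≡ - ι a
    ι-neg a = toℚᵘ-injective (ℚᵘₚ.≃-trans (ι-toℚᵘ (ℤ.- a)) (ℚᵘₚ.≃-sym
      (ℚᵘₚ.≃-trans (toℚᵘ-homo‿- (ι a)) (ℚᵘₚ.-‿cong (ι-toℚᵘ a)))))

    ι-0 : ι (+ 0) ≡ 0ℚ
    ι-0 = refl

    ι-1 : ι (+ 1) ≡ 1ℚ
    ι-1 = refl

    ι-mono-< : ∀ {a b} → a ℤ.< b → ι a < ι b
    ι-mono-< {a} {b} p = toℚᵘ-cancel-< (ℚᵘₚ.<-respʳ-≃ (ℚᵘₚ.≃-sym (ι-toℚᵘ b)) (ℚᵘₚ.<-respˡ-≃ (ℚᵘₚ.≃-sym (ι-toℚᵘ a))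
      (ℚᵘ.*<* (subst₂ ℤ._<_ (sym (ℤₚ.*-identityʳ a)) (sym (ℤₚ.*-identityʳ b)) p))))

    -- This is 1 / (2 (d + 1)); for d = n it is 1 / (2 N), the unit in which the barycentre has
    -- integer coordinates.
    half : ℕ → ℚ
    half d = + 1 / suc (suc (d ℕ.+ d))

    half-pos : ∀ d → 0ℚ < half d
    half-pos d = toℚᵘ-cancel-< (ℚᵘₚ.<-respʳ-≃ (ℚᵘₚ.≃-sym (toℚᵘ-fromℚᵘ (ℚᵘ.mkℚᵘ (+ 1) (suc (d ℕ.+ d)))))
      (ℚᵘ.*<* (ℤ.+<+ (ℕ.s≤s ℕ.z≤n))))

    half-unit : ∀ d → ι (+ suc d ℤ.+ + suc d) * half d ≡ 1ℚ
    half-unit d = toℚᵘ-injective (ℚᵘₚ.≃-trans (toℚᵘ-homo-* (ι (+ suc d ℤ.+ + suc d)) (half d))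
      (ℚᵘₚ.≃-trans (ℚᵘₚ.*-cong (ι-toℚᵘ (+ suc d ℤ.+ + suc d)) (toℚᵘ-fromℚᵘ (ℚᵘ.mkℚᵘ (+ 1) (suc (d ℕ.+ d)))))
      (ℚᵘ.*≡* (lem (+ d)))))
      where lem : ∀ d → (+ 1 ℤ.+ d ℤ.+ (+ 1 ℤ.+ d)) ℤ.* + 1 ℤ.* + 1 ≡ + 1 ℤ.* (+ 1 ℤ.* (+ 2 ℤ.+ (d ℤ.+ d)))
            lem = ℤSolver.solve-∀

    /-scale : ∀ k d → k / suc d ≡ ι k * (+ 1 / suc d)
    /-scale k d = toℚᵘ-injective (ℚᵘₚ.≃-trans (toℚᵘ-fromℚᵘ (ℚᵘ.mkℚᵘ k d)) (ℚᵘₚ.≃-sym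
      (ℚᵘₚ.≃-trans (toℚᵘ-homo-* (ι k) (+ 1 / suc d)) (ℚᵘₚ.≃-trans (ℚᵘₚ.*-cong (ι-toℚᵘ k) (toℚᵘ-fromℚᵘ (ℚᵘ.mkℚᵘ (+ 1) d)))
      (ℚᵘ.*≡* (lem k (+ d)))))))
      where lem : ∀ k d → k ℤ.* + 1 ℤ.* (+ 1 ℤ.+ d) ≡ k ℤ.* (+ 1 ℤ.* (+ 1 ℤ.+ d))
            lem = ℤSolver.solve-∀

    /-unit : ∀ d → ι (+ suc d) * (+ 1 / suc d) ≡ 1ℚ
    /-unit d = toℚᵘ-injective (ℚᵘₚ.≃-trans (toℚᵘ-homo-* (ι (+ suc d)) (+ 1 / suc d))
      (ℚᵘₚ.≃-trans (ℚᵘₚ.*-cong (ι-toℚᵘ (+ suc d)) (toℚᵘ-fromℚᵘ (ℚᵘ.mkℚᵘ (+ 1) d)))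
      (ℚᵘ.*≡* (lem (+ d)))))
      where lem : ∀ d → (+ 1 ℤ.+ d) ℤ.* + 1 ℤ.* + 1 ≡ + 1 ℤ.* (+ 1 ℤ.* (+ 1 ℤ.+ d))
            lem = ℤSolver.solve-∀

  ι-sub : ∀ a b → ι (a ℤ.- b) ≡ ι a - ι b
  ι-sub a b = trans (ι-+ a (ℤ.- b)) (cong (λ z → ι a + z) (ι-neg b))

  ι-injective : ∀ {a b} → ι a ≡ ι b → a ≡ b
  ι-injective {a} {b} e with ℤₚ.<-cmp a b
  ... | tri< q _ _ = ⊥-elim (<-irrefl e (ι-mono-< q))
  ... | tri≈ _ r _ = r
  ... | tri> _ _ q = ⊥-elim (<-irrefl (sym e) (ι-mono-< q))

  ι-mono-≤ : ∀ {a b} → a ℤ.≤ b → ι a ≤ ι b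
  ι-mono-≤ {a} {b} p with a ℤₚ.≟ b
  ... | yes refl = ≤-refl
  ... | no a≢b = <⇒≤ (ι-mono-< (ℤₚ.≤∧≢⇒< p a≢b))

  ι-cancel-≤ : ∀ {a b} → ι a ≤ ι b → a ℤ.≤ b
  ι-cancel-≤ {a} {b} p with ℤₚ.<-cmp a b
  ... | tri< q _ _ = ℤₚ.<⇒≤ q
  ... | tri≈ _ refl _ = ℤₚ.≤-refl
  ... | tri> _ _ q = ⊥-elim (<-irrefl refl (<-≤-trans (ι-mono-< q) p))

  private
    lem-cancel : ∀ a b → a - b + b ≡ a
    lem-cancel = solve-∀ ℚ-ring

  0≤⇒≤ : ∀ {a b} → 0ℚ ≤ a - b → b ≤ a
  0≤⇒≤ {a} {b} p = subst₂ _≤_ (+-identityˡ b) (lem-cancel a b) (+-monoˡ-≤ b p)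

  0<⇒< : ∀ {a b} → 0ℚ < a - b → b < a
  0<⇒< {a} {b} p = subst₂ _<_ (+-identityˡ b) (lem-cancel a b) (+-monoˡ-< b p)

  <⇒0< : ∀ {a b} → b < a → 0ℚ < a - b
  <⇒0< {a} {b} p = subst (_< a - b) (+-inverseʳ b) (+-monoˡ-< (- b) p)

-- W_aff acting on rational points through affine permutations.

module AlcoveMaps where

  open import Data.Nat as ℕ using (ℕ; zero; suc)
  import Data.Nat.Properties as ℕₚ
  open import Data.Fin as Fin using (Fin; zero; suc; toℕ; inject₁; fromℕ)
  import Data.Fin.Properties as Finₚ
  open import Data.Integer as ℤ using (ℤ; +_; -[1+_])
  import Data.Integer.Properties as ℤₚ
  import Data.Integer.Tactic.RingSolver as ℤSolver
  open import Data.Rational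
  open import Data.Rational.Properties
  open import Data.List using (List; []; _∷_; _++_; foldr)
  open import Data.Product using (∃; _,_; proj₁; proj₂)
  open import Data.Empty using (⊥-elim)
  open import Function using (_∘_; id)
  open import Relation.Nullary using (¬_; Dec; yes; no)
  open import Relation.Nullary.Decidable using (dec-true; dec-false)
  open import Relation.Binary.Definitions using (Tri; tri<; tri≈; tri>)
  open import Relation.Binary.PropositionalEquality
  open import Data.Bool using (if_then_else_)
  open import Tactic.RingSolver using (solve-∀)

  open IntegerResidues
  open Majorisation
  open RationalEmbedding

  module Maps (n′ : ℕ) where
    open Majorization n′ public
    open AType (suc n′) hiding (N) public

    n : ℕ
    n = suc n′

    -- Extending points to ℤ by x̂(v + N) = x̂(v) + 1, W_aff acts by precomposition with affine
    -- permutations, so products of generators compose in the opposite order.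
    hat : Pt → ℤ → ℚ
    hat x v = x (rm v) + ι (fl v)

    hat-cong : ∀ {x y} → x ≐ y → ∀ v → hat x v ≡ hat y v
    hat-cong e v = cong (_+ ι (fl v)) (e (rm v))

    hat-shift : ∀ x v k → hat x (v ℤ.+ k ℤ.* Nℤ) ≡ hat x v + ι k
    hat-shift x v k = trans (cong₂ (λ c q → x c + q) (rm-shift v k) (trans (cong ι (fl-shift v k)) (ι-+ (fl v) k)))
      (sym (+-assoc (x (rm v)) (ι (fl v)) (ι k)))

    hat-fin : ∀ x c → hat x ⟦ c ⟧ ≡ x c
    hat-fin x c = trans (cong₂ (λ d q → x d + q) (rm-fin c) (trans (cong ι (fl-fin c)) ι-0)) (+-identityʳ (x c))

    act : (ℤ → ℤ) → Map
    act f x c = hat x (f ⟦ c ⟧)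

    hat-act : ∀ F x v → hat (act (fun F) x) v ≡ hat x (fun F v)
    hat-act F x v = trans (sym (hat-shift x (fun F ⟦ rm v ⟧) (fl v)))
      (cong (hat x) (trans (sym (shift F ⟦ rm v ⟧ (fl v))) (cong (fun F) (sym (divmod v)))))

    Σᶠ≡Σℚ : ∀ {m} (f : Fin m → ℚ) → Σᶠ f ≡ Σℚ f
    Σᶠ≡Σℚ {zero} f = refl
    Σᶠ≡Σℚ {suc m} f = cong (λ z → f zero + z) (Σᶠ≡Σℚ (f ∘ suc))

    Σᶠ-cong : ∀ {m} {f g : Fin m → ℚ} → (∀ c → f c ≡ g c) → Σᶠ f ≡ Σᶠ g
    Σᶠ-cong {zero} e = refl
    Σᶠ-cong {suc m} e = cong₂ _+_ (e zero) (Σᶠ-cong (e ∘ suc))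

    Σᶠ-zero : ∀ m → Σᶠ {m} (λ _ → 0ℚ) ≡ 0ℚ
    Σᶠ-zero zero = refl
    Σᶠ-zero (suc m) = trans (+-identityˡ _) (Σᶠ-zero m)

    Σᶠ-differ : ∀ {m} (f g : Fin m → ℚ) i j → ¬ i ≡ j → (∀ k → ¬ k ≡ i → ¬ k ≡ j → f k ≡ g k) →
                Σᶠ f + (g i + g j) ≡ Σᶠ g + (f i + f j)
    Σᶠ-differ f g i j i≢j h = subst₂ (λ F G → F + (g i + g j) ≡ G + (f i + f j)) (sym (Σᶠ≡Σℚ f)) (sym (Σᶠ≡Σℚ g))
      (Σℚ-differ-at-two f g i j i≢j h)

    ε-same : ∀ i → ε i i ≡ 1ℚ
    ε-same i = cong (λ b → if b then 1ℚ else 0ℚ) (dec-true (i Fin.≟ i) refl)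

    ε-diff : ∀ {i j} → ¬ i ≡ j → ε i j ≡ 0ℚ
    ε-diff {i} {j} i≢j = cong (λ b → if b then 1ℚ else 0ℚ) (dec-false (i Fin.≟ j) i≢j)

    module _ {i j : Fin N} (i≢j : ¬ i ≡ j) where
      root-fst : root i j i ≡ 1ℚ
      root-fst = cong₂ _-_ (ε-same i) (ε-diff (i≢j ∘ sym))

      root-snd : root i j j ≡ - 1ℚ
      root-snd = cong₂ _-_ (ε-diff i≢j) (ε-same j)

      root-off : ∀ c → ¬ c ≡ i → ¬ c ≡ j → root i j c ≡ 0ℚ
      root-off c c≢i c≢j = cong₂ _-_ (ε-diff (c≢i ∘ sym)) (ε-diff (c≢j ∘ sym))

      inner-root : ∀ x → ⟨ x , root i j ⟩ ≡ x i - x j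
      inner-root x = trans (sym (+-identityʳ _))
        (trans (Σᶠ-differ (λ c → x c * root i j c) (λ _ → 0ℚ) i j i≢j
          (λ c p q → trans (cong (x c *_) (root-off c p q)) (*-zeroʳ (x c))))
        (trans (cong₂ _+_ (Σᶠ-zero N) (cong₂ _+_ (cong (x i *_) root-fst) (cong (x j *_) root-snd))) (lem (x i) (x j))))
        where lem : ∀ a b → 0ℚ + (a * 1ℚ + b * (- 1ℚ)) ≡ a - b
              lem = solve-∀ ℚ-ring

      sref-fst : ∀ k x → sref (root i j) k x i ≡ x j + ι k
      sref-fst k x = trans (cong₂ (λ p r → x i - (p - ℤ→ℚ k) * r) (inner-root x) root-fst)
        (trans (lem (x i) (x j) (ℤ→ℚ k)) (cong (λ z → x j + z) (ι-def k)))
        where lem : ∀ a b k → a - (a - b - k) * 1ℚ ≡ b + k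
              lem = solve-∀ ℚ-ring

      sref-snd : ∀ k x → sref (root i j) k x j ≡ x i - ι k
      sref-snd k x = trans (cong₂ (λ p r → x j - (p - ℤ→ℚ k) * r) (inner-root x) root-snd)
        (trans (lem (x i) (x j) (ℤ→ℚ k)) (cong (λ z → x i - z) (ι-def k)))
        where lem : ∀ a b k → b - (a - b - k) * (- 1ℚ) ≡ a - k
              lem = solve-∀ ℚ-ring

      sref-off : ∀ k x c → ¬ c ≡ i → ¬ c ≡ j → sref (root i j) k x c ≡ x c
      sref-off k x c p q = trans (cong (λ r → x c - (⟨ x , root i j ⟩ - ℤ→ℚ k) * r) (root-off c p q)) (lem (x c) (⟨ x , root i j ⟩ - ℤ→ℚ k))
        where lem : ∀ a b → a - b * 0ℚ ≡ a
              lem = solve-∀ ℚ-ring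

      private
        b : ℤ → ℤ
        b k = ⟦ j ⟧ ℤ.+ k ℤ.* Nℤ

        rm-b : ∀ k → rm (b k) ≡ j
        rm-b k = trans (rm-shift ⟦ j ⟧ k) (rm-fin j)

      root-≢ : ∀ k → ¬ rm ⟦ i ⟧ ≡ rm (⟦ j ⟧ ℤ.+ k ℤ.* Nℤ)
      root-≢ k e = i≢j (trans (sym (rm-fin i)) (trans e (rm-b k)))

      -- The new coordinate at `i` is `x j + k`, which is `hat x` at the position j + k N; the
      -- reflection exchanges the positions i and j + k N.
      sref-act : ∀ k x → sref (root i j) k x ≐ act (τ ⟦ i ⟧ (⟦ j ⟧ ℤ.+ k ℤ.* Nℤ)) x
      sref-act k x c = by (c Fin.≟ i) (c Fin.≟ j)
        where
        lem₁ : ∀ i j → i ℤ.+ (j ℤ.- i) ≡ j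
        lem₁ = ℤSolver.solve-∀
        lem₂ : ∀ i j k N → j ℤ.+ (i ℤ.- (j ℤ.+ k ℤ.* N)) ≡ i ℤ.+ ℤ.- k ℤ.* N
        lem₂ = ℤSolver.solve-∀
        by : Dec (c ≡ i) → Dec (c ≡ j) → sref (root i j) k x c ≡ act (τ ⟦ i ⟧ (b k)) x c
        by (yes refl) _ = trans (sref-fst k x) (sym (trans (cong (hat x) (trans (τ-fst ⟦ i ⟧ refl) (lem₁ ⟦ i ⟧ (b k))))
          (trans (hat-shift x ⟦ j ⟧ k) (cong (_+ ι k) (hat-fin x j)))))
        by (no _) (yes refl) = trans (sref-snd k x) (sym (trans (cong (hat x) (trans (τ-snd ⟦ j ⟧ (root-≢ k) (trans (rm-fin j) (sym (rm-b k)))) (lem₂ ⟦ i ⟧ ⟦ j ⟧ k Nℤ)))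
          (trans (hat-shift x ⟦ i ⟧ (ℤ.- k)) (cong₂ _+_ (hat-fin x i) (ι-neg k)))))
        by (no p) (no q) = trans (sref-off k x c p q) (sym (trans (cong (hat x) (τ-off ⟦ c ⟧
          (λ e → p (trans (sym (rm-fin c)) (trans e (rm-fin i)))) (λ e → q (trans (sym (rm-fin c)) (trans e (rm-b k)))))) (hat-fin x c)))

      sref-InE : ∀ k x → InE x → InE (sref (root i j) k x)
      sref-InE k x x∈E = trans (cancel (Σᶠ (sref (root i j) k x)) (Σᶠ x) (x i + x j)
          (trans (Σᶠ-differ (sref (root i j) k x) x i j i≢j (sref-off k x))
            (cong (λ z → Σᶠ x + z) (trans (cong₂ _+_ (sref-fst k x) (sref-snd k x)) (lem (x i) (x j) (ι k)))))) x∈E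
        where
        lem : ∀ a b k → b + k + (a - k) ≡ a + b
        lem = solve-∀ ℚ-ring
        lem₂ : ∀ a c → a ≡ a + c - c
        lem₂ = solve-∀ ℚ-ring
        cancel : ∀ a b c → a + c ≡ b + c → a ≡ b
        cancel a b c e = trans (lem₂ a c) (trans (cong (_- c) e) (sym (lem₂ b c)))

    inject₁≢suc : ∀ {m} (i : Fin m) → ¬ inject₁ i ≡ suc i
    inject₁≢suc zero ()
    inject₁≢suc (suc i) e = inject₁≢suc i (Finₚ.suc-injective e)

    zero≢last : ¬ zero ≡ fromℕ n
    zero≢last ()

    inner-α : ∀ x i → ⟨ x , α i ⟩ ≡ x (inject₁ i) - x (suc i)
    inner-α x i = inner-root (inject₁≢suc i) x

    τ≗ : ∀ {a a′ b b′} → a ≡ a′ → b ≡ b′ → ∀ v → τ a b v ≡ τ a′ b′ v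
    τ≗ refl refl v = refl

    -- For the affine generator k = -1, and its two positions are 0 and n - N = -1, again
    -- neighbours.
    gen-act : ∀ s x → gen s x ≐ act (σ s) x
    gen-act zero x c = trans (sref-act zero≢last -[1+ 0 ] x c) (cong (hat x)
      (trans (τ-sym (root-≢ zero≢last -[1+ 0 ]) ⟦ c ⟧) (τ≗ {b = ⟦ zero ⟧} eq refl ⟦ c ⟧)))
      where
      lem : ∀ n → n ℤ.+ ℤ.- ℤ.1ℤ ℤ.* (ℤ.1ℤ ℤ.+ n) ≡ ℤ.0ℤ ℤ.- ℤ.1ℤ
      lem = ℤSolver.solve-∀
      eq : ⟦ fromℕ n ⟧ ℤ.+ -[1+ 0 ] ℤ.* Nℤ ≡ ⟦ zero ⟧ ℤ.- ℤ.1ℤ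
      eq = trans (cong (λ k → + k ℤ.+ -[1+ 0 ] ℤ.* Nℤ) (Finₚ.toℕ-fromℕ n)) (lem (+ n))
    gen-act (suc i) x c = trans (sref-act (inject₁≢suc i) (+ 0) x c) (cong (hat x) (τ≗ eq₁ (lem₂ ⟦ suc i ⟧ Nℤ) ⟦ c ⟧))
      where
      lem₁ : ∀ i → i ≡ ℤ.1ℤ ℤ.+ i ℤ.- ℤ.1ℤ
      lem₁ = ℤSolver.solve-∀
      lem₂ : ∀ j N → j ℤ.+ ℤ.0ℤ ℤ.* N ≡ j
      lem₂ = ℤSolver.solve-∀
      eq₁ : ⟦ inject₁ i ⟧ ≡ ⟦ suc i ⟧ ℤ.- ℤ.1ℤ
      eq₁ = trans (cong +_ (Finₚ.toℕ-inject₁ i)) (lem₁ (+ toℕ i))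

    prod-act : ∀ u x → prod u x ≐ act (fun (W u)) x
    prod-act [] x c = sym (hat-fin x c)
    prod-act (s ∷ u) x c = trans (gen-act s (prod u x) c)
      (trans (hat-cong (prod-act u x) (σ s ⟦ c ⟧)) (hat-act (W u) x (σ s ⟦ c ⟧)))

    hat-prod : ∀ u x v → hat (prod u x) v ≡ hat x (u ⟪ v ⟫)
    hat-prod u x v = trans (hat-cong (prod-act u x) v) (hat-act (W u) x v)

    prod-cong : ∀ u {x y} → x ≐ y → prod u x ≐ prod u y
    prod-cong u {x} {y} e c = trans (prod-act u x c) (trans (hat-cong e (u ⟪ ⟦ c ⟧ ⟫)) (sym (prod-act u y c)))

    prod-++ : ∀ u v x → prod (u ++ v) x ≡ prod u (prod v x)
    prod-++ [] v x = refl
    prod-++ (s ∷ u) v x = cong (gen s) (prod-++ u v x)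

    gen-InE : ∀ s x → InE x → InE (gen s x)
    gen-InE zero x = sref-InE zero≢last -[1+ 0 ] x
    gen-InE (suc i) x = sref-InE (inject₁≢suc i) (+ 0) x

    prod-InE : ∀ u x → InE x → InE (prod u x)
    prod-InE [] x p = p
    prod-InE (s ∷ u) x p = gen-InE s (prod u x) (prod-InE u x p)

    ≋⇒≈ : ∀ u v → u ≋ v → prod u ≈ prod v
    ≋⇒≈ u v e x _ c = trans (prod-act u x c) (trans (cong (hat x) (e ⟦ c ⟧)) (sym (prod-act v x c)))

    rprod : List RSpec → Map
    rprod = foldr (λ r g → rmap r ∘ g) id

    rprod-word : ∀ rs → ∃ λ u → ∀ x → rprod rs x ≐ prod u x
    rprod-word [] = [] , λ x c → refl
    rprod-word ((i , j , i≢j , k) ∷ rs) with rprod-word rs | reflection-word (root-≢ i≢j k)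
    ... | u , h | v , e = v ++ u , λ x c → trans (sref-act i≢j k (rprod rs x) c)
      (trans (hat-cong (h x) _) (trans (cong (hat (prod u x)) (sym (e ⟦ c ⟧)))
      (trans (sym (prod-act v (prod u x) c)) (cong (λ y → y c) (sym (prod-++ v u x))))))

    IsW-word : ∀ {f} → IsW f → ∃ λ u → f ≈ prod u
    IsW-word (rs , h) with rprod-word rs
    ... | u , e = u , λ x x∈E c → trans (h x x∈E c) (e x c)

    -- The barycentre of the fundamental alcove lies on no reflecting hyperplane, so its image
    -- determines an element of W_aff.
    bary : Pt
    bary c = ι (⟦ c ⟧ ℤ.+ ⟦ c ⟧ ℤ.- + n) * half n

    -- Since 2 N times `half n` is 1, the extension is affine in `v` with slope 1 / N; strict
    -- monotonicity and injectivity follow.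
    hat-bary : ∀ v → hat bary v ≡ ι (v ℤ.+ v ℤ.- + n) * half n
    hat-bary v = trans (cong (λ z → bary (rm v) + z) (trans (sym (*-identityʳ (ι (fl v)))) (cong (ι (fl v) *_) (sym (half-unit n)))))
      (trans (lem₁ (ι (⟦ rm v ⟧ ℤ.+ ⟦ rm v ⟧ ℤ.- + n)) (ι (fl v)) (ι (Nℤ ℤ.+ Nℤ)) (half n))
      (cong (_* half n) (trans (cong (λ z → ι (⟦ rm v ⟧ ℤ.+ ⟦ rm v ⟧ ℤ.- + n) + z) (sym (ι-* (fl v) (Nℤ ℤ.+ Nℤ))))
      (trans (sym (ι-+ _ _)) (cong ι (trans (lem₂ ⟦ rm v ⟧ (fl v) Nℤ (+ n)) (cong (λ z → z ℤ.+ z ℤ.- + n) (sym (divmod v)))))))))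
      where
      lem₁ : ∀ a f N h → a * h + f * (N * h) ≡ (a + f * N) * h
      lem₁ = solve-∀ ℚ-ring
      lem₂ : ∀ r f N n → r ℤ.+ r ℤ.- n ℤ.+ f ℤ.* (N ℤ.+ N) ≡ (r ℤ.+ f ℤ.* N) ℤ.+ (r ℤ.+ f ℤ.* N) ℤ.- n
      lem₂ = ℤSolver.solve-∀

    private instance
      half-positive : Positive (half n)
      half-positive = positive (half-pos n)

    hat-bary-mono : ∀ {v w} → v ℤ.< w → hat bary v < hat bary w
    hat-bary-mono {v} {w} p = subst₂ _<_ (sym (hat-bary v)) (sym (hat-bary w))
      (*-monoˡ-<-pos (half n) (ι-mono-< (ℤₚ.+-monoˡ-< (ℤ.- + n) (ℤₚ.+-mono-< p p))))

    hat-bary-cancel : ∀ {v w} → hat bary v < hat bary w → v ℤ.< w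
    hat-bary-cancel {v} {w} p with ℤₚ.<-cmp v w
    ... | tri< q _ _ = q
    ... | tri≈ _ refl _ = ⊥-elim (<-irrefl refl p)
    ... | tri> _ _ q = ⊥-elim (<-asym p (hat-bary-mono q))

    hat-bary-cancel-≤ : ∀ {v w} → hat bary v ≤ hat bary w → v ℤ.≤ w
    hat-bary-cancel-≤ {v} {w} p with ℤₚ.<-cmp v w
    ... | tri< q _ _ = ℤₚ.<⇒≤ q
    ... | tri≈ _ refl _ = ℤₚ.≤-refl
    ... | tri> _ _ q = ⊥-elim (<-irrefl refl (<-≤-trans (hat-bary-mono q) p))

    hat-bary-injective : ∀ {v w} → hat bary v ≡ hat bary w → v ≡ w
    hat-bary-injective {v} {w} p with ℤₚ.<-cmp v w
    ... | tri< q _ _ = ⊥-elim (<-irrefl p (hat-bary-mono q))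
    ... | tri≈ _ e _ = e
    ... | tri> _ _ q = ⊥-elim (<-irrefl (sym p) (hat-bary-mono q))

    bary-InE : InE bary
    bary-InE = trans (Σᶠ-cong {N} λ c → cong (λ z → ι z * half n) (lem₀ ⟦ c ⟧ (+ n)))
      (trans (arith N (ℤ.- + n)) (trans (cong (λ z → ι z * half n) (lem (+ n))) (trans (cong (_* half n) ι-0) (*-zeroˡ (half n)))))
      where
      lem₀ : ∀ c n → c ℤ.+ c ℤ.- n ≡ c ℤ.+ c ℤ.+ ℤ.- n
      lem₀ = ℤSolver.solve-∀
      lem : ∀ n → (ℤ.1ℤ ℤ.+ n) ℤ.* (ℤ.1ℤ ℤ.+ n ℤ.- ℤ.1ℤ ℤ.+ ℤ.- n) ≡ ℤ.0ℤ
      lem = ℤSolver.solve-∀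
      -- The offset `b` is kept free because dropping the first index raises it by 2.
      arith : ∀ m b → Σᶠ {m} (λ c → ι (+ toℕ c ℤ.+ + toℕ c ℤ.+ b) * half n) ≡ ι (+ m ℤ.* (+ m ℤ.- ℤ.1ℤ ℤ.+ b)) * half n
      arith zero b = sym (trans (cong (_* half n) ι-0) (*-zeroˡ (half n)))
      arith (suc m) b = trans (cong₂ _+_ (cong (λ z → ι z * half n) (ℤₚ.+-identityˡ b))
          (trans (Σᶠ-cong {m} λ c → cong (λ z → ι z * half n) (lem₁ (+ toℕ c) b)) (arith m (+ 2 ℤ.+ b))))
        (trans (sym (*-distribʳ-+ (half n) (ι b) _)) (cong (_* half n) (trans (sym (ι-+ b _)) (cong ι (lem₂ (+ m) b)))))
        where
        lem₁ : ∀ c b → (ℤ.1ℤ ℤ.+ c) ℤ.+ (ℤ.1ℤ ℤ.+ c) ℤ.+ b ≡ c ℤ.+ c ℤ.+ (+ 2 ℤ.+ b)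
        lem₁ = ℤSolver.solve-∀
        lem₂ : ∀ m b → b ℤ.+ m ℤ.* (m ℤ.- ℤ.1ℤ ℤ.+ (+ 2 ℤ.+ b)) ≡ (ℤ.1ℤ ℤ.+ m) ℤ.* (ℤ.1ℤ ℤ.+ m ℤ.- ℤ.1ℤ ℤ.+ b)
        lem₂ = ℤSolver.solve-∀

    Fin<⇒≢ : ∀ {m} {i j : Fin m} → i Fin.< j → ¬ i ≡ j
    Fin<⇒≢ i<j refl = ℕₚ.<-irrefl refl i<j

    bary-Aid : Aid bary
    bary-Aid = bary-InE , λ i j i<j →
        subst (- 1ℚ <_) (sym (inner-root (Fin<⇒≢ i<j) bary)) (lower i j)
      , subst (_< 0ℚ) (sym (inner-root (Fin<⇒≢ i<j) bary)) (upper i j i<j)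
      where
      bary<1 : ∀ i j → bary j < bary i + 1ℚ
      bary<1 i j = subst₂ _<_ (hat-fin bary j)
        (trans (hat-shift bary ⟦ i ⟧ ℤ.1ℤ) (cong₂ _+_ (hat-fin bary i) ι-1))
        (hat-bary-mono (ℤₚ.<-≤-trans (⟦⟧<N j) (≤-by {e = ⟦ i ⟧} (ℤ.+≤+ ℕ.z≤n) (lem₃ ⟦ i ⟧ Nℤ))))
        where lem₃ : ∀ i N → i ℤ.+ ℤ.1ℤ ℤ.* N ℤ.- N ≡ i
              lem₃ = ℤSolver.solve-∀
      lem₁ : ∀ i j → (i + 1ℚ) - j ≡ (i - j) - (- 1ℚ)
      lem₁ = solve-∀ ℚ-ring
      lem₂ : ∀ i j → j - i ≡ 0ℚ - (i - j)
      lem₂ = solve-∀ ℚ-ring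
      lower : ∀ i j → - 1ℚ < bary i - bary j
      lower i j = 0<⇒< (subst (0ℚ <_) (lem₁ (bary i) (bary j)) (<⇒0< (bary<1 i j)))
      upper : ∀ i j → i Fin.< j → bary i - bary j < 0ℚ
      upper i j i<j = 0<⇒< (subst (0ℚ <_) (lem₂ (bary i) (bary j)) (<⇒0<
        (subst₂ _<_ (hat-fin bary i) (hat-fin bary j) (hat-bary-mono (ℤ.+<+ i<j)))))

    -- Coordinates increase within a block of N positions as roots pair negatively with `x`, and
    -- they spread by less than 1 as the pairings exceed -1, so consecutive blocks do not overlap.
    hat-mono : ∀ {x} → Aid x → ∀ {v w} → v ℤ.< w → hat x v < hat x w
    hat-mono {x} (_ , aid) {v} {w} v<w = by (ℤₚ.<-cmp (fl v) (fl w))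
      where
      incr : ∀ {i j} → i Fin.< j → x i < x j
      incr {i} {j} i<j = 0<⇒< (subst (0ℚ <_) (lem (x i) (x j)) (<⇒0< (subst (_< 0ℚ) (inner-root (Fin<⇒≢ i<j) x) (proj₂ (aid i j i<j)))))
        where lem : ∀ a b → 0ℚ - (a - b) ≡ b - a
              lem = solve-∀ ℚ-ring
      spread : ∀ {i j} → i Fin.< j → x j < x i + 1ℚ
      spread {i} {j} i<j = 0<⇒< (subst (0ℚ <_) (lem (x i) (x j)) (<⇒0< (subst (- 1ℚ <_) (inner-root (Fin<⇒≢ i<j) x) (proj₁ (aid i j i<j)))))
        where lem : ∀ a b → (a - b) - (- 1ℚ) ≡ (a + 1ℚ) - b
              lem = solve-∀ ℚ-ring
      p<p+1 : ∀ p → p < p + 1ℚ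
      p<p+1 p = subst (_< p + 1ℚ) (+-identityʳ p) (+-monoʳ-< p (positive⁻¹ 1ℚ))
      within : ∀ i j → x i < x j + 1ℚ
      within i j with Finₚ.<-cmp i j
      ... | tri< l _ _ = <-trans (incr l) (p<p+1 (x j))
      ... | tri≈ _ refl _ = p<p+1 (x i)
      ... | tri> _ _ g = spread g
      lem₁ : ∀ a b → a + 1ℚ + b ≡ a + (1ℚ + b)
      lem₁ = solve-∀ ℚ-ring
      by : Tri (fl v ℤ.< fl w) (fl v ≡ fl w) (fl w ℤ.< fl v) → hat x v < hat x w
      by (tri< l _ _) = <-≤-trans (+-monoˡ-< (ι (fl v)) (within (rm v) (rm w)))
        (≤-trans (≤-reflexive (trans (lem₁ (x (rm w)) (ι (fl v))) (cong (λ z → x (rm w) + z) (trans (cong (_+ ι (fl v)) (sym ι-1)) (sym (ι-+ ℤ.1ℤ (fl v)))))))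
          (+-monoʳ-≤ (x (rm w)) (ι-mono-≤ (ℤₚ.i<j⇒suc[i]≤j l))))
      by (tri> _ _ g) = ⊥-elim (ℤₚ.<⇒≱ g (fl-mono (ℤₚ.<⇒≤ v<w)))
      by (tri≈ _ e _) = subst (λ q → x (rm v) + ι (fl v) < x (rm w) + ι q) e (+-monoˡ-< (ι (fl v)) (incr rv<rw))
        where
        rv<rw : rm v Fin.< rm w
        rv<rw = ℤₚ.drop‿+<+ (subst₂ ℤ._<_ (sym (sub-residue v)) (sym (trans (sub-residue w) (cong (λ q → w ℤ.- q ℤ.* Nℤ) (sym e))))
          (ℤₚ.+-monoˡ-< (ℤ.- (fl v ℤ.* Nℤ)) v<w))

-- Agreement of the Bruhat order on maps with the reflection order on words.

module BruhatOrder where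

  open import Data.Nat as ℕ using (ℕ; zero; suc)
  import Data.Nat.Properties as ℕₚ
  open import Data.Fin as Fin using (Fin; zero; suc)
  import Data.Fin.Properties as Finₚ
  open import Data.Integer hiding (suc; pos)
  open import Data.Integer.Properties
  open import Data.Integer.Tactic.RingSolver using (solve-∀)
  import Data.Rational as ℚ
  open import Data.List using (List; []; _∷_; _++_; length; reverse)
  import Data.List.Properties as Listₚ
  open import Data.Product using (∃; _×_; _,_; proj₁; proj₂)
  open import Data.Sum using (_⊎_; inj₁; inj₂)
  open import Data.Empty using (⊥; ⊥-elim)
  open import Function using (_∘_)
  open import Relation.Nullary using (¬_; Dec; yes; no)
  open import Relation.Nullary.Decidable using (map′)
  open import Relation.Binary.Definitions using (Tri; tri<; tri≈; tri>)
  open import Relation.Binary.PropositionalEquality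

  open IntegerResidues
  open AffinePermutation using (Σℤ)
  open CoxeterOrder using (Σℤ-≤-tight)
  open AlcoveMaps

  module BruhatMaps (n′ : ℕ) where
    open Maps n′ public

    -- v ↦ g v - v is weakly increasing and periodic.
    increasing-translation : (g : ℤ → ℤ) → (∀ v w → v < w → g v < g w) →
                             (∀ v k → g (v + k * Nℤ) ≡ g v + k * Nℤ) →
                             ∀ v w → g v - v ≤ g w - w
    increasing-translation g mono per v w = subst₂ _≤_ refl (periodic w k)
        (subst (λ z → g v - v ≤ g z - z) meet (climb j))
      where
      k = + ∣ v - w ∣
      j = ∣ w + k * Nℤ - v ∣
      lem₀ : ∀ v → v + 0ℤ ≡ v
      lem₀ = solve-∀
      lem₂ : ∀ x y k → x + k - (y + k) ≡ x - y
      lem₂ = solve-∀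
      lem₃ : ∀ v j → v + (1ℤ + j) ≡ v + j + 1ℤ
      lem₃ = solve-∀
      lem₄ : ∀ v w → v + (w - v) ≡ w
      lem₄ = solve-∀
      lem₅ : ∀ w k n v → w + k * (1ℤ + n) - v ≡ k - (v - w) + k * n
      lem₅ = solve-∀
      lem₆ : ∀ x y z → y - (z + 1ℤ) - (x - z) ≡ y - x - 1ℤ
      lem₆ = solve-∀
      step : ∀ z → g z - z ≤ g (z + 1ℤ) - (z + 1ℤ)
      step z = ≤-by (gap≥0 (mono z (z + 1ℤ) (<-by {z} {z + 1ℤ} {0ℤ} ≤-refl (lem z)))) (lem₆ (g z) (g (z + 1ℤ)) z)
        where lem : ∀ z → z + 1ℤ - z - 1ℤ ≡ 0ℤ
              lem = solve-∀
      climb : ∀ j → g v - v ≤ g (v + + j) - (v + + j)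
      climb zero = ≤-reflexive (cong (λ z → g z - z) (sym (lem₀ v)))
      climb (suc j) = ≤-trans (climb j) (subst (λ z → g (v + + j) - (v + + j) ≤ g z - z) (sym (lem₃ v (+ j))) (step (v + + j)))
      v-w≤k : v - w ≤ k
      v-w≤k = i≤+∣i∣ (v - w)
      nonneg : 0ℤ ≤ w + k * Nℤ - v
      nonneg = subst (0ℤ ≤_) (sym (lem₅ w k (+ n) v))
        (0≤+ (diff≥0 v-w≤k) (*-monoʳ-≤-nonNeg (+ n) {0ℤ} {k} (+≤+ ℕ.z≤n)))
      meet : v + + j ≡ w + k * Nℤ
      meet = trans (cong (λ z → v + z) (0≤i⇒+∣i∣≡i nonneg)) (lem₄ v (w + k * Nℤ))
      periodic : ∀ w k → g (w + k * Nℤ) - (w + k * Nℤ) ≡ g w - w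
      periodic w k = trans (cong (_- (w + k * Nℤ)) (per w k)) (lem₂ (g w) w (k * Nℤ))

    -- `hat x` equals `hat bary` after `g`, and both are increasing, so `g` is increasing and hence
    -- a translation by a constant. The sign of the constant makes one window dominate the other,
    -- and equal window sums make them agree.
    same-alcove : ∀ u v x → Aid x → prod u x ≐ prod v bary → u ≋ v
    same-alcove u v x aid e = by (≤-total 0ℤ (g 0ℤ - 0ℤ))
      where
      g : ℤ → ℤ
      g z = v ⟪ inv (W u) z ⟫
      hats : ∀ z → hat x (u ⟪ z ⟫) ≡ hat bary (v ⟪ z ⟫)
      hats z = trans (sym (hat-prod u x z)) (trans (hat-cong e z) (hat-prod v bary z))
      hat-g : ∀ z → hat x z ≡ hat bary (g z)
      hat-g z = trans (cong (hat x) (sym (fun-inv (W u) z))) (hats (inv (W u) z))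
      constant : ∀ z w → g z - z ≤ g w - w
      constant = increasing-translation g
        (λ z w z<w → hat-bary-cancel (subst₂ ℚ._<_ (hat-g z) (hat-g w) (hat-mono {x} aid z<w)))
        (λ z k → trans (cong (v ⟪_⟫) (inv-shift (W u) z k)) (shift (W v) _ k))
      diff : ∀ z → g (u ⟪ z ⟫) - u ⟪ z ⟫ ≡ v ⟪ z ⟫ - u ⟪ z ⟫
      diff z = cong (λ y → v ⟪ y ⟫ - u ⟪ z ⟫) (inv-fun (W u) z)
      Σ≡ : Σℤ (λ c → u ⟪ ⟦ c ⟧ ⟫) ≡ Σℤ (λ c → v ⟪ ⟦ c ⟧ ⟫)
      Σ≡ = trans (Σ-window u) (sym (Σ-window v))
      by : (0ℤ ≤ g 0ℤ - 0ℤ) ⊎ (g 0ℤ - 0ℤ ≤ 0ℤ) → u ≋ v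
      by (inj₁ p) = window-≋ u v (Σℤ-≤-tight (λ c → u ⟪ ⟦ c ⟧ ⟫) (λ c → v ⟪ ⟦ c ⟧ ⟫) (λ c → 0≤i-j⇒j≤i (≤-trans p
        (≤-trans (constant 0ℤ (u ⟪ ⟦ c ⟧ ⟫)) (≤-reflexive (diff ⟦ c ⟧))))) Σ≡)
      by (inj₂ p) = window-≋ u v (λ c → sym (Σℤ-≤-tight (λ c → v ⟪ ⟦ c ⟧ ⟫) (λ c → u ⟪ ⟦ c ⟧ ⟫) (λ c → i-j≤0⇒i≤j
        (≤-trans (≤-trans (≤-reflexive (sym (diff ⟦ c ⟧))) (constant (u ⟪ ⟦ c ⟧ ⟫) 0ℤ)) p)) (sym Σ≡) c))

    ≈⇒≋ : ∀ u v → prod u ≈ prod v → u ≋ v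
    ≈⇒≋ u v e = same-alcove u v bary bary-Aid (e bary bary-InE)

    ≈-sym : ∀ {f g : Map} → f ≈ g → g ≈ f
    ≈-sym e x p c = sym (e x p c)

    ≈-trans : ∀ {f g h : Map} → f ≈ g → g ≈ h → f ≈ h
    ≈-trans e e′ x p c = trans (e x p c) (e′ x p c)

    _≋?_ : ∀ u v → Dec (u ≋ v)
    u ≋? v = map′ (window-≋ u v) (λ e c → e ⟦ c ⟧) (Finₚ.all? λ c → u ⟪ ⟦ c ⟧ ⟫ ≟ v ⟪ ⟦ c ⟧ ⟫)

    word-of-length? : (P : Word → Set) → (∀ u → Dec (P u)) → ∀ k → Dec (∃ λ u → length u ≡ k × P u)
    word-of-length? P P? zero = map′ (λ p → [] , refl , p) (λ { ([] , _ , p) → p }) (P? [])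
    word-of-length? P P? (suc k) = map′
      (λ { (s , u , e , p) → s ∷ u , cong suc e , p })
      (λ { (s ∷ u , e , p) → s , u , ℕₚ.suc-injective e , p })
      (Finₚ.any? λ s → word-of-length? (P ∘ (s ∷_)) (P? ∘ (s ∷_)) k)

    Reduced : Word → Set
    Reduced u = ∃ λ v → v ≋ u × (∀ w → w ≋ u → length v ℕ.≤ length w)

    -- Lengths are tried upwards from 0. `f` counts the lengths left before that of `u`; when it
    -- reaches 0, `u` itself is shortest.
    reduce : ∀ u → Reduced u
    reduce u = go (length u) 0 (ℕₚ.+-identityʳ (length u)) (λ w _ → ℕ.z≤n)
      where
      go : ∀ f j → f ℕ.+ j ≡ length u → (∀ w → w ≋ u → j ℕ.≤ length w) → Reduced u
      go zero j e low = u , (λ _ → refl) , λ w h → ℕₚ.≤-trans (ℕₚ.≤-reflexive (sym e)) (low w h)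
      go (suc f) j e low with word-of-length? (_≋ u) (_≋? u) j
      ... | yes (v , refl , h) = v , h , low
      ... | no none = go f (suc j) (trans (ℕₚ.+-suc f j) e)
            λ w h → ℕₚ.≤∧≢⇒< (low w h) (λ eq → none (w , sym eq , h))

    Reduced-length : ∀ {f u} → f ≈ prod u → (r : Reduced u) → HasLength f (length (proj₁ r))
    Reduced-length {f} {u} e (v , h , low) = (v , refl , ≈-trans (≋⇒≈ v u h) (≈-sym e)) ,
      λ w h′ → low w (≈⇒≋ w u (≈-trans h′ e))

    -- The inequality of lengths comes from a shortest word of `w`: exchange deletes one of its
    -- letters and leaves a word for `v`.
    HStep⇒BStep : ∀ {f g v w} → f ≈ prod v → g ≈ prod w → HStep v w → BStep f g
    HStep⇒BStep {f} {g} {v} {w} f≈v g≈w st = with-deletion (HStep-deletion {v} {w′} (HStep-resp {v} {w} {v} {w′} (λ _ → refl) (λ x → sym (w′≋w x)) st))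
      where
      w′ = proj₁ (reduce w)
      w′≋w : w′ ≋ w
      w′≋w = proj₁ (proj₂ (reduce w))
      with-deletion : (∃ λ A → ∃ λ s → ∃ λ B → (w′ ≡ A ++ s ∷ B) × (A ++ B ≋ v)) → BStep f g
      with-deletion (A , s , B , e , h) =
        (prod z , (reverse B , s , λ _ _ _ → refl) , g≈f∘t) ,
        length (proj₁ (reduce v)) , length w′ , Reduced-length {f} {v} f≈v (reduce v) , Reduced-length {g} {w} g≈w (reduce w) ,
        ℕₚ.≤-trans (ℕ.s≤s (proj₂ (proj₂ (reduce v)) (A ++ B) h)) (ℕₚ.≤-reflexive (sym (trans (cong length e) (length-deletion A s B))))
        where
        -- From w = A s B and v = A B one has w = v B⁻¹ s B; the double reversal gives the shape
        -- demanded by `IsRefl`, with conjugator `reverse B`.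
        z = reverse B ++ s ∷ reverse (reverse B)
        wz : w ≋ v ++ z
        wz x = trans (sym (w′≋w x)) (trans (cong (_⟪ x ⟫) e) (trans (W-++ A (s ∷ B) x) (sym
          (trans (W-++ v z x) (trans (cong (z ⟪_⟫) (trans (sym (h x)) (W-++ A B x)))
          (trans (W-++ (reverse B) (s ∷ reverse (reverse B)) (B ⟪ A ⟪ x ⟫ ⟫))
          (trans (cong (λ C → C ⟪ σ s (reverse B ⟪ B ⟪ A ⟪ x ⟫ ⟫ ⟫) ⟫) (Listₚ.reverse-involutive B))
          (cong (λ y → B ⟪ σ s y ⟫) (trans (W-reverse B _) (inv-fun (W B) _))))))))))
        g≈f∘t : g ≈ (f ∘ prod z)
        g≈f∘t x x∈E c = trans (g≈w x x∈E c) (trans (≋⇒≈ w (v ++ z) wz x x∈E c)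
          (trans (cong (λ y → y c) (prod-++ v z x)) (sym (f≈v (prod z x) (prod-InE z x x∈E) c))))

    invA : Aff → Aff
    invA F = record { fun = inv F ; inv = fun F ; shift = inv-shift F ; fun-inv = inv-fun F ; inv-fun = fun-inv F }

    τ-at-fst : ∀ a b → τ a b a ≡ b
    τ-at-fst a b = trans (τ-fst a refl) (lem a b)
      where lem : ∀ a b → a + (b - a) ≡ b
            lem = solve-∀

    -- The reflection yields a pair, and the lengths decide that it is `w` that inverts it:
    -- otherwise `v` does, and exchange gives a word for `w` shorter than `v`.
    BStep⇒HStep : ∀ {f g} → BStep f g → ∃ λ v → ∃ λ w → prod v ≈ f × prod w ≈ g × HStep v w
    BStep⇒HStep {f} {g} ((t , (z , s , t≈) , g≈f∘t) , _ , _ , ((v , refl , v≈f) , _) , ((w , refl , w≈g) , w-min) , k₁<k₂) =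
      v , w , v≈f , w≈g , by (<-cmp a b)
      where
      word = z ++ s ∷ reverse z
      wz : w ≋ v ++ word
      wz = ≈⇒≋ w (v ++ word) (λ x x∈E c → trans (w≈g x x∈E c) (trans (g≈f∘t x x∈E c)
        (trans (sym (v≈f (t x) (t∈E x x∈E) c)) (trans (prod-cong v (t≈ x x∈E) c) (cong (λ y → y c) (sym (prod-++ v word x)))))))
        where
        t∈E : ∀ x → InE x → InE (t x)
        t∈E x x∈E = trans (Σᶠ-cong (t≈ x x∈E)) (prod-InE word x x∈E)
      Z = invA (W z)
      c = fun Z (⟦ s ⟧ - 1ℤ)
      d = fun Z ⟦ s ⟧
      a = inv (W v) c
      b = inv (W v) d
      c≢d : ¬ rm c ≡ rm d
      c≢d = inv-≢ (W z) (pred-≢ ⟦ s ⟧)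
      a≢b : ¬ rm a ≡ rm b
      a≢b = inv-≢ (W v) c≢d
      w-swap : ∀ x → w ⟪ x ⟫ ≡ v ⟪ τ a b x ⟫
      w-swap x = trans (wz x) (trans (W-++ v word x) (trans (W-++ z (s ∷ reverse z) (v ⟪ x ⟫))
        (trans (W-reverse z _) (trans (τ-conj Z (pred-≢ ⟦ s ⟧) (z ⟪ v ⟪ x ⟫ ⟫))
        (trans (cong (τ c d) (inv-fun (W z) (v ⟪ x ⟫)))
        (sym (trans (τ-conj (W v) a≢b x) (cong₂ (λ p q → τ p q (v ⟪ x ⟫)) (fun-inv (W v) c) (fun-inv (W v) d)))))))))
      oriented : ∀ {a b} → ¬ rm a ≡ rm b → a < b → (∀ x → w ⟪ x ⟫ ≡ v ⟪ τ a b x ⟫) → HStep v w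
      oriented {a} {b} a≢b a<b swap = pick (<-cmp (w ⟪ b ⟫) (w ⟪ a ⟫))
        where
        swap′ : ∀ x → v ⟪ x ⟫ ≡ w ⟪ τ a b x ⟫
        swap′ x = sym (trans (swap (τ a b x)) (cong (v ⟪_⟫) (τ-involutive a≢b x)))
        at-b : w ⟪ b ⟫ ≡ v ⟪ a ⟫
        at-b = trans (swap b) (cong (v ⟪_⟫) (trans (τ-sym a≢b b) (τ-at-fst b a)))
        at-a : w ⟪ a ⟫ ≡ v ⟪ b ⟫
        at-a = trans (swap a) (cong (v ⟪_⟫) (τ-at-fst a b))
        too-short : (∃ λ A → ∃ λ s → ∃ λ B → (v ≡ A ++ s ∷ B) × (A ++ B ≋ w)) → ⊥
        too-short (A , s , B , e , h) = ℕₚ.<-irrefl refl (ℕₚ.<-≤-trans k₁<k₂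
          (ℕₚ.≤-trans (w-min (A ++ B) (≈-trans (≋⇒≈ (A ++ B) w h) w≈g))
          (ℕₚ.≤-trans (ℕₚ.n≤1+n _) (ℕₚ.≤-reflexive (sym (trans (cong length e) (length-deletion A s B)))))))
        pick : Tri (w ⟪ b ⟫ < w ⟪ a ⟫) (w ⟪ b ⟫ ≡ w ⟪ a ⟫) (w ⟪ a ⟫ < w ⟪ b ⟫) → HStep v w
        pick (tri< l _ _) = hstep a≢b a<b l swap′
        pick (tri≈ _ e _) = ⊥-elim (a≢b (cong rm (sym (fun-injective (W w) e))))
        pick (tri> _ _ g) = ⊥-elim (too-short (HStep-deletion {w} {v} (hstep a≢b a<b (subst₂ _<_ at-a at-b g) swap)))
      by : Tri (a < b) (a ≡ b) (b < a) → HStep v w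
      by (tri< l _ _) = oriented a≢b l w-swap
      by (tri≈ _ e _) = ⊥-elim (a≢b (cong rm e))
      by (tri> _ _ g) = oriented (a≢b ∘ sym) g λ x → trans (w-swap x) (cong (v ⟪_⟫) (τ-sym a≢b x))

    ≤B⇒⊑ : ∀ {f g u v} → f ≈ prod u → g ≈ prod v → f ≤B g → u ⊑ v
    ≤B⇒⊑ {u = u} {v} f≈u g≈v (b-refl e) = ⊑-refl (≈⇒≋ u v (≈-trans (≈-sym f≈u) (≈-trans e g≈v)))
    ≤B⇒⊑ {u = u} {v} f≈u g≈v (b-step p st) with BStep⇒HStep st
    ... | v₁ , w₁ , v₁≈ , w₁≈ , h = ⊑-respʳ {u} {w₁} {v} (⊑-step {u} {v₁} {w₁} (≤B⇒⊑ {u = u} {v₁} f≈u (≈-sym v₁≈) p) h) (≈⇒≋ w₁ v (≈-trans w₁≈ g≈v))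

    ⊑⇒≤B : ∀ {f g u v} → f ≈ prod u → g ≈ prod v → u ⊑ v → f ≤B g
    ⊑⇒≤B {u = u} {v} f≈u g≈v (⊑-refl e) = b-refl (≈-trans f≈u (≈-trans (≋⇒≈ u v e) (≈-sym g≈v)))
    ⊑⇒≤B {u = u} {w} f≈u g≈v (⊑-step {v = v₁} p st) = b-step (⊑⇒≤B {g = prod v₁} {u} {v₁} f≈u (λ _ _ _ → refl) p) (HStep⇒BStep {v = v₁} {w} (λ _ _ _ → refl) g≈v st)

-- Combinations of simple roots and greatest solutions of systems of bounds.

module RootCombinations where

  open import Data.Nat as ℕ using (ℕ; zero; suc)
  import Data.Nat.Properties as ℕₚ
  open import Data.Bool using (true; false)
  open import Data.Fin as Fin using (Fin; zero; suc; toℕ; inject₁; fromℕ)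
  import Data.Fin.Properties as Finₚ
  open import Data.Fin.Subset using (Subset)
  open import Data.Fin.Subset.Properties using (anySubset?)
  open import Data.Vec using ([]; _∷_)
  open import Data.Integer hiding (suc; pos)
  open import Data.Integer.Properties
  open import Data.Integer.Tactic.RingSolver using (solve-∀)
  open import Data.Product using (Σ; ∃; _×_; _,_)
  open import Data.Empty using (⊥-elim)
  open import Function using (_∘_)
  open import Relation.Nullary using (¬_; Dec; yes; no)
  open import Relation.Nullary.Decidable using (map′; ¬?; decidable-stable)
  open import Relation.Binary.PropositionalEquality
  import Algebra.Properties.CommutativeMonoid.Sum as MonoidSum

  open IntegerResidues
  open AffinePermutation using (module SumTwoPoints)
  open Majorisation

  open MonoidSum ℕₚ.+-0-commutativeMonoid public using () renaming (sum to Σℕ)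
  open SumTwoPoints ℕₚ.+-0-commutativeMonoid using () renaming (sum-differ-at-one to Σℕ-differ-at-one)

  Σℕ-+ : ∀ {m} (f g : Fin m → ℕ) → Σℕ (λ i → f i ℕ.+ g i) ≡ Σℕ f ℕ.+ Σℕ g
  Σℕ-+ = MonoidSum.∑-distrib-+ ℕₚ.+-0-commutativeMonoid

  Σℕ-cong : ∀ {m} {f g : Fin m → ℕ} → (∀ i → f i ≡ g i) → Σℕ f ≡ Σℕ g
  Σℕ-cong = MonoidSum.sum-cong-≗ ℕₚ.+-0-commutativeMonoid

  Σℕ≡0 : ∀ {m} (f : Fin m → ℕ) → Σℕ f ≡ 0 → ∀ i → f i ≡ 0
  Σℕ≡0 {suc m} f e zero = ℕₚ.m+n≡0⇒m≡0 (f zero) e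
  Σℕ≡0 {suc m} f e (suc i) = Σℕ≡0 (f ∘ suc) (ℕₚ.m+n≡0⇒n≡0 (f zero) e) i

  -- Coordinates of a combination Σ e_i α_i of simple roots: the c-th one is hi e c - lo 0 e c,
  -- that is e_c - e_{c-1} with the conventions e_{-1} = a and e_m = 0.
  hi : ∀ {m} → (Fin m → ℤ) → Fin (suc m) → ℤ
  hi {zero}  e zero    = 0ℤ
  hi {suc m} e zero    = e zero
  hi {suc m} e (suc c) = hi (e ∘ suc) c

  lo : ∀ {m} → ℤ → (Fin m → ℤ) → Fin (suc m) → ℤ
  lo a e zero    = a
  lo a e (suc i) = e i

  ext : ∀ {m} → (Fin m → ℤ) → ℕ → ℤ
  ext {zero}  e k       = 0ℤ
  ext {suc m} e zero    = e zero
  ext {suc m} e (suc k) = ext (e ∘ suc) k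

  hi-inject₁ : ∀ {m} (e : Fin m → ℤ) i → hi e (inject₁ i) ≡ e i
  hi-inject₁ e zero    = refl
  hi-inject₁ e (suc i) = hi-inject₁ (e ∘ suc) i

  hi-last : ∀ {m} (e : Fin m → ℤ) → hi e (fromℕ m) ≡ 0ℤ
  hi-last {zero}  e = refl
  hi-last {suc m} e = hi-last (e ∘ suc)

  ext-toℕ : ∀ {m} (e : Fin m → ℤ) i → ext e (toℕ i) ≡ e i
  ext-toℕ e zero    = refl
  ext-toℕ e (suc i) = ext-toℕ (e ∘ suc) i

  ext-≥ : ∀ {m} (e : Fin m → ℤ) k → m ℕ.≤ k → ext e k ≡ 0ℤ
  ext-≥ {zero}  e k       _           = refl
  ext-≥ {suc m} e (suc k) (ℕ.s≤s m≤k) = ext-≥ (e ∘ suc) k m≤k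

  hi-mono : ∀ {m} {e e′ : Fin m → ℤ} → (∀ i → e i ≤ e′ i) → ∀ c → hi e c ≤ hi e′ c
  hi-mono {zero}  h zero    = ≤-refl
  hi-mono {suc m} h zero    = h zero
  hi-mono {suc m} h (suc c) = hi-mono (h ∘ suc) c

  lo-mono : ∀ {m} a {e e′ : Fin m → ℤ} → (∀ i → e i ≤ e′ i) → ∀ c → lo a e c ≤ lo a e′ c
  lo-mono a h zero    = ≤-refl
  lo-mono a h (suc i) = h i

  rootℤ : ∀ {m} → (Fin m → ℤ) → Fin (suc m) → ℤ
  rootℤ e c = hi e c - lo 0ℤ e c

  E : ∀ {m} → (Fin m → ℤ) → ℕ → ℤ
  E e zero    = 0ℤ
  E e (suc k) = ext e k

  -- The predecessor `a` of the first coefficient is free because the tail of `e` has `e zero` as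
  -- its predecessor.
  psum-root-from : ∀ {m} a (e : Fin m → ℤ) k → psum (suc k) (λ c → hi e c - lo a e c) ≡ ext e k - a
  psum-root-from {zero} a e zero = lem a
    where lem : ∀ a → 0ℤ - a + 0ℤ ≡ 0ℤ - a
          lem = solve-∀
  psum-root-from {zero} a e (suc k) = lem a
    where lem : ∀ a → 0ℤ - a + 0ℤ ≡ 0ℤ - a
          lem = solve-∀
  psum-root-from {suc m} a e zero = lem (e zero) a
    where lem : ∀ e a → e - a + 0ℤ ≡ e - a
          lem = solve-∀
  psum-root-from {suc m} a e (suc k) = trans (cong (λ z → e zero - a + z)
      (trans (psum-cong (suc k) λ c → cong (λ z → hi (e ∘ suc) c - z) (relabel c)) (psum-root-from (e zero) (e ∘ suc) k)))
      (lem (e zero) a (ext (e ∘ suc) k))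
    where
    lem : ∀ e a x → e - a + (x - e) ≡ x - a
    lem = solve-∀
    relabel : ∀ c → e c ≡ lo (e zero) (e ∘ suc) c
    relabel zero    = refl
    relabel (suc c) = refl

  -- By telescoping, the first k coordinates sum to the coefficient of the k-th simple root, and to
  -- 0 when k is 0 or exceeds m. This decouples the coefficients in the majorisation inequalities.
  psum-root : ∀ {m} (e : Fin m → ℤ) k → psum k (rootℤ e) ≡ E e k
  psum-root e zero = refl
  psum-root e (suc k) = trans (psum-root-from 0ℤ e k) (+-identityʳ (ext e k))

  rootℤ-injective : ∀ {m} (e e′ : Fin m → ℤ) → (∀ c → rootℤ e c ≡ rootℤ e′ c) → ∀ i → e i ≡ e′ i
  rootℤ-injective e e′ h i = trans (sym (at e)) (trans (psum-cong (suc (toℕ i)) h) (at e′))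
    where at : ∀ e → psum (suc (toℕ i)) (rootℤ e) ≡ e i
          at e = trans (psum-root e (suc (toℕ i))) (ext-toℕ e i)

  -- The pairing of Σ e_k α_k with α_i, that is 2 e_i - e_{i-1} - e_{i+1}.
  rootDiff : ∀ {m} → (Fin m → ℤ) → Fin m → ℤ
  rootDiff e i = rootℤ e (inject₁ i) - rootℤ e (suc i)

  -- The neighbours of `e i` enter the pairing with coefficient -1.
  rootDiff-antitone : ∀ {m} {e e′ : Fin m → ℤ} → (∀ k → e k ≤ e′ k) → ∀ i → e i ≡ e′ i → rootDiff e′ i ≤ rootDiff e i
  rootDiff-antitone {_} {e} {e′} e≤e′ i eq = subst₂ _≤_ (sym (unfold e′)) (sym (unfold e))
      (shrink (e i) (e′ i) (lo 0ℤ e (inject₁ i)) (lo 0ℤ e′ (inject₁ i)) (hi e (suc i)) (hi e′ (suc i))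
        (≤-reflexive (sym eq)) (lo-mono 0ℤ e≤e′ (inject₁ i)) (hi-mono e≤e′ (suc i)))
    where
    unfold : ∀ e → rootDiff e i ≡ e i - lo 0ℤ e (inject₁ i) - (hi e (suc i) - e i)
    unfold e = cong (λ z → z - lo 0ℤ e (inject₁ i) - (hi e (suc i) - e i)) (hi-inject₁ e i)
    lem : ∀ x x′ l l′ h h′ → (x - l - (h - x)) - (x′ - l′ - (h′ - x′)) ≡ (x - x′) + (x - x′) + (l′ - l) + (h′ - h)
    lem = solve-∀
    shrink : ∀ x x′ l l′ h h′ → x′ ≤ x → l ≤ l′ → h ≤ h′ → x′ - l′ - (h′ - x′) ≤ x - l - (h - x)
    shrink x x′ l l′ h h′ p q r = ≤-by (0≤+ (0≤+ (0≤+ (diff≥0 p) (diff≥0 p)) (diff≥0 q)) (diff≥0 r)) (lem x x′ l l′ h h′)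

  prefix : ∀ m → ℕ → Subset m
  prefix zero    k       = []
  prefix (suc m) zero    = false ∷ prefix m zero
  prefix (suc m) (suc k) = true ∷ prefix m k

  card-prefix : ∀ {m} k → k ℕ.≤ m → card (prefix m k) ≡ k
  card-prefix {zero}  zero    _         = refl
  card-prefix {suc m} zero    _         = card-prefix {m} zero ℕ.z≤n
  card-prefix {suc m} (suc k) (ℕ.s≤s p) = cong suc (card-prefix k p)

  ssum-shift : ∀ {m} (K : Subset m) (f : Fin m → ℤ) k → ssum K (λ c → f c - k) ≡ ssum K f - rep (card K) k
  ssum-shift [] f k = refl
  ssum-shift (true ∷ K) f k = trans (cong (λ z → f zero - k + z) (ssum-shift K (f ∘ suc) k))
      (lem (f zero) k (ssum K (f ∘ suc)) (rep (card K) k))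
    where lem : ∀ f k s r → f - k + (s - r) ≡ f + s - (k + r)
          lem = solve-∀
  ssum-shift (false ∷ K) f k = ssum-shift K (f ∘ suc) k

  psum-shift : ∀ {m} j → j ℕ.≤ m → (f : Fin m → ℤ) → ∀ k → psum j (λ c → f c - k) ≡ psum j f - rep j k
  psum-shift zero _ f k = refl
  psum-shift {suc m} (suc j) (ℕ.s≤s j≤m) f k = trans (cong (λ z → f zero - k + z) (psum-shift j j≤m (f ∘ suc) k))
      (lem (f zero) k (psum j (f ∘ suc)) (rep j k))
    where lem : ∀ f k s r → f - k + (s - r) ≡ f + s - (k + r)
          lem = solve-∀

  ssum-cong : ∀ {m} (K : Subset m) {f g : Fin m → ℤ} → (∀ c → f c ≡ g c) → ssum K f ≡ ssum K g
  ssum-cong [] e = refl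
  ssum-cong (true ∷ K) e = cong₂ _+_ (e zero) (ssum-cong K (e ∘ suc))
  ssum-cong (false ∷ K) e = ssum-cong K (e ∘ suc)

  allSubsets? : ∀ {m} (P : Subset m → Set) → (∀ K → Dec (P K)) → Dec (∀ K → P K)
  allSubsets? P P? = map′
    (λ none K → decidable-stable (P? K) λ ¬p → none (K , ¬p))
    (λ all (K , ¬p) → ¬p (all K))
    (¬? (anySubset? λ K → ¬? (P? K)))

  -- If a point e dominating all solutions violates constraint i, then lowering e at i keeps it
  -- above all solutions; the descent stops at the greatest solution.
  module Greatest {m : ℕ} (P : Fin m → (Fin m → ℕ) → Set) (P? : ∀ i d → Dec (P i d))
    (drop : ∀ i d e → (∀ k → d k ℕ.≤ e k) → (∀ k → P k d) → ¬ P i e → d i ℕ.< e i)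
    (d₀ : Fin m → ℕ) (feasible₀ : ∀ k → P k d₀) where

    Feasible : (Fin m → ℕ) → Set
    Feasible d = ∀ k → P k d

    Bound : (Fin m → ℕ) → Set
    Bound e = ∀ d → Feasible d → ∀ k → d k ℕ.≤ e k

    lower : Fin m → (Fin m → ℕ) → Fin m → ℕ
    lower i e k with k Fin.≟ i
    ... | yes _ = ℕ.pred (e k)
    ... | no _  = e k

    lower-at : ∀ i e → lower i e i ≡ ℕ.pred (e i)
    lower-at i e with i Fin.≟ i
    ... | yes _ = refl
    ... | no ¬p = ⊥-elim (¬p refl)

    lower-off : ∀ i e k → ¬ k ≡ i → lower i e k ≡ e k
    lower-off i e k k≢i with k Fin.≟ i
    ... | yes p = ⊥-elim (k≢i p)
    ... | no _ = refl

    lower-bound : ∀ i e → Bound e → ¬ P i e → Bound (lower i e)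
    lower-bound i e bound ¬p d f k with k Fin.≟ i
    ... | yes refl = ℕₚ.<⇒≤pred (drop i d e (bound d f) f ¬p)
    ... | no _ = bound d f k

    Σ-lower : ∀ i e → 0 ℕ.< e i → Σℕ (lower i e) ℕ.< Σℕ e
    Σ-lower i e 0<ei = ℕₚ.+-cancelʳ-< (e i) (Σℕ (lower i e)) (Σℕ e)
      (subst (ℕ._< Σℕ e ℕ.+ e i) (sym (Σℕ-differ-at-one (lower i e) e i (lower-off i e)))
        (ℕₚ.+-monoʳ-< (Σℕ e) (subst (ℕ._< e i) (sym (lower-at i e)) (ℕₚ.≤-reflexive (ℕₚ.suc-pred (e i) ⦃ ℕ.>-nonZero 0<ei ⦄)))))

    descend : ∀ fuel e → Σℕ e ℕ.≤ fuel → Bound e → ∃ λ d → Feasible d × Bound d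
    descend fuel e le bound = by fuel le (Finₚ.all? λ i → P? i e)
      where
      by : ∀ fuel → Σℕ e ℕ.≤ fuel → Dec (∀ i → P i e) → ∃ λ d → Feasible d × Bound d
      by fuel le (yes f) = e , f , bound
      by fuel le (no ¬f) = next fuel le (Finₚ.¬∀⟶∃¬ m (λ i → P i e) (λ i → P? i e) ¬f)
        where
        next : ∀ fuel → Σℕ e ℕ.≤ fuel → (∃ λ i → ¬ P i e) → ∃ λ d → Feasible d × Bound d
        next zero le (i , ¬p) = ⊥-elim (ℕₚ.<⇒≱ (ℕₚ.<-≤-trans (Σ-lower i e 0<ei) le) ℕ.z≤n)
          -- The feasible point `d₀` certifies through `drop` that `e i` is positive, so lowering it
          -- really decreases the sum.
          where 0<ei = ℕₚ.≤-<-trans ℕ.z≤n (drop i d₀ e (bound d₀ feasible₀) feasible₀ ¬p)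
        next (suc fuel) le (i , ¬p) = descend fuel (lower i e)
            (ℕₚ.≤-pred (ℕₚ.≤-trans (Σ-lower i e 0<ei) le)) (lower-bound i e bound ¬p)
          where 0<ei = ℕₚ.≤-<-trans ℕ.z≤n (drop i d₀ e (bound d₀ feasible₀) feasible₀ ¬p)

    greatest : ∀ e → Bound e → ∃ λ d → Feasible d × Bound d
    greatest e = descend (Σℕ e) e ℕₚ.≤-refl

-- Weights, dominance and translation by the root lattice.

module DominantWeights where

  open import Data.Nat as ℕ using (ℕ; zero; suc)
  import Data.Nat.Properties as ℕₚ
  open import Data.Fin as Fin using (Fin; zero; suc; toℕ; inject₁; fromℕ)
  import Data.Fin.Properties as Finₚ
  open import Data.Integer as ℤ using (ℤ; +_)
  import Data.Integer.Properties as ℤₚ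
  open import Data.Rational
  open import Data.Rational.Properties
  open import Data.Bool using (if_then_else_)
  open import Data.List using (List)
  open import Data.Product using (∃; _,_; proj₂)
  open import Data.Sum using (_⊎_; inj₁; inj₂)
  open import Function using (_∘_)
  open import Relation.Nullary using (¬_; yes; no; does)
  open import Relation.Nullary.Decidable using (dec-true; dec-false)
  open import Relation.Binary.PropositionalEquality
  open import Tactic.RingSolver using (solve-∀)

  open Majorisation
  open RationalEmbedding
  open BruhatOrder
  open RootCombinations

  last? : ∀ {m} (c : Fin (suc m)) → (c ≡ fromℕ m) ⊎ (∃ λ j → c ≡ inject₁ j)
  last? {zero} zero = inj₁ refl
  last? {suc m} zero = inj₂ (zero , refl)
  last? {suc m} (suc c) with last? c
  ... | inj₁ e = inj₁ (cong suc e)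
  ... | inj₂ (j , e) = inj₂ (suc j , cong suc e)

  fromℕ≢inject₁ : ∀ {m} (i : Fin m) → ¬ inject₁ i ≡ fromℕ m
  fromℕ≢inject₁ zero ()
  fromℕ≢inject₁ (suc i) e = fromℕ≢inject₁ i (Finₚ.suc-injective e)

  steps⇒decreasing : ∀ {m} (f : Fin (suc m) → ℤ) → (∀ i → f (suc i) ℤ.≤ f (inject₁ i)) → Decreasing f
  steps⇒decreasing f h zero zero _ = ℤₚ.≤-refl
  steps⇒decreasing {suc m} f h zero (suc d) _ = ℤₚ.≤-trans (steps⇒decreasing (f ∘ suc) (h ∘ suc) zero d ℕ.z≤n) (h zero)
  steps⇒decreasing {suc m} f h (suc c) (suc d) (ℕ.s≤s p) = steps⇒decreasing (f ∘ suc) (h ∘ suc) c d p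

  constant : ∀ {m} (f : Fin (suc m) → ℚ) → (∀ i → f (inject₁ i) ≡ f (suc i)) → ∀ c → f c ≡ f zero
  constant f h zero = refl
  constant {suc m} f h (suc c) = trans (constant (f ∘ suc) (h ∘ suc) c) (sym (h zero))

  module Weights (n′ : ℕ) where
    open BruhatMaps n′ public

    Σᶠ-+ : ∀ {m} (f g : Fin m → ℚ) → Σᶠ (λ i → f i + g i) ≡ Σᶠ f + Σᶠ g
    Σᶠ-+ {zero} f g = refl
    Σᶠ-+ {suc m} f g = trans (cong (λ z → f zero + g zero + z) (Σᶠ-+ (f ∘ suc) (g ∘ suc))) (lem (f zero) (g zero) (Σᶠ (f ∘ suc)) (Σᶠ (g ∘ suc)))
      where lem : ∀ a b c d → a + b + (c + d) ≡ a + c + (b + d)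
            lem = solve-∀ ℚ-ring

    Σᶠ-*ˡ : ∀ {m} k (f : Fin m → ℚ) → Σᶠ (λ i → k * f i) ≡ k * Σᶠ f
    Σᶠ-*ˡ {zero} k f = sym (*-zeroʳ k)
    Σᶠ-*ˡ {suc m} k f = trans (cong (λ z → k * f zero + z) (Σᶠ-*ˡ k (f ∘ suc))) (sym (*-distribˡ-+ k (f zero) (Σᶠ (f ∘ suc))))

    Σᶠ-sub : ∀ {m} (f g : Fin m → ℚ) → Σᶠ (λ i → f i - g i) ≡ Σᶠ f - Σᶠ g
    Σᶠ-sub f g = trans (Σᶠ-+ f (λ i → - g i)) (cong (λ z → Σᶠ f + z)
      (trans (Σᶠ-cong λ i → lem (g i)) (trans (Σᶠ-*ˡ (- 1ℚ) g) (sym (lem (Σᶠ g))))))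
      where lem : ∀ a → - a ≡ - 1ℚ * a
            lem = solve-∀ ℚ-ring

    Σᶠ-single : ∀ {m} (f : Fin m → ℚ) j → (∀ k → ¬ k ≡ j → f k ≡ 0ℚ) → Σᶠ f ≡ f j
    Σᶠ-single {m} f j h = trans (sym (+-identityʳ (Σᶠ f))) (trans (cong (_+ 0ℚ) (Σᶠ≡Σℚ f))
      (trans (Σℚ-differ-at-one f (λ _ → 0ℚ) j h) (trans (cong (_+ f j) (trans (sym (Σᶠ≡Σℚ {m} (λ _ → 0ℚ))) (Σᶠ-zero m))) (+-identityˡ (f j)))))

    Σᶠ-all-zero : ∀ {m} (f : Fin m → ℚ) → (∀ k → f k ≡ 0ℚ) → Σᶠ f ≡ 0ℚ
    Σᶠ-all-zero {m} f h = trans (Σᶠ-cong h) (Σᶠ-zero m)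

    Σᵥ-InE : ∀ {m} (k : Fin m → ℚ) (β : Fin m → Pt) → (∀ i → InE (β i)) → InE (Σᵥ (λ i → k i ·ᵥ β i))
    Σᵥ-InE {zero} k β h = Σᶠ-zero N
    Σᵥ-InE {suc m} k β h = trans (Σᶠ-+ (k zero ·ᵥ β zero) (Σᵥ (λ i → k (suc i) ·ᵥ β (suc i))))
      (trans (cong₂ _+_ (trans (Σᶠ-*ˡ (k zero) (β zero)) (trans (cong (k zero *_) (h zero)) (*-zeroʳ (k zero))))
        (Σᵥ-InE (k ∘ suc) (β ∘ suc) (h ∘ suc))) (+-identityˡ 0ℚ))

    rootsum : (Fin n → ℤ) → Pt
    rootsum e = Σᵥ (λ i → ℤ→ℚ (e i) ·ᵥ α i)

    rootsum-ι : ∀ e c → rootsum e c ≡ ι (rootℤ e c)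
    rootsum-ι e c = trans (Σᶠ-cong {n} λ i → trans (cong (_* α i c) (ι-def (e i))) (lem (ι (e i)) (ε (inject₁ i) c) (ε (suc i) c)))
      (trans (Σᶠ-sub {n} (λ i → ι (e i) * ε (inject₁ i) c) (λ i → ι (e i) * ε (suc i) c)) (trans (cong₂ _-_ (upper (last? c)) (lower c)) (sym (ι-sub (hi e c) (lo ℤ.0ℤ e c)))))
      where
      lem : ∀ k a b → k * (a - b) ≡ k * a - k * b
      lem = solve-∀ ℚ-ring
      zero-term : ∀ k {i j} → ¬ i ≡ j → k * ε i j ≡ 0ℚ
      zero-term k i≢j = trans (cong (k *_) (ε-diff i≢j)) (*-zeroʳ k)
      one-term : ∀ k i → k * ε i i ≡ k
      one-term k i = trans (cong (k *_) (ε-same i)) (*-identityʳ k)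
      upper : (c ≡ fromℕ n) ⊎ (∃ λ j → c ≡ inject₁ j) → Σᶠ {n} (λ i → ι (e i) * ε (inject₁ i) c) ≡ ι (hi e c)
      upper (inj₁ refl) = trans (Σᶠ-all-zero {n} (λ i → ι (e i) * ε (inject₁ i) (fromℕ n)) λ i → zero-term (ι (e i)) {inject₁ i} {fromℕ n} (fromℕ≢inject₁ i))
        (sym (trans (cong ι (hi-last e)) ι-0))
      upper (inj₂ (j , refl)) = trans (Σᶠ-single {n} (λ i → ι (e i) * ε (inject₁ i) (inject₁ j)) j λ i i≢j → zero-term (ι (e i)) {inject₁ i} {inject₁ j} (i≢j ∘ Finₚ.inject₁-injective))
        (trans (one-term (ι (e j)) (inject₁ j)) (cong ι (sym (hi-inject₁ e j))))
      lower : ∀ c → Σᶠ {n} (λ i → ι (e i) * ε (suc i) c) ≡ ι (lo ℤ.0ℤ e c)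
      lower zero = trans (Σᶠ-all-zero {n} (λ i → ι (e i) * ε (suc i) zero) λ i → zero-term (ι (e i)) {suc i} {zero} λ ()) (sym ι-0)
      lower (suc j) = trans (Σᶠ-single {n} (λ i → ι (e i) * ε (suc i) (suc j)) j λ i i≢j → zero-term (ι (e i)) {suc i} {suc j} (i≢j ∘ Finₚ.suc-injective)) (one-term (ι (e j)) (suc j))

    rootsum-cong : ∀ {e e′ : Fin n → ℤ} → (∀ i → e i ≡ e′ i) → rootsum e ≐ rootsum e′
    rootsum-cong h c = Σᶠ-cong {n} λ i → cong (λ z → ℤ→ℚ z * α i c) (h i)

    rootsum-+ : ∀ e e′ c → rootsum (λ i → e i ℤ.+ e′ i) c ≡ rootsum e c + rootsum e′ c
    rootsum-+ e e′ c = trans (Σᶠ-cong {n} λ i → trans (cong (_* α i c) (trans (ι-def (e i ℤ.+ e′ i)) (trans (ι-+ (e i) (e′ i)) (sym (cong₂ _+_ (ι-def (e i)) (ι-def (e′ i)))))))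
      (*-distribʳ-+ (α i c) (ℤ→ℚ (e i)) (ℤ→ℚ (e′ i)))) (Σᶠ-+ {n} (λ i → ℤ→ℚ (e i) * α i c) (λ i → ℤ→ℚ (e′ i) * α i c))

    rootsum-0 : ∀ c → rootsum (λ _ → ℤ.0ℤ) c ≡ 0ℚ
    rootsum-0 c = Σᶠ-all-zero {n} (λ i → ℤ→ℚ ℤ.0ℤ * α i c) λ i → trans (cong (_* α i c) (trans (ι-def ℤ.0ℤ) ι-0)) (*-zeroˡ (α i c))

    rootsum-neg : ∀ e c → rootsum (λ i → ℤ.- e i) c ≡ - rootsum e c
    rootsum-neg e c = trans (lem (rootsum (λ i → ℤ.- e i) c) (rootsum e c))
      (trans (cong (_- rootsum e c) (trans (sym (rootsum-+ (λ i → ℤ.- e i) e c))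
        (trans (rootsum-cong (λ i → ℤₚ.+-inverseˡ (e i)) c) (rootsum-0 c)))) (+-identityˡ (- rootsum e c)))
      where lem : ∀ a b → a ≡ a + b - b
            lem = solve-∀ ℚ-ring

    root-InE : ∀ {i j} → ¬ i ≡ j → InE (root i j)
    root-InE {i} {j} i≢j = trans (sym (+-identityʳ (Σᶠ (root i j)))) (trans (Σᶠ-differ (root i j) (λ _ → 0ℚ) i j i≢j (root-off i≢j))
      (trans (cong₂ _+_ (Σᶠ-zero N) (cong₂ _+_ (root-fst i≢j) (root-snd i≢j))) refl))

    rootsum-InE : ∀ e → InE (rootsum e)
    rootsum-InE e = Σᵥ-InE (λ i → ℤ→ℚ (e i)) α (λ i → root-InE (inject₁≢suc i))

    indicator : ℕ → ℕ → ℚ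
    indicator i j = if does (j ℕ.≤? i) then 1ℚ else 0ℚ

    indicator-≤ : ∀ {i j} → j ℕ.≤ i → indicator i j ≡ 1ℚ
    indicator-≤ {i} {j} p = cong (λ b → if b then 1ℚ else 0ℚ) (dec-true (j ℕ.≤? i) p)

    indicator-≰ : ∀ {i j} → ¬ j ℕ.≤ i → indicator i j ≡ 0ℚ
    indicator-≰ {i} {j} p = cong (λ b → if b then 1ℚ else 0ℚ) (dec-false (j ℕ.≤? i) p)

    indicator-suc : ∀ i j → indicator (suc i) (suc j) ≡ indicator i j
    indicator-suc i j with j ℕ.≤? i
    ... | yes p = trans (indicator-≤ (ℕ.s≤s p)) (sym (indicator-≤ p))
    ... | no ¬p = trans (indicator-≰ {suc i} {suc j} (¬p ∘ ℕ.s≤s⁻¹)) (sym (indicator-≰ ¬p))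

    Σ-indicator : ∀ m i → i ℕ.< m → Σᶠ {m} (λ j → indicator i (toℕ j)) ≡ ι (+ suc i)
    Σ-indicator (suc m) zero _ = trans (cong₂ _+_ (indicator-≤ {0} {0} ℕ.z≤n) (Σᶠ-all-zero {m} (λ j → indicator 0 (suc (toℕ j))) λ j → indicator-≰ {0} {suc (toℕ j)} λ ())) (sym ι-1)
    Σ-indicator (suc m) (suc i) (ℕ.s≤s p) = trans (cong₂ _+_ (trans (indicator-≤ {suc i} {0} ℕ.z≤n) (sym ι-1))
      (trans (Σᶠ-cong {m} λ j → indicator-suc i (toℕ j)) (Σ-indicator m i p))) (sym (ι-+ (+ 1) (+ suc i)))

    Σᶠ-const : ∀ m k → Σᶠ {m} (λ _ → k) ≡ ι (+ m) * k
    Σᶠ-const zero k = sym (trans (cong (_* k) ι-0) (*-zeroˡ k))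
    Σᶠ-const (suc m) k = trans (cong (λ z → k + z) (Σᶠ-const m k)) (trans (lem k (ι (+ m))) (cong (_* k) (trans (cong (_+ ι (+ m)) (sym ι-1)) (sym (ι-+ (+ 1) (+ m))))))
      where lem : ∀ k m → k + m * k ≡ (1ℚ + m) * k
            lem = solve-∀ ℚ-ring

    ϖ-InE : ∀ i → InE (ϖ i)
    ϖ-InE i = trans (Σᶠ-sub {N} (λ j → indicator (toℕ i) (toℕ j)) (λ _ → + suc (toℕ i) / N))
      (trans (cong₂ _-_ (Σ-indicator N (toℕ i) (ℕₚ.m≤n⇒m≤1+n (Finₚ.toℕ<n i)))
        (trans (Σᶠ-const N (+ suc (toℕ i) / N)) (trans (cong (ι (+ N) *_) (/-scale (+ suc (toℕ i)) n))
          (trans (lem (ι (+ N)) (ι (+ suc (toℕ i))) (+ 1 / N)) (trans (cong (ι (+ suc (toℕ i)) *_) (/-unit n)) (*-identityʳ (ι (+ suc (toℕ i)))))))))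
      (+-inverseʳ (ι (+ suc (toℕ i)))))
      where lem : ∀ a b c → a * (b * c) ≡ b * (a * c)
            lem = solve-∀ ℚ-ring

    ϖ-diff-off : ∀ i j → ¬ i ≡ j → ϖ i (inject₁ j) - ϖ i (suc j) ≡ 0ℚ
    ϖ-diff-off i j i≢j = trans (cong (λ z → (z - + suc (toℕ i) / N) - ϖ i (suc j)) (trans (cong (indicator (toℕ i)) (Finₚ.toℕ-inject₁ j)) same)) (+-inverseʳ (ϖ i (suc j)))
      where
      same : indicator (toℕ i) (toℕ j) ≡ indicator (toℕ i) (suc (toℕ j))
      same with suc (toℕ j) ℕ.≤? toℕ i
      ... | yes p = trans (indicator-≤ (ℕₚ.<⇒≤ p)) (sym (indicator-≤ p))
      ... | no ¬p = trans (indicator-≰ {toℕ i} {toℕ j} λ q → ¬p (ℕₚ.≤∧≢⇒< q (λ e → i≢j (sym (Finₚ.toℕ-injective e))))) (sym (indicator-≰ ¬p))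

    ϖ-diff-at : ∀ i → ϖ i (inject₁ i) - ϖ i (suc i) ≡ 1ℚ
    ϖ-diff-at i = trans (cong₂ (λ a b → (a - q) - (b - q))
        (trans (cong (indicator (toℕ i)) (Finₚ.toℕ-inject₁ i)) (indicator-≤ {toℕ i} {toℕ i} ℕₚ.≤-refl))
        (indicator-≰ {toℕ i} {suc (toℕ i)} (ℕₚ.<-irrefl refl))) (lem q)
      where
      q = + suc (toℕ i) / N
      lem : ∀ q → (1ℚ - q) - (0ℚ - q) ≡ 1ℚ
      lem = solve-∀ ℚ-ring

    weight : (Fin n → ℤ) → Pt
    weight c = Σᵥ (λ i → ℤ→ℚ (c i) ·ᵥ ϖ i)

    weight-InE : ∀ c → InE (weight c)
    weight-InE c = Σᵥ-InE (λ i → ℤ→ℚ (c i)) ϖ ϖ-InE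

    weight-diff : ∀ c j → weight c (inject₁ j) - weight c (suc j) ≡ ι (c j)
    weight-diff c j = trans (sym (Σᶠ-sub {n} (λ i → ℤ→ℚ (c i) * ϖ i (inject₁ j)) (λ i → ℤ→ℚ (c i) * ϖ i (suc j)))) (trans (Σᶠ-cong {n} λ i → lem (ℤ→ℚ (c i)) (ϖ i (inject₁ j)) (ϖ i (suc j)))
      (trans (Σᶠ-single {n} (λ i → ℤ→ℚ (c i) * (ϖ i (inject₁ j) - ϖ i (suc j))) j λ i i≢j → trans (cong (ℤ→ℚ (c i) *_) (ϖ-diff-off i j i≢j)) (*-zeroʳ (ℤ→ℚ (c i))))
      (trans (cong (ℤ→ℚ (c j) *_) (ϖ-diff-at j)) (trans (*-identityʳ (ℤ→ℚ (c j))) (ι-def (c j))))))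
      where lem : ∀ k a b → k * a - k * b ≡ k * (a - b)
            lem = solve-∀ ℚ-ring

    -- The difference has equal coordinates, and N times their common value is 0.
    diffs-determine : ∀ y z → InE y → InE z → (∀ i → y (inject₁ i) - y (suc i) ≡ z (inject₁ i) - z (suc i)) → y ≐ z
    diffs-determine y z y∈E z∈E h c = trans (lem₁ (y c) (z c)) (trans (cong (_+ z c) (trans (const c) w₀≡0)) (+-identityˡ (z c)))
      where
      w : Pt
      w = y -ᵥ z
      lem₁ : ∀ a b → a ≡ a - b + b
      lem₁ = solve-∀ ℚ-ring
      lem₂ : ∀ a b c d → a - b ≡ (c - d) + ((a - c) - (b - d))
      lem₂ = solve-∀ ℚ-ring
      const : ∀ c → w c ≡ w zero
      const = constant w λ i → trans (lem₂ (y (inject₁ i)) (z (inject₁ i)) (y (suc i)) (z (suc i)))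
        (trans (cong (λ t → w (suc i) + (t - (z (inject₁ i) - z (suc i)))) (h i)) (trans (cong (λ t → w (suc i) + t) (+-inverseʳ (z (inject₁ i) - z (suc i)))) (+-identityʳ (w (suc i)))))
      Nw≡0 : ι (+ N) * w zero ≡ 0ℚ
      Nw≡0 = trans (sym (Σᶠ-const N (w zero))) (trans (Σᶠ-cong {N} (λ c → sym (const c))) (trans (Σᶠ-sub {N} y z) (trans (cong₂ _-_ y∈E z∈E) refl)))
      lem₃ : ∀ w N k → N * k * w ≡ k * (N * w)
      lem₃ = solve-∀ ℚ-ring
      w₀≡0 : w zero ≡ 0ℚ
      w₀≡0 = trans (sym (*-identityˡ (w zero))) (trans (cong (_* w zero) (sym (/-unit n)))
        (trans (lem₃ (w zero) (ι (+ N)) (+ 1 / N)) (trans (cong ((+ 1 / N) *_) Nw≡0) (*-zeroʳ (+ 1 / N)))))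

    -- In E a weight is determined by its pairings with the simple roots, so these integers replace
    -- the expansion in `ϖ`, and a translation by roots just adds `rootDiff`.
    record DominantData (l : Pt) : Set where
      field
        coeff   : Fin n → ℤ
        l∈E     : InE l
        l-diff  : ∀ i → l (inject₁ i) - l (suc i) ≡ ι (coeff i)
        coeff≥0 : ∀ i → ℤ.0ℤ ℤ.≤ coeff i

    open DominantData public

    dominant-data : ∀ {l} → Dominant l → DominantData l
    dominant-data {l} ((c , e) , dom) = record
      { coeff = c
      ; l∈E = trans (Σᶠ-cong e) (weight-InE c)
      ; l-diff = diff
      ; coeff≥0 = λ i → ι-cancel-≤ (subst₂ _≤_ (sym ι-0) (trans (inner-α l i) (diff i)) (dom i)) }
      where
      diff : ∀ i → l (inject₁ i) - l (suc i) ≡ ι (c i)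
      diff i = trans (cong₂ _-_ (e (inject₁ i)) (e (suc i))) (weight-diff c i)

    data-dominant : ∀ {l} → DominantData l → Dominant l
    data-dominant {l} D = (coeff D , diffs-determine l (weight (coeff D)) (l∈E D) (weight-InE (coeff D))
        (λ i → trans (l-diff D i) (sym (weight-diff (coeff D) i)))) ,
      λ i → subst₂ _≤_ ι-0 (sym (trans (inner-α l i) (l-diff D i))) (ι-mono-≤ (coeff≥0 D i))

    diff-shift : ∀ {l μ : Pt} (D : DominantData l) e → (∀ c → μ c ≡ l c + rootsum e c) → ∀ i →
                 μ (inject₁ i) - μ (suc i) ≡ ι (coeff D i ℤ.+ rootDiff e i)
    diff-shift {l} {μ} D e h i = trans (cong₂ _-_ (h (inject₁ i)) (h (suc i)))
      (trans (lem (l (inject₁ i)) (l (suc i)) (rootsum e (inject₁ i)) (rootsum e (suc i)))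
      (trans (cong₂ _+_ (l-diff D i) (trans (cong₂ _-_ (rootsum-ι e (inject₁ i)) (rootsum-ι e (suc i))) (sym (ι-sub (rootℤ e (inject₁ i)) (rootℤ e (suc i))))))
      (sym (ι-+ (coeff D i) (rootDiff e i)))))
      where lem : ∀ a b c d → (a + c) - (b + d) ≡ (a - b) + (c - d)
            lem = solve-∀ ℚ-ring

    shift-data : ∀ {l μ : Pt} (D : DominantData l) e → (∀ c → μ c ≡ l c + rootsum e c) →
                 (∀ i → ℤ.0ℤ ℤ.≤ coeff D i ℤ.+ rootDiff e i) → DominantData μ
    shift-data {l} {μ} D e h pos = record
      { coeff = λ i → coeff D i ℤ.+ rootDiff e i
      ; l∈E = trans (Σᶠ-cong {N} h) (trans (Σᶠ-+ {N} l (rootsum e)) (trans (cong₂ _+_ (l∈E D) (rootsum-InE e)) refl))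
      ; l-diff = diff-shift {l} {μ} D e h
      ; coeff≥0 = pos }

    dominant-shift-≥0 : ∀ {l μ : Pt} (D : DominantData l) e → (∀ c → μ c ≡ l c + rootsum e c) → Dominant μ →
                        ∀ i → ℤ.0ℤ ℤ.≤ coeff D i ℤ.+ rootDiff e i
    dominant-shift-≥0 {l} {μ} D e h dom i = ι-cancel-≤ (subst₂ _≤_ (sym ι-0)
      (trans (inner-α μ i) (diff-shift {l} {μ} D e h i)) (proj₂ dom i))

-- Ideals, least weights and Paper Boats.

module PaperBoats where

  open import Data.Nat as ℕ using (ℕ; zero; suc)
  import Data.Nat.Properties as ℕₚ
  open import Data.Fin as Fin using (Fin; zero; suc; toℕ; inject₁; opposite; fromℕ<)
  import Data.Fin.Properties as Finₚ
  open import Data.Fin.Subset using (Subset)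
  open import Data.Integer hiding (suc; pos)
  open import Data.Integer.Properties
  import Data.Integer.Tactic.RingSolver as ℤSolver
  open import Data.Rational as ℚ using (ℚ; 0ℚ; 1ℚ)
  import Data.Rational.Properties as ℚₚ
  open import Data.List using (List; []; _∷_; _++_)
  open import Data.Product using (Σ; ∃; _×_; _,_; proj₁; proj₂)
  open import Data.Empty using (⊥; ⊥-elim)
  open import Function using (_∘_; id)
  open import Relation.Nullary using (¬_; Dec; yes; no)
  open import Relation.Nullary.Decidable using (_×-dec_; _→-dec_)
  open import Relation.Binary.PropositionalEquality
  open import Tactic.RingSolver using (solve-∀)

  open IntegerResidues
  open Majorisation
  open RationalEmbedding
  open RootCombinations
  open DominantWeights

  module Boats (n′ : ℕ) where
    open Weights n′ public

    -- Two reflections in parallel hyperplanes compose to a translation, so W_aff contains the root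
    -- lattice.
    double-reflection : ∀ {i j} → ¬ i ≡ j → ∀ k y c →
                        sref (root i j) k (sref (root i j) (+ 0) y) c ≡ y c ℚ.+ ι k ℚ.* root i j c
    double-reflection {i} {j} i≢j k y c = by (c Fin.≟ i) (c Fin.≟ j)
      where
      y′ = sref (root i j) (+ 0) y
      lem₁ : ∀ a k → a ℚ.- 0ℚ ℚ.+ k ≡ a ℚ.+ k ℚ.* 1ℚ
      lem₁ = solve-∀ ℚ-ring
      lem₂ : ∀ a k → a ℚ.+ 0ℚ ℚ.- k ≡ a ℚ.+ k ℚ.* (ℚ.- 1ℚ)
      lem₂ = solve-∀ ℚ-ring
      lem₃ : ∀ a k → a ≡ a ℚ.+ k ℚ.* 0ℚ
      lem₃ = solve-∀ ℚ-ring
      by : Dec (c ≡ i) → Dec (c ≡ j) → sref (root i j) k y′ c ≡ y c ℚ.+ ι k ℚ.* root i j c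
      by (yes refl) _ = trans (sref-fst i≢j k y′) (trans (cong (ℚ._+ ι k) (trans (sref-snd i≢j (+ 0) y) (cong (λ z → y i ℚ.- z) ι-0)))
        (trans (lem₁ (y i) (ι k)) (cong (λ z → y i ℚ.+ ι k ℚ.* z) (sym (root-fst i≢j)))))
      by (no _) (yes refl) = trans (sref-snd i≢j k y′) (trans (cong (ℚ._- ι k) (trans (sref-fst i≢j (+ 0) y) (cong (λ z → y j ℚ.+ z) ι-0)))
        (trans (lem₂ (y j) (ι k)) (cong (λ z → y j ℚ.+ ι k ℚ.* z) (sym (root-snd i≢j)))))
      by (no p) (no q) = trans (sref-off i≢j k y′ c p q) (trans (sref-off i≢j (+ 0) y c p q)
        (trans (lem₃ (y c) (ι k)) (cong (λ z → y c ℚ.+ ι k ℚ.* z) (sym (root-off i≢j c p q)))))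

    translation-list : ∀ {m} (g : Fin m → Fin n) (e : Fin m → ℤ) →
                       ∃ λ rs → ∀ x c → rprod rs x c ≡ x c ℚ.+ Σᵥ (λ k → ℤ→ℚ (e k) ·ᵥ α (g k)) c
    translation-list {zero} g e = [] , λ x c → sym (ℚₚ.+-identityʳ (x c))
    translation-list {suc m} g e with translation-list (g ∘ suc) (e ∘ suc)
    ... | rs , h = (i , j , i≢j , e zero) ∷ (i , j , i≢j , + 0) ∷ rs , λ x c →
          trans (double-reflection i≢j (e zero) (rprod rs x) c)
          (trans (cong₂ (λ p q → p ℚ.+ q ℚ.* α (g zero) c) (h x c) (sym (ι-def (e zero))))
          (lem (x c) (Σᵥ (λ k → ℤ→ℚ (e (suc k)) ·ᵥ α (g (suc k))) c) (ℤ→ℚ (e zero) ℚ.* α (g zero) c)))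
      where
      i = inject₁ (g zero)
      j = suc (g zero)
      i≢j = inject₁≢suc (g zero)
      lem : ∀ x s t → x ℚ.+ s ℚ.+ t ≡ x ℚ.+ (t ℚ.+ s)
      lem = solve-∀ ℚ-ring

    rprod-++ : ∀ rs rs′ x → rprod (rs ++ rs′) x ≡ rprod rs (rprod rs′ x)
    rprod-++ [] rs′ x = refl
    rprod-++ (r ∷ rs) rs′ x = cong (rmap r) (rprod-++ rs rs′ x)

    shiftMap : Map → (Fin n → ℤ) → Map
    shiftMap θ e x = θ x +ᵥ rootsum e

    shift-IsW : ∀ {θ} e → IsW θ → IsW (shiftMap θ e)
    shift-IsW {θ} e (rs , h) = proj₁ T ++ rs , λ x x∈E c → trans (cong (ℚ._+ rootsum e c) (h x x∈E c))
        (sym (trans (cong (λ y → y c) (rprod-++ (proj₁ T) rs x)) (proj₂ T (rprod rs x) c)))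
      where T = translation-list id e

    Shifts : Pt → (Fin n → ℤ) → Pt → Set
    Shifts l e μ = ∀ c → μ c ≡ l c ℚ.+ rootsum e c

    shift-IsTheta : ∀ {a l μ θ} e → Shifts l e μ → IsTheta a l θ → IsTheta a μ (shiftMap θ e)
    shift-IsTheta {a} {l} {μ} {θ} e h (θ∈W , iff) = shift-IsW e θ∈W , λ y → to y , from y
      where
      r = rootsum e
      lem₁ : ∀ t r → t ≡ t ℚ.+ r ℚ.- r
      lem₁ = solve-∀ ℚ-ring
      lem₂ : ∀ y r l → y ℚ.- r ℚ.- l ≡ y ℚ.- (l ℚ.+ r)
      lem₂ = solve-∀ ℚ-ring
      lem₃ : ∀ y r → y ℚ.- r ℚ.+ r ≡ y
      lem₃ = solve-∀ ℚ-ring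
      same : ∀ y c → (y -ᵥ r) c ℚ.- l c ≡ y c ℚ.- μ c
      same y c = trans (lem₂ (y c) (r c) (l c)) (cong (λ z → y c ℚ.- z) (sym (h c)))
      to : ∀ y → InAlc (shiftMap θ e) y → InAlc (w₀ ∘ a) (y -ᵥ μ)
      to y (x , aid , q) = back (proj₁ (iff (y -ᵥ r)) (x , aid , λ c → trans (lem₁ (θ x c) (r c)) (cong (ℚ._- r c) (q c))))
        where back : InAlc (w₀ ∘ a) ((y -ᵥ r) -ᵥ l) → InAlc (w₀ ∘ a) (y -ᵥ μ)
              back (x , aid , q) = x , aid , λ c → trans (q c) (same y c)
      from : ∀ y → InAlc (w₀ ∘ a) (y -ᵥ μ) → InAlc (shiftMap θ e) y
      from y (x , aid , q) = back (proj₂ (iff (y -ᵥ r)) (x , aid , λ c → trans (q c) (sym (same y c))))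
        where back : InAlc θ (y -ᵥ r) → InAlc (shiftMap θ e) y
              back (x , aid , q) = x , aid , λ c → trans (cong (ℚ._+ r c) (q c)) (lem₃ (y c) (r c))

    bary-at : ∀ {f} u → f ≈ prod u → ∀ c → f bary c ≡ hat bary (u ⟪ ⟦ c ⟧ ⟫)
    bary-at u f≈u c = trans (f≈u bary bary-InE c) (prod-act u bary c)

    -- Adding an integer r to a coordinate is the same as moving its position in `hat bary` by r N,
    -- and `hat bary` is injective.
    window-shift : ∀ {θ} e u u′ → θ ≈ prod u → shiftMap θ e ≈ prod u′ →
                   ∀ c → u′ ⟪ ⟦ c ⟧ ⟫ ≡ u ⟪ ⟦ c ⟧ ⟫ + rootℤ e c * Nℤ
    window-shift {θ} e u u′ θ≈u θ′≈u′ c = hat-bary-injective (trans (sym (bary-at u′ θ′≈u′ c))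
      (trans (cong₂ ℚ._+_ (bary-at u θ≈u c) (rootsum-ι e c)) (sym (hat-shift bary (u ⟪ ⟦ c ⟧ ⟫) (rootℤ e c)))))

    psum-shifted : ∀ {θ} e u u′ → θ ≈ prod u → shiftMap θ e ≈ prod u′ →
                   ∀ m k → psum k (vert (W u′) m) ≡ psum k (vert (W u) m) + E e k
    psum-shifted e u u′ θ≈u θ′≈u′ m k = trans (psum-cong k verts)
        (trans (psum-+ k (vert (W u) m) (rootℤ e)) (cong (λ z → psum k (vert (W u) m) + z) (psum-root e k)))
      where
      lem : ∀ w r m → w + r - m ≡ w - m + r
      lem = ℤSolver.solve-∀
      verts : ∀ c → vert (W u′) m c ≡ vert (W u) m c + rootℤ e c
      verts c = trans (cong (λ z → fl (z - m)) (window-shift e u u′ θ≈u θ′≈u′ c))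
        (trans (cong fl (lem (u ⟪ ⟦ c ⟧ ⟫) (rootℤ e c * Nℤ) m)) (fl-shift (u ⟪ ⟦ c ⟧ ⟫ - m) (rootℤ e c)))

    theta-unique : ∀ {a μ θ₁ θ₂} u₁ u₂ → θ₁ ≈ prod u₁ → θ₂ ≈ prod u₂ → IsTheta a μ θ₁ → IsTheta a μ θ₂ → u₁ ≋ u₂
    theta-unique {a} {μ} {θ₁} {θ₂} u₁ u₂ θ₁≈ θ₂≈ (_ , iff₁) (_ , iff₂) =
        meet (proj₂ (iff₁ (θ₂ bary)) (proj₁ (iff₂ (θ₂ bary)) (bary , bary-Aid , λ _ → refl)))
      where
      meet : InAlc θ₁ (θ₂ bary) → u₁ ≋ u₂
      meet (x , aid , e) = same-alcove u₁ u₂ x aid λ c →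
        trans (sym (θ₁≈ x (proj₁ aid) c)) (trans (e c) (θ₂≈ bary bary-InE c))

    -- `w₀` turns Π⁻ into Π⁺, so the barycentre of the alcove of `θ` is `l` plus a point of Π⁺. Both
    -- have weakly decreasing coordinates, and `hat bary` reflects the order.
    theta-Dom : ∀ {a l θ} u → InF a → Dominant l → IsTheta a l θ → θ ≈ prod u → Dom u
    theta-Dom {a} {l} {θ} u (_ , a⊂Π⁻) (_ , l≥0) (_ , iff) θ≈u = steps⇒decreasing (λ c → u ⟪ ⟦ c ⟧ ⟫) λ i →
        hat-bary-cancel-≤ (subst₂ ℚ._≤_ (bary-at u θ≈u (suc i)) (bary-at u θ≈u (inject₁ i)) (decreasing i))
      where
      in-box : InAlc (w₀ ∘ a) (θ bary -ᵥ l) → ∃ λ z → Π⁺ z × (∀ c → θ bary c ≡ l c ℚ.+ z c)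
      in-box (x , aid , e) with a⊂Π⁻ (a x) (x , aid , λ _ → refl)
      ... | z , z∈Π , w₀z≐ax = z , z∈Π , λ c → trans (lem (θ bary c) (l c)) (cong (λ y → l c ℚ.+ y)
            (trans (sym (e c)) (trans (sym (w₀z≐ax (opposite c))) (cong z (Finₚ.opposite-involutive c)))))
        where lem : ∀ t l → t ≡ l ℚ.+ (t ℚ.- l)
              lem = solve-∀ ℚ-ring
      box : ∃ λ z → Π⁺ z × (∀ c → θ bary c ≡ l c ℚ.+ z c)
      box = in-box (proj₁ (iff (θ bary)) (bary , bary-Aid , λ _ → refl))
      descends : ∀ y i → 0ℚ ℚ.≤ AType.⟨_,_⟩ n y (α i) → y (suc i) ℚ.≤ y (inject₁ i)
      descends y i p = 0≤⇒≤ (subst (0ℚ ℚ.≤_) (inner-α y i) p)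
      decreasing : ∀ i → θ bary (suc i) ℚ.≤ θ bary (inject₁ i)
      decreasing i = subst₂ ℚ._≤_ (sym (proj₂ (proj₂ box) (suc i))) (sym (proj₂ (proj₂ box) (inject₁ i)))
        (ℚₚ.+-mono-≤ (descends l i (l≥0 i)) (descends (proj₁ box) i (proj₁ (proj₂ (proj₁ (proj₂ box)) i))))

    -- For μ = l + Σ e_i α_i, the vertices of θ_a(μ) are those of θ_a(l) translated by Σ e_i α_i.
    module Ideal {a : Map} (a∈F : InF a) {l : Pt} {θ : Map} (θ-l : IsTheta a l θ) (u : Word) (θ≈u : θ ≈ prod u)
                 {x : Map} (x∈W : IsW x) (ux : Word) (x≈ux : x ≈ prod ux) where

      -- Majorisation of `ux` by the translate of `u` along Σ e_i α_i, with the partial sums of the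
      -- translate expressed through those of `u`.
      Feas : (Fin n → ℤ) → Set
      Feas e = ∀ m K → ssum K (vert (W ux) m) ≤ psum (card K) (vert (W u) m) + E e (card K)

      module _ {μ : Pt} (e : Fin n → ℤ) (h : Shifts l e μ) where
        θ′-μ : IsTheta a μ (shiftMap θ e)
        θ′-μ = shift-IsTheta {a} {l} {μ} {θ} e h θ-l

        u′ : Word
        u′ = proj₁ (IsW-word (proj₁ θ′-μ))

        θ′≈u′ : shiftMap θ e ≈ prod u′
        θ′≈u′ = proj₂ (IsW-word (proj₁ θ′-μ))

        Feas⇒InI : Feas e → InI a μ x
        Feas⇒InI f = x∈W , shiftMap θ e , θ′-μ , ⊑⇒≤B {u = ux} {v = u′} x≈ux θ′≈u′ (⋐⇒⊑ {ux} {u′} λ m K →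
          ≤-trans (f m K) (≤-reflexive (sym (psum-shifted e u u′ θ≈u θ′≈u′ m (card K)))))

        InI⇒Feas : Dominant μ → InI a μ x → Feas e
        InI⇒Feas dom (_ , θ₂ , θ₂-μ , x≤θ₂) m K =
            ≤-trans (⊑⇒⋐ {ux} {u′} (theta-Dom {a} {μ} u′ a∈F dom θ′-μ θ′≈u′) ux⊑u′ m K) (≤-reflexive (psum-shifted e u u′ θ≈u θ′≈u′ m (card K)))
          where
          w₂ = IsW-word (proj₁ θ₂-μ)
          ux⊑u′ : ux ⊑ u′
          ux⊑u′ = ⊑-respʳ {ux} {proj₁ w₂} {u′} (≤B⇒⊑ {u = ux} {v = proj₁ w₂} x≈ux (proj₂ w₂) x≤θ₂)
            (theta-unique {a} {μ} (proj₁ w₂) u′ (proj₂ w₂) θ′≈u′ θ₂-μ θ′-μ)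

      Feas-0 : Dominant l → InI a l x → Feas (λ _ → 0ℤ)
      Feas-0 = InI⇒Feas {l} (λ _ → 0ℤ) λ c → sym (trans (cong (λ z → l c ℚ.+ z) (rootsum-0 c)) (ℚₚ.+-identityʳ (l c)))

    E-mono : ∀ {m} {e e′ : Fin m → ℤ} → (∀ i → e i ≤ e′ i) → ∀ k → E e k ≤ E e′ k
    E-mono h zero = ≤-refl
    E-mono h (suc k) = ext-mono h k
      where
      ext-mono : ∀ {m} {e e′ : Fin m → ℤ} → (∀ i → e i ≤ e′ i) → ∀ k → ext e k ≤ ext e′ k
      ext-mono {zero} h k = ≤-refl
      ext-mono {suc m} h zero = h zero
      ext-mono {suc m} h (suc k) = ext-mono (h ∘ suc) k

    pos-of neg-of : (Fin n → ℕ) → Fin n → ℤ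
    pos-of d i = + d i
    neg-of d i = - + d i

    ≼-up : ∀ {l μ} d → (l -ᵥ μ) ≐ rootsum (pos-of d) → Shifts μ (pos-of d) l
    ≼-up {l} {μ} d h c = trans (lem (l c) (μ c)) (cong (λ z → μ c ℚ.+ z) (h c))
      where lem : ∀ l m → l ≡ m ℚ.+ (l ℚ.- m)
            lem = solve-∀ ℚ-ring

    ≼-down : ∀ {l μ} d → (l -ᵥ μ) ≐ rootsum (pos-of d) → Shifts l (neg-of d) μ
    ≼-down {l} {μ} d h c = trans (lem (l c) (μ c)) (cong (λ z → l c ℚ.+ z) (trans (cong ℚ.-_ (h c)) (sym (rootsum-neg (pos-of d) c))))
      where lem : ∀ l m → m ≡ l ℚ.+ ℚ.- (l ℚ.- m)
            lem = solve-∀ ℚ-ring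

    -- The base point is the smaller weight `μ`: passing up to `l` adds a non-negative coefficient
    -- to the right side of every majorisation inequality.
    InI-up : ∀ {a μ l x} → InF a → Dominant μ → μ ≼ l → InI a μ x → InI a l x
    InI-up {a} {μ} {l} {x} a∈F dom (d , h) x∈I@(x∈W , θ , θ-μ , _) =
        Feas⇒InI {l} (pos-of d) (≼-up {l} {μ} d h) λ m K → ≤-trans (Feas-0 dom x∈I m K)
          (+-monoʳ-≤ (psum (card K) (vert (W (proj₁ wθ)) m)) (E-mono {n} {λ _ → 0ℤ} {pos-of d} (λ i → +≤+ ℕ.z≤n) (card K)))
      where
      wθ = IsW-word (proj₁ θ-μ)
      wx = IsW-word x∈W
      open Ideal a∈F θ-μ (proj₁ wθ) (proj₂ wθ) x∈W (proj₁ wx) (proj₂ wx)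

    neg-of-0 : ∀ {l} → Shifts l (neg-of (λ _ → 0)) l
    neg-of-0 {l} c = sym (trans (cong (λ z → l c ℚ.+ z) (rootsum-0 c)) (ℚₚ.+-identityʳ (l c)))

    -- The vertex for `m` is that of its residue, translated along (1, ..., 1). Thus N vertices
    -- suffice, and the constraints become decidable.
    vert-residue : ∀ F m c → vert F m c ≡ vert F ⟦ rm m ⟧ c - fl m
    vert-residue F m c = trans (cong fl (trans (cong (λ z → fun F ⟦ c ⟧ - z) (divmod m)) (lem (fun F ⟦ c ⟧) ⟦ rm m ⟧ (fl m * Nℤ))))
        (fl-sub (fun F ⟦ c ⟧ - ⟦ rm m ⟧) (fl m))
      where lem : ∀ f r k → f - (r + k) ≡ f - r - k
            lem = ℤSolver.solve-∀

    rootsum-injective : ∀ e e′ → rootsum e ≐ rootsum e′ → ∀ i → e i ≡ e′ i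
    rootsum-injective e e′ h = rootℤ-injective e e′ λ c → ι-injective (trans (sym (rootsum-ι e c)) (trans (h c) (rootsum-ι e′ c)))

    ≼-compose : ∀ {l μ ν} d d′ → (l -ᵥ μ) ≐ rootsum (pos-of d) → (μ -ᵥ ν) ≐ rootsum (pos-of d′) →
                (l -ᵥ ν) ≐ rootsum (pos-of (λ i → d i ℕ.+ d′ i))
    ≼-compose {l} {μ} {ν} d d′ h h′ c = trans (lem (l c) (μ c) (ν c)) (trans (cong₂ ℚ._+_ (h c) (h′ c)) (sym (rootsum-+ (pos-of d) (pos-of d′) c)))
      where lem : ∀ l m v → l ℚ.- v ≡ (l ℚ.- m) ℚ.+ (m ℚ.- v)
            lem = solve-∀ ℚ-ring

    zero-coeffs : ∀ {l μ} d → (l -ᵥ μ) ≐ rootsum (pos-of d) → (∀ i → d i ≡ 0) → μ ≐ l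
    zero-coeffs {l} {μ} d h z c = sym (trans (lem (l c) (μ c)) (trans (cong (ℚ._+ μ c) (trans (h c) (trans (rootsum-cong (λ i → cong +_ (z i)) c) (rootsum-0 c)))) (ℚₚ.+-identityˡ (μ c))))
      where lem : ∀ l m → l ≡ l ℚ.- m ℚ.+ m
            lem = solve-∀ ℚ-ring

    module Least {a : Map} (a∈F : InF a) {l : Pt} (dom-l : Dominant l) {x : Map} (x∈I : InI a l x) where
      θ-l = proj₁ (proj₂ (proj₂ x∈I))
      wθ = IsW-word (proj₁ θ-l)
      wx = IsW-word (proj₁ x∈I)
      u = proj₁ wθ
      ux = proj₁ wx
      open Ideal a∈F θ-l u (proj₂ wθ) (proj₁ x∈I) ux (proj₂ wx)

      c₀ : Fin n → ℤ
      c₀ = coeff (dominant-data dom-l)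

      X Y : ℤ → Fin N → ℤ
      X = vert (W ux)
      Y = vert (W u)

      base : ∀ m K → ssum K (X m) ≤ psum (card K) (Y m) + E {n} (λ _ → 0ℤ) (card K)
      base = Feas-0 dom-l x∈I

      -- By `psum-root` the sets of size i + 1 involve only the coefficient `k` of the simple root
      -- i; this is the upper bound that they put on it.
      Fits : Fin n → ℕ → Set
      Fits i k = ∀ r K → card K ≡ suc (toℕ i) → ssum K (X ⟦ r ⟧) ≤ psum (suc (toℕ i)) (Y ⟦ r ⟧) - + k

      P : Fin n → (Fin n → ℕ) → Set
      P i d = (0ℤ ≤ c₀ i + rootDiff (neg-of d) i) × Fits i (d i)

      P? : ∀ i d → Dec (P i d)
      P? i d = (0ℤ ≤? c₀ i + rootDiff (neg-of d) i) ×-dec Finₚ.all? λ r → allSubsets? _ λ K →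
        (card K ℕ.≟ suc (toℕ i)) →-dec (ssum K (X ⟦ r ⟧) ≤? psum (suc (toℕ i)) (Y ⟦ r ⟧) - + d i)

      Feas⇒Fits : ∀ d → Feas (neg-of d) → ∀ i → Fits i (d i)
      Feas⇒Fits d f i r K e = ≤-trans (f ⟦ r ⟧ K) (≤-reflexive (trans (cong (λ k → psum k (Y ⟦ r ⟧) + E (neg-of d) k) e)
        (cong (λ z → psum (suc (toℕ i)) (Y ⟦ r ⟧) + z) (ext-toℕ (neg-of d) i))))

      -- Where `d` and `e` agree at i, constraint i passes from `d` to `e`: `Fits` sees only that
      -- coordinate, and subtracting more of the other roots only helps dominance at i.
      drop : ∀ i d e → (∀ k → d k ℕ.≤ e k) → (∀ k → P k d) → ¬ P i e → d i ℕ.< e i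
      drop i d e d≤e f ¬p = by (d i ℕ.≟ e i)
        where
        by : Dec (d i ≡ e i) → d i ℕ.< e i
        by (no d≢e) = ℕₚ.≤∧≢⇒< (d≤e i) d≢e
        by (yes eq) = ⊥-elim (¬p
          ( ≤-trans (proj₁ (f i)) (+-monoʳ-≤ (c₀ i) (rootDiff-antitone {n} {neg-of e} {neg-of d}
              (λ k → neg-mono-≤ (+≤+ (d≤e k))) i (cong (λ k → - + k) (sym eq))))
          , subst (Fits i) eq (proj₂ (f i))))

      feasible₀ : ∀ k → P k (λ _ → 0)
      feasible₀ k = dominant-shift-≥0 {l} {l} (dominant-data dom-l) (neg-of (λ _ → 0)) (neg-of-0 {l}) dom-l k , Feas⇒Fits (λ _ → 0) base k

      open Greatest P P? drop (λ _ → 0) feasible₀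

      -- A starting bound for the descent: any one inequality for a set of size i + 1 bounds the
      -- i-th coefficient, and the prefix at residue 0 is chosen.
      gapAt : Fin n → ℤ
      gapAt i = psum (suc (toℕ i)) (Y 0ℤ) - ssum (prefix N (suc (toℕ i))) (X 0ℤ)

      bound₀ : Bound (λ i → ∣ gapAt i ∣)
      bound₀ d f i = drop‿+≤+ (≤-trans (swap (ssum (prefix N (suc (toℕ i))) (X 0ℤ)) (psum (suc (toℕ i)) (Y 0ℤ)) (+ d i)
          (proj₂ (f i) zero (prefix N (suc (toℕ i))) (card-prefix (suc (toℕ i)) (ℕₚ.m≤n⇒m≤1+n (Finₚ.toℕ<n i)))))
          (i≤+∣i∣ (gapAt i)))
        where
        lem : ∀ s p d → p - s - d ≡ p - d - s
        lem = ℤSolver.solve-∀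
        swap : ∀ s p d → s ≤ p - d → d ≤ p - s
        swap s p d h = ≤-by (diff≥0 h) (lem s p d)

      best : ∃ λ d → Feasible d × Bound d
      best = greatest (λ i → ∣ gapAt i ∣) bound₀

      d* : Fin n → ℕ
      d* = proj₁ best

      -- For sizes 1 to n, `Fits` at the residue of `m` is shifted to `m` itself; both sides lose
      -- the same multiple of `fl m` since the sets have equal size.
      feasible⇒Feas : ∀ d → Feasible d → Feas (neg-of d)
      feasible⇒Feas d f m K = by (card K) refl
        where
        from-base : E {n} (λ _ → 0ℤ) (card K) ≡ E (neg-of d) (card K) → ssum K (X m) ≤ psum (card K) (Y m) + E (neg-of d) (card K)
        from-base e = ≤-trans (base m K) (≤-reflexive (cong (λ z → psum (card K) (Y m) + z) e))
        lem : ∀ p s r d → p - d - s ≡ p - r + - d - (s - r)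
        lem = ℤSolver.solve-∀
        rearrange : ∀ p s r d → s ≤ p - d → s - r ≤ p - r + - d
        rearrange p s r d h = ≤-by (diff≥0 h) (sym (lem p s r d))
        inside : ∀ i → card K ≡ suc (toℕ i) → ssum K (X m) ≤ psum (card K) (Y m) + E (neg-of d) (card K)
        inside i e = subst₂ _≤_ (sym lhs) (sym rhs)
            (rearrange (psum (suc (toℕ i)) (Y ⟦ rm m ⟧)) (ssum K (X ⟦ rm m ⟧)) (rep (suc (toℕ i)) (fl m)) (+ d i) (proj₂ (f i) (rm m) K e))
          where
          lhs : ssum K (X m) ≡ ssum K (X ⟦ rm m ⟧) - rep (suc (toℕ i)) (fl m)
          lhs = trans (ssum-cong K (vert-residue (W ux) m)) (trans (ssum-shift K (X ⟦ rm m ⟧) (fl m))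
            (cong (λ k → ssum K (X ⟦ rm m ⟧) - rep k (fl m)) e))
          rhs : psum (card K) (Y m) + E (neg-of d) (card K) ≡ psum (suc (toℕ i)) (Y ⟦ rm m ⟧) - rep (suc (toℕ i)) (fl m) + - + d i
          rhs = trans (cong (λ k → psum k (Y m) + E (neg-of d) k) e) (cong₂ _+_
            (trans (psum-cong (suc (toℕ i)) (vert-residue (W u) m)) (psum-shift (suc (toℕ i)) (ℕₚ.m≤n⇒m≤1+n (Finₚ.toℕ<n i)) (Y ⟦ rm m ⟧) (fl m)))
            (ext-toℕ (neg-of d) i))
        by : ∀ k → card K ≡ k → ssum K (X m) ≤ psum (card K) (Y m) + E (neg-of d) (card K)
        by zero e = from-base (trans (cong (E {n} (λ _ → 0ℤ)) e) (sym (cong (E (neg-of d)) e)))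
        by (suc k) e = split (k ℕ.<? n)
          where
          split : Dec (k ℕ.< n) → ssum K (X m) ≤ psum (card K) (Y m) + E (neg-of d) (card K)
          split (yes k<n) = inside (fromℕ< k<n) (trans e (cong suc (sym (Finₚ.toℕ-fromℕ< k<n))))
          -- Only the full set remains. There, as for the empty set, a root combination sums to 0,
          -- so the inequality known for `l` applies unchanged.
          split (no k≮n) = from-base (trans (cong (E {n} (λ _ → 0ℤ)) e) (trans (ext-≥ {n} (λ _ → 0ℤ) k (ℕₚ.≮⇒≥ k≮n))
            (sym (trans (cong (E (neg-of d)) e) (ext-≥ (neg-of d) k (ℕₚ.≮⇒≥ k≮n))))))

      μ* : Pt
      μ* = l -ᵥ rootsum (pos-of d*)

      l-μ* : (l -ᵥ μ*) ≐ rootsum (pos-of d*)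
      l-μ* c = lem (l c) (rootsum (pos-of d*) c)
        where lem : ∀ l r → l ℚ.- (l ℚ.- r) ≡ r
              lem = solve-∀ ℚ-ring

      μ*-shift : Shifts l (neg-of d*) μ*
      μ*-shift = ≼-down {l} {μ*} d* l-μ*

      dom-μ* : Dominant μ*
      dom-μ* = data-dominant (shift-data {l} {μ*} (dominant-data dom-l) (neg-of d*) μ*-shift (λ i → proj₁ (proj₁ (proj₂ best) i)))

      x∈Iμ* : InI a μ* x
      x∈Iμ* = Feas⇒InI {μ*} (neg-of d*) μ*-shift (feasible⇒Feas d* (proj₁ (proj₂ best)))

      maximal : ∀ {ν} d → Dominant ν → (l -ᵥ ν) ≐ rootsum (pos-of d) → InI a ν x → ∀ i → d i ℕ.≤ d* i
      maximal {ν} d dom-ν h x∈Iν = proj₂ (proj₂ best) d λ i →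
        dominant-shift-≥0 {l} {ν} (dominant-data dom-l) (neg-of d) (≼-down {l} {ν} d h) dom-ν i ,
        Feas⇒Fits d (InI⇒Feas {ν} (neg-of d) (≼-down {l} {ν} d h) dom-ν x∈Iν) i

      -- A weight `ν` below `μ*` whose ideal contains `x` has coefficients `d* + d` relative to `l`;
      -- these are at most `d*`, so `d` vanishes and `ν` is `μ*`, which a cover forbids.
      x∈PBμ* : InPB a μ* x
      x∈PBμ* = x∈Iμ* , λ ν dom-ν (( d , h) , ν≢μ* , _) x∈Iν → ν≢μ* (zero-coeffs {μ*} {ν} d h λ i →
        ℕₚ.n≤0⇒n≡0 (ℕₚ.+-cancelˡ-≤ (d* i) (d i) 0 (ℕₚ.≤-trans
          (maximal {ν} (λ i → d* i ℕ.+ d i) dom-ν (≼-compose {l} {μ*} {ν} d* d l-μ* h) x∈Iν i) (ℕₚ.≤-reflexive (sym (ℕₚ.+-identityʳ (d* i)))))))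

    -- Covers suffice: between μ and a smaller weight whose ideal contains x there would be a cover of μ.
    PB-minimal : ∀ k {a x μ κ} → InF a → InPB a μ x → Dominant κ → (f : Fin n → ℕ) → Σℕ f ℕ.≤ k →
                 (μ -ᵥ κ) ≐ rootsum (pos-of f) → InI a κ x → ¬ κ ≐ μ → ⊥
    PB-minimal k {a} {x} {μ} {κ} a∈F pb dom-κ f Σf≤k h x∈Iκ κ≢μ =
        proj₂ pb κ dom-κ ((f , h) , κ≢μ , between k Σf≤k) x∈Iκ
      where
      between : ∀ k → Σℕ f ℕ.≤ k → ∀ ν → Dominant ν → κ ≼ ν → ν ≼ μ → ¬ ν ≐ κ → ¬ ν ≐ μ → ⊥
      -- The ideal of `ν` contains `x` by `InI-up`, and μ - ν has a strictly smaller coefficient sum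
      -- than μ - κ because ν - κ is not zero. So `ν` can replace `κ` in the induction.
      between k Σf≤k ν dom-ν (g , hg) (f′ , hf′) ν≢κ ν≢μ = next k (ℕₚ.≤-trans Σf′<Σf Σf≤k)
        where
        f≡ : ∀ i → f i ≡ f′ i ℕ.+ g i
        f≡ i = +-injective (rootsum-injective (pos-of f) (pos-of (λ i → f′ i ℕ.+ g i))
          (λ c → trans (sym (h c)) (≼-compose {μ} {ν} {κ} f′ g hf′ hg c)) i)
        Σg≢0 : ¬ Σℕ g ≡ 0
        Σg≢0 e = ν≢κ λ c → sym (zero-coeffs {ν} {κ} g hg (Σℕ≡0 g e) c)
        Σf′<Σf : Σℕ f′ ℕ.< Σℕ f
        Σf′<Σf = ℕₚ.<-≤-trans (ℕₚ.m<m+n (Σℕ f′) (ℕₚ.n≢0⇒n>0 Σg≢0)) (ℕₚ.≤-reflexive (sym (trans (Σℕ-cong f≡) (Σℕ-+ f′ g))))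
        next : ∀ k → Σℕ f′ ℕ.< k → ⊥
        next (suc k) lt = PB-minimal k {a} {x} {μ} {ν} a∈F pb dom-ν f′ (ℕₚ.≤-pred lt) hf′ (InI-up a∈F dom-κ (g , hg) x∈Iκ) ν≢μ

    PB-least : ∀ {a l x μ} (a∈F : InF a) (dom-l : Dominant l) (x∈I : InI a l x) → Dominant μ → μ ≼ l → InPB a μ x →
               Least.μ* a∈F dom-l x∈I ≐ μ
    PB-least {a} {l} {x} {μ} a∈F dom-l x∈I dom-μ (d , h) pb = by (Finₚ.all? λ c → μ* c ℚₚ.≟ μ c)
      where
      open Least a∈F dom-l x∈I using (μ*; d*; l-μ*; dom-μ*; x∈Iμ*; maximal)
      f : Fin n → ℕ
      f i = d* i ℕ.∸ d i
      d≤d* : ∀ i → d i ℕ.≤ d* i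
      d≤d* = maximal {μ} d dom-μ h (proj₁ pb)
      lem : ∀ l m m* → m ℚ.- m* ≡ (l ℚ.- m*) ℚ.- (l ℚ.- m)
      lem = solve-∀ ℚ-ring
      lem₂ : ∀ p q → p ℚ.+ q ℚ.- q ≡ p
      lem₂ = solve-∀ ℚ-ring
      μ-μ* : (μ -ᵥ μ*) ≐ rootsum (pos-of f)
      μ-μ* c = trans (lem (l c) (μ c) (μ* c)) (trans (cong₂ ℚ._-_ (trans (l-μ* c)
          (trans (rootsum-cong (λ i → cong +_ (sym (ℕₚ.m∸n+n≡m (d≤d* i)))) c) (rootsum-+ (pos-of f) (pos-of d) c))) (h c))
        (lem₂ (rootsum (pos-of f) c) (rootsum (pos-of d) c)))
      by : Dec (∀ c → μ* c ≡ μ c) → μ* ≐ μ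
      by (yes e) = e
      by (no ¬e) = ⊥-elim (PB-minimal (Σℕ f) {a} {x} {μ} {μ*} a∈F pb dom-μ* f ℕₚ.≤-refl μ-μ* x∈Iμ* ¬e)

open import Data.Nat using (ℕ; suc; _≤_)
open import Data.Product using (_×_; _,_; ∃; proj₁)
open import Relation.Binary.PropositionalEquality using (sym; trans)

theoremA : (n : ℕ) → 1 ≤ n → let open AType n in
    (l : Pt) → Dominant l → (a : Map) → InF a →
      ((x : Map) → IsW x →
         (InI a l x → ∃ λ μ → Dominant μ × (μ ≼ l) × InPB a μ x)
         × ((∃ λ μ → Dominant μ × (μ ≼ l) × InPB a μ x) → InI a l x))
      × ((x : Map) → (μ μ′ : Pt) → Dominant μ → Dominant μ′ → μ ≼ l → μ′ ≼ l →
           InPB a μ x → InPB a μ′ x → μ ≐ μ′)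
theoremA (suc n′) _ l dom-l a a∈F =
    (λ x _ → (λ x∈I → let open Least a∈F dom-l x∈I in μ* , dom-μ* , (d* , l-μ*) , x∈PBμ*)
           , (λ (μ , dom-μ , μ≼l , x∈PB) → InI-up a∈F dom-μ μ≼l (proj₁ x∈PB)))
  , (λ x μ μ′ dom-μ dom-μ′ μ≼l μ′≼l x∈PB x∈PB′ c →
       -- One witness that `x` is in the ideal of `l`, obtained from `μ`, fixes a single `μ*` with
       -- which both weights agree.
       let x∈I = InI-up a∈F dom-μ μ≼l (proj₁ x∈PB) in
       trans (sym (PB-least a∈F dom-l x∈I dom-μ μ≼l x∈PB c))
             (PB-least a∈F dom-l x∈I dom-μ′ μ′≼l x∈PB′ c))
  where open PaperBoats.Boats n′
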